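{- Let $k\ge 3$ and let $\mathbf F$ be a $k$-CNF formula on $n$ variables. There exists a randomized algorithm running in time $O^*\!\left(2^{(1-\frac{1}{k\ln 2})n}\right)$ that takes $\mathbf F$ as input and, if $\mathbf F$ is satisfiable, outputs $z_1^*,z_2^*\in\Omega_{\mathbf F}$ with $$d_H(z_1^*,z_2^*)\ \ge\ \frac12\left(1-\frac{4(k-1)}{(k-2)^2}\right)\cdot\mathrm{Diam}(\mathbf F)$$ with probability $1-o(1)$.
   Context: $\Omega_{\mathbf F}\subseteq\{0,1\}^n$ is the set of satisfying assignments of $\mathbf F$; $d_H$ is Hamming distance; $\mathrm{Diam}(\mathbf F)=\max_{z_1,z_2\in\Omega_{\mathbf F}} d_H(z_1,z_2)$ for satisfiable $\mathbf F$. A $k$-CNF formula is a conjunction of clauses, each a disjunction of at most $k$ literals; formulas have $n^{O(1)}$ clauses. $k$ is a constant and $O^*$ hides factors polynomial in $n$; $o(1)$ is as $n\to\infty$. -}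

module Defs where

open import Data.Bool using (Bool; true; false; if_then_else_)
open import Data.Bool.Properties using () renaming (_≟_ to _≟ᵇ_)
open import Data.Fin using (Fin; toℕ)
open import Data.Integer using (+_)
open import Data.List using (List; []; _∷_; length; map; filter; cartesianProduct; cartesianProductWith)
open import Data.List.Extrema.Nat using (max)
open import Data.List.Relation.Unary.All using (All; all?)
open import Data.List.Relation.Unary.Any using (Any; any?)
open import Data.Maybe as Maybe using (Maybe; just; nothing)
import Data.Maybe.Relation.Unary.Any as MaybeAny
open import Data.Nat using (ℕ; zero; suc; NonZero; >-nonZero; _+_; _*_; _∸_; _^_; _≤_; _≡ᵇ_; z<s)
open import Data.Nat.Properties using (m*n≢0; m^n≢0; m<n⇒0<n∸m; ≤-trans)
open import Data.Product using (_×_; _,_; ∃; ∃₂; ∃-syntax; proj₁; uncurry)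
open import Data.Rational as ℚ using (ℚ; 0ℚ; 1ℚ; ½; _/_)
open import Data.Rational.Properties as ℚₚ using ()
open import Data.Vec as Vec using (Vec; []; _∷_; lookup; zip)
open import Relation.Binary.PropositionalEquality using (_≡_)
open import Relation.Nullary using (Dec; ¬?; _×-dec_)
open import Relation.Unary using (Pred; Decidable)
open import Level using (0ℓ)

bitStrings : ∀ n → List (Vec Bool n)
bitStrings zero    = [] ∷ []
bitStrings (suc n) = cartesianProductWith _∷_ (false ∷ true ∷ []) (bitStrings n)

-- The literal (i , true) is xᵢ and (i , false) is its negation.
Literal Clause CNF Assignment : ℕ → Set
Literal n    = Fin n × Bool
Clause n     = List (Literal n)
CNF n        = List (Clause n)
Assignment n = Vec Bool n

IsKCNF : ∀ {n} → ℕ → CNF n → Set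
IsKCNF k F = All (λ C → length C ≤ k) F

LitTrue : ∀ {n} → Assignment n → Literal n → Set
LitTrue z (i , b) = lookup z i ≡ b

_⊨_ : ∀ {n} → Assignment n → CNF n → Set
z ⊨ F = All (Any (LitTrue z)) F

_⊨?_ : ∀ {n} (z : Assignment n) (F : CNF n) → Dec (z ⊨ F)
z ⊨? F = all? (any? (λ { (i , b) → lookup z i ≟ᵇ b })) F

Satisfiable : ∀ {n} → CNF n → Set
Satisfiable F = ∃ λ z → z ⊨ F

Ω : ∀ {n} → CNF n → List (Assignment n)
Ω F = filter (_⊨? F) (bitStrings _)

d-H : ∀ {n} → Assignment n → Assignment n → ℕ
d-H x y = Vec.count (λ { (a , b) → ¬? (a ≟ᵇ b) }) (zip x y)

-- The default 0 only matters when F is unsatisfiable.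
Diam : ∀ {n} → CNF n → ℕ
Diam F = max 0 (map (uncurry d-H) (cartesianProduct (Ω F) (Ω F)))

-- Randomized algorithms: Jones's WHILE language over binary trees,
-- extended with a coin-flip command.  Trees are thought of as pointers into
-- a heap of shared cells, so every command takes constant time (for a fixed
-- program); in particular trees can only be tested for being nil.  Up to
-- logarithmic factors in the running time, which O* absorbs here, this
-- is the unit-cost RAM with logarithmic word size.

infixr 5 _∙_

data Tree : Set where
  nil : Tree
  _∙_ : Tree → Tree → Tree

Var : Set
Var = ℕ

data Expr : Set where
  var   : Var → Expr
  nil   : Expr
  cons  : Expr → Expr → Expr
  hd tl : Expr → Expr

infix  6 _:=_
infixr 5 _⨾_

data Program : Set where
  _:=_  : Var → Expr → Program
  flip  : Var → Program
  _⨾_   : Program → Program → Program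
  cond  : Expr → Program → Program → Program
  while : Expr → Program → Program

Store : Set
Store = Var → Tree

_[_↦_] : Store → Var → Tree → Store
(σ [ x ↦ t ]) y = if x ≡ᵇ y then t else σ y

left right : Tree → Tree
left  nil     = nil
left  (s ∙ t) = s
right nil     = nil
right (s ∙ t) = t

⟦_⟧ : Expr → Store → Tree
⟦ var x ⟧    σ = σ x
⟦ nil ⟧      σ = nil
⟦ cons e f ⟧ σ = ⟦ e ⟧ σ ∙ ⟦ f ⟧ σ
⟦ hd e ⟧     σ = left (⟦ e ⟧ σ)
⟦ tl e ⟧     σ = right (⟦ e ⟧ σ)

encodeBit : Bool → Tree
encodeBit false = nil
encodeBit true  = nil ∙ nil

truthy : Tree → Bool
truthy nil     = false
truthy (_ ∙ _) = true

-- The commands still to be executed, and the current store.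
Config : Set
Config = List Program × Store

-- One time step.  Every step is supplied with a fresh coin, which only flip
-- looks at; a halted configuration stays as it is.
step : Bool → Config → Config
step b ([] , σ)             = [] , σ
step b ((x := e) ∷ K , σ)   = K , σ [ x ↦ ⟦ e ⟧ σ ]
step b (flip x ∷ K , σ)     = K , σ [ x ↦ encodeBit b ]
step b ((p ⨾ q) ∷ K , σ)    = p ∷ q ∷ K , σ
step b (cond e p q ∷ K , σ) = (if truthy (⟦ e ⟧ σ) then p else q) ∷ K , σ
step b (while e p ∷ K , σ)  = (if truthy (⟦ e ⟧ σ) then p ∷ while e p ∷ K else K) , σ

run : ∀ {T} → Vec Bool T → Config → Config
run []      κ = κ
run (b ∷ ω) κ = run ω (step b κ)

-- Variable 0 holds the input at the start and the output at the end.
initial : Program → Tree → Config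
initial A t = A ∷ [] , (λ _ → nil) [ 0 ↦ t ]

output : Config → Tree
output (_ , σ) = σ 0

HaltsWithin : ℕ → Program → Tree → Set
HaltsWithin T A t = ∀ (ω : Vec Bool T) → proj₁ (run ω (initial A t)) ≡ []

Pr : ∀ {T} {P : Pred (Vec Bool T) 0ℓ} → Decidable P → ℚ
Pr {T} P? = + length (filter P? (bitStrings T)) / (2 ^ T)
  where instance _ = m^n≢0 2 T

encodeℕ : ℕ → Tree
encodeℕ zero    = nil
encodeℕ (suc m) = nil ∙ encodeℕ m

encodeList : {X : Set} → (X → Tree) → List X → Tree
encodeList enc []       = nil
encodeList enc (x ∷ xs) = enc x ∙ encodeList enc xs

encodeLiteral : ∀ {n} → Literal n → Tree
encodeLiteral (i , b) = encodeℕ (toℕ i) ∙ encodeBit b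

encodeCNF : ∀ {n} → CNF n → Tree
encodeCNF {n} F = encodeℕ n ∙ encodeList (encodeList encodeLiteral) F

decodeAssignment : ∀ n → Tree → Maybe (Assignment n)
decodeAssignment zero    nil     = just []
decodeAssignment zero    (_ ∙ _) = nothing
decodeAssignment (suc n) nil     = nothing
decodeAssignment (suc n) (s ∙ t) = Maybe.map (truthy s ∷_) (decodeAssignment n t)

decodePair : ∀ n → Tree → Maybe (Assignment n × Assignment n)
decodePair n nil     = nothing
decodePair n (s ∙ t) = Maybe.zip (decodeAssignment n s) (decodeAssignment n t)

ratio : ∀ k → 3 ≤ k → ℚ
ratio k 3≤k = ½ ℚ.* (1ℚ ℚ.- + (4 * (k ∸ 1)) / ((k ∸ 2) ^ 2))
  where instance
    _ = >-nonZero (m<n⇒0<n∸m 3≤k)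
    _ = m^n≢0 (k ∸ 2) 2

Diverse : ∀ k → 3 ≤ k → ∀ {n} → CNF n → Pred (Assignment n × Assignment n) 0ℓ
Diverse k 3≤k F (z₁ , z₂) =
  z₁ ⊨ F × z₂ ⊨ F × ratio k 3≤k ℚ.* (+ Diam F / 1) ℚ.≤ + d-H z₁ z₂ / 1

Success : ∀ k → 3 ≤ k → Program → ∀ {n} → CNF n → ∀ T → Pred (Vec Bool T) 0ℓ
Success k 3≤k A {n} F T ω =
  MaybeAny.Any (Diverse k 3≤k F)
    (decodePair n (output (run ω (initial A (encodeCNF F)))))

success? : ∀ k (3≤k : 3 ≤ k) A {n} (F : CNF n) T → Decidable (Success k 3≤k A F T)
success? k 3≤k A F T ω =
  MaybeAny.dec (λ { (z₁ , z₂) → (z₁ ⊨? F) ×-dec (z₂ ⊨? F) ×-dec (_ ℚₚ.≤? _) }) _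

-- A real number ρ is given by the predicate ρ <_ on the rationals.
UpperCut : Set₁
UpperCut = ℚ → Set

harmonicBlock : ℕ → ℕ → ℚ
harmonicBlock m zero    = 0ℚ
harmonicBlock m (suc l) = harmonicBlock m l ℚ.+ + 1 / suc (m + l)

-- ln 2 is the integral of 1/x over [1,2], the infimum of the upper Riemann
-- sums Σ_{i<M} (1/M)·1/(1+i/M) = Σ_{i<M} 1/(M+i) for M = m+1 equal parts.
-- The infimum is not attained.
ln2 : UpperCut
ln2 q = ∃ λ m → harmonicBlock m (suc m) ℚ.< q

-- 1 - 1/(k ln 2).  Since 1 - 1/(k x) increases with x > 0, a rational r is
-- above it iff r > 1 - 1/(k q) for some rational q = a/b > ln 2.
exponent : ∀ k → 3 ≤ k → UpperCut
exponent k 3≤k r = ∃₂ λ a b → ln2 (+ suc a / suc b) × bound a b ℚ.< r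
  where
  instance _ = >-nonZero (≤-trans (z<s {2}) 3≤k)
  bound : ℕ → ℕ → ℚ
  bound a b = 1ℚ ℚ.- + suc b / (k * suc a)
    where instance _ = m*n≢0 k (suc a)

-- T(n) = O*(2^(ρ n)) for a real ρ ≥ 0.  As 2^(ρ n) is the infimum of 2^(r n)
-- over rationals r = a/b > ρ, the inequality T(n) ≤ p(n) 2^(ρ n) says that
-- T(n) ≤ p(n) 2^(a n / b) for all these, with the same polynomial p.
_∈O*2^[_·n] : (ℕ → ℕ) → UpperCut → Set
T ∈O*2^[ ρ ·n] = ∃[ C ] ∃[ d ] ∀ n a b .{{_ : NonZero b}} → ρ (+ a / b) →
  T n ^ b ≤ (C * suc n ^ d) ^ b * 2 ^ (a * n)

IsLittleO1 : (ℕ → ℚ) → Set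
IsLittleO1 ε = ∀ δ → 0ℚ ℚ.< δ → ∃[ n₀ ] ∀ n → n₀ ≤ n → ℚ.∣ ε n ∣ ℚ.< δ

-- The algorithm is Schöning's random walk, run twice.  Let z be a solution and
-- d the distance of the current assignment from z.  A step decreases d with
-- probability at least about 1/k, so x ^ d with x = 2/(2k-1), slightly less than
-- 1/(k-1), grows by a factor ℓ > 1 on average as long as no solution is found;
-- hence a walk of linear length succeeds with probability x ^ d up to 2^-Ω(n),
-- and from a uniform start with probability about u ^ n, u = (1+x)/2, where
-- 1/u ≤ 2 e^(-1/k) is the base of the time bound.  Subtracting a multiple of X ^ d,
-- X = 1/(k-2), from the potential makes it negative for d ≥ n/(k-1), so the same
-- probability counts only solutions found within that distance of z.
-- The first phase finds a solution z₀.  By the triangle inequality some solution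
-- z is at distance r ≥ Diam/2 from z₀.  If r is at least about n/4, a walk from
-- a uniform start finds a solution so close to z that its distance from z₀ is
-- large enough; otherwise flipping each bit of z₀ with probability 1/4 hits z
-- itself with probability at least u ^ n.  For k ≤ 6 the ratio is not positive
-- and z₀ alone suffices.
module Submission where

open import Defs
open import Data.Bool using (Bool; true; false; if_then_else_; not; T)
open import Data.Empty using (⊥; ⊥-elim)
import Data.Fin.Properties as Finₚ
open import Data.Fin using (Fin; zero; suc; toℕ)
import Data.Integer as ℤ
import Data.Integer.Properties as ℤₚ
open import Data.Integer using (+_)
open import Data.List as List using (List; []; _∷_; length; filter; _++_)
import Data.List.Extrema.Nat as Extrema
import Data.List.Membership.Propositional.Properties as Membership
import Data.List.Properties as Listₚ
open import Data.List.Relation.Unary.All using ([]; _∷_)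
open import Data.List.Relation.Unary.Any using (Any; here; there)
open import Data.Maybe as Maybe using (Maybe; just; nothing)
import Data.Maybe.Relation.Unary.Any as MaybeAny
open import Data.Nat
open import Data.Nat.Properties
open import Data.Nat.Divisibility using (divides)
import Data.Nat.DivMod as DivMod
open import Data.Nat.Tactic.RingSolver using (solve-∀)
open import Data.Product using (_×_; _,_; ∃; ∃-syntax; proj₁; proj₂; uncurry)
open import Data.Rational as ℚ using (ℚ; 0ℚ; 1ℚ; ½)
import Data.Rational.Properties as ℚₚ
import Data.Rational.Unnormalised as ℚᵘ
import Data.Rational.Unnormalised.Properties as ℚᵘₚ
import Data.Integer.Tactic.RingSolver as ℤSolver
open import Data.Sum using (_⊎_; inj₁; inj₂)
open import Data.Vec as Vec using (Vec; []; _∷_; lookup)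
open import Data.Unit using (⊤; tt)
open import Function using (id)
open import Level using (0ℓ)
open import Relation.Binary.PropositionalEquality using (_≡_; _≢_; refl; sym; trans; cong; cong₂; subst; subst₂; module ≡-Reasoning)
open import Relation.Nullary using (¬_; Dec; yes; no; does; _×-dec_)
open import Relation.Unary using (Pred; Decidable)
import Tactic.RingSolver as RingSolver
import Tactic.RingSolver.Core.AlmostCommutativeRing as ACR

-- The base 2 e^(-1/k) of the time bound exceeds Schöning's own 2(1 - 1/k), and the proof lives on
-- this slack. At x = 1/(k-1) and probability 1/k the potential x ^ d is only a martingale; the
-- smaller x still satisfies 1 + x > e^(1/k), but now ℓ > 1 even after 1/k has been rounded to a
-- probability that fair coins can produce. With ℓ > 1, running out of fuel costs one geometric
-- term, and no analysis of the paths of the walk is needed. The ratio is made for the cutoff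
-- n/(k-1): a solution that misses it has distance at least 4(k-1)/(k-2)² · r from z by the triangle
-- inequality, and for r ≥ n/4 this is at least n/(k-1). The algorithm knows neither z nor r, so it
-- makes both kinds of attempt in every round; keeping the farther solution makes the useless kind
-- harmless. No real number occurs. e^(1/k) enters through (1 + 1/J)^J, ln 2 through a telescoping
-- product, and the exponential number of rounds is computed in unary by repeated rounded
-- multiplication with a fraction that bounds the base from below.

isZero? : ∀ p → Maybe (0ℚ ≡ p)
isZero? (ℚ.mkℚ (+ 0) 0 _) = just refl
isZero? _                 = nothing

ℚ-ring : ACR.AlmostCommutativeRing 0ℓ 0ℓ
ℚ-ring = ACR.fromCommutativeRing ℚₚ.+-*-commutativeRing isZero?

-- Coin averages, and execution on finite memories

mean : ℚ → ℚ → ℚ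
mean p q = ½ ℚ.* (p ℚ.+ q)

mean-idem : ∀ p → mean p p ≡ p
mean-idem = lemma
  where
  lemma : ∀ p → ½ ℚ.* (p ℚ.+ p) ≡ p
  lemma = RingSolver.solve-∀ ℚ-ring

mean-mono : ∀ {p p′ q q′} → p ℚ.≤ p′ → q ℚ.≤ q′ → mean p q ℚ.≤ mean p′ q′
mean-mono p≤p′ q≤q′ = ℚₚ.*-monoˡ-≤-nonNeg ½ (ℚₚ.+-mono-≤ p≤p′ q≤q′)

-- Stores are replaced by finite lists, padded with nil: then a store with
-- known entries computes, and no function extensionality is needed.

Memory : Set
Memory = List Tree

get : Memory → Store
get []      _       = nil
get (t ∷ s) zero    = t
get (t ∷ s) (suc x) = get s x

set : Memory → Var → Tree → Memory
set []      zero    t = t ∷ []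
set []      (suc x) t = nil ∷ set [] x t
set (_ ∷ s) zero    t = t ∷ s
set (u ∷ s) (suc x) t = u ∷ set s x t

get-set : ∀ s x t y → get (set s x t) y ≡ (get s [ x ↦ t ]) y
get-set []      zero    t zero    = refl
get-set []      zero    t (suc y) = refl
get-set []      (suc x) t zero    = refl
get-set []      (suc x) t (suc y) with x ≡ᵇ y | get-set [] x t y
... | true  | eq = eq
... | false | eq = eq
get-set (u ∷ s) zero    t zero    = refl
get-set (u ∷ s) zero    t (suc y) = refl
get-set (u ∷ s) (suc x) t zero    = refl
get-set (u ∷ s) (suc x) t (suc y) = get-set s x t y

Configuration : Set
Configuration = List Program × Memory

next : Bool → Configuration → Configuration
next b ([] , s)             = [] , s
next b ((x := e) ∷ K , s)   = K , set s x (⟦ e ⟧ (get s))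
next b (flip x ∷ K , s)     = K , set s x (encodeBit b)
next b ((p ⨾ q) ∷ K , s)    = p ∷ q ∷ K , s
next b (cond e p q ∷ K , s) = (if truthy (⟦ e ⟧ (get s)) then p else q) ∷ K , s
next b (while e p ∷ K , s)  = (if truthy (⟦ e ⟧ (get s)) then p ∷ while e p ∷ K else K) , s

infix 4 _≗_ _∼_

_≗_ : Store → Store → Set
σ ≗ τ = ∀ x → σ x ≡ τ x

record _∼_ (κ : Config) (κ′ : Configuration) : Set where
  constructor same
  field
    commands : proj₁ κ ≡ proj₁ κ′
    store    : proj₂ κ ≗ get (proj₂ κ′)

open _∼_

⟦⟧-cong : ∀ e {σ τ} → σ ≗ τ → ⟦ e ⟧ σ ≡ ⟦ e ⟧ τ
⟦⟧-cong (var x)    eq = eq x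
⟦⟧-cong nil        eq = refl
⟦⟧-cong (cons e f) eq = cong₂ _∙_ (⟦⟧-cong e eq) (⟦⟧-cong f eq)
⟦⟧-cong (hd e)     eq = cong left (⟦⟧-cong e eq)
⟦⟧-cong (tl e)     eq = cong right (⟦⟧-cong e eq)

update-cong : ∀ {σ} s x {t u} → t ≡ u → σ ≗ get s → (σ [ x ↦ t ]) ≗ get (set s x u)
update-cong {σ} s x {u = u} refl eq y = trans (if-cong (x ≡ᵇ y)) (sym (get-set s x u y))
  where
  if-cong : ∀ c → (if c then u else σ y) ≡ (if c then u else get s y)
  if-cong true  = refl
  if-cong false = eq y

step-∼ : ∀ b {κ κ′} → κ ∼ κ′ → step b κ ∼ next b κ′
step-∼ b {[] , σ}             {_ , s} (same refl eq) = same refl eq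
step-∼ b {(x := e) ∷ K , σ}   {_ , s} (same refl eq) = same refl (update-cong s x (⟦⟧-cong e eq) eq)
step-∼ b {flip x ∷ K , σ}     {_ , s} (same refl eq) = same refl (update-cong s x refl eq)
step-∼ b {(p ⨾ q) ∷ K , σ}    {_ , s} (same refl eq) = same refl eq
step-∼ b {cond e p q ∷ K , σ} {_ , s} (same refl eq) =
  same (cong (λ t → (if truthy t then p else q) ∷ K) (⟦⟧-cong e eq)) eq
step-∼ b {while e p ∷ K , σ}  {_ , s} (same refl eq) =
  same (cong (λ t → if truthy t then p ∷ while e p ∷ K else K) (⟦⟧-cong e eq)) eq

-- Win Good t κ ρ: from κ the program halts within t steps whatever the coins
-- show, and with probability at least ρ the output is then Good.
data Win (Good : Tree → Set) : ℕ → Configuration → ℚ → Set where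
  good : ∀ {t s ρ} → Good (get s 0) → ρ ℚ.≤ 1ℚ → Win Good t ([] , s) ρ
  bad  : ∀ {t s ρ} → ρ ℚ.≤ 0ℚ → Win Good t ([] , s) ρ
  coin : ∀ {t κ ρ₀ ρ₁ ρ} → Win Good t (next false κ) ρ₀ → Win Good t (next true κ) ρ₁ →
         ρ ℚ.≤ mean ρ₀ ρ₁ → Win Good (suc t) κ ρ

module _ {Good : Tree → Set} where

  weaken : ∀ {t t′ κ ρ ρ′} → t ≤ t′ → ρ′ ℚ.≤ ρ → Win Good t κ ρ → Win Good t′ κ ρ′
  weaken _         ρ≤ (good g ρ≤1)   = good g (ℚₚ.≤-trans ρ≤ ρ≤1)
  weaken _         ρ≤ (bad ρ≤0)      = bad (ℚₚ.≤-trans ρ≤ ρ≤0)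
  weaken (s≤s t≤t′) ρ≤ (coin w₀ w₁ h) =
    coin (weaken t≤t′ ℚₚ.≤-refl w₀) (weaken t≤t′ ℚₚ.≤-refl w₁) (ℚₚ.≤-trans ρ≤ h)

  longer : ∀ {t t′ κ ρ} → t ≤ t′ → Win Good t κ ρ → Win Good t′ κ ρ
  longer t≤t′ = weaken t≤t′ ℚₚ.≤-refl

  toss : ∀ {t κ} (ρ : Bool → ℚ) → (∀ b → Win Good t (next b κ) (ρ b)) →
         Win Good (suc t) κ (mean (ρ false) (ρ true))
  toss ρ w = coin (w false) (w true) ℚₚ.≤-refl

  tick : ∀ {t κ ρ} → (∀ b → Win Good t (next b κ) ρ) → Win Good (suc t) κ ρ
  tick {ρ = ρ} w = coin (w false) (w true) (ℚₚ.≤-reflexive (sym (mean-idem ρ)))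

silent : Configuration → Maybe Configuration
silent ([] , s)          = nothing
silent (flip x ∷ K , s)  = nothing
silent κ                 = just (next false κ)

silent-sound : ∀ {κ κ′} → silent κ ≡ just κ′ → ∀ b → next b κ ≡ κ′
silent-sound {(x := e) ∷ K , s}   refl b = refl
silent-sound {(p ⨾ q) ∷ K , s}    refl b = refl
silent-sound {cond e p q ∷ K , s} refl b = refl
silent-sound {while e p ∷ K , s}  refl b = refl

silently : ℕ → Configuration → Maybe Configuration
silently zero    κ = just κ
silently (suc j) κ = silent κ Maybe.>>= silently j

-- The equation is meant to be proved by `refl`: conversion checking then executes the program
-- symbolically on a memory of known shape. Only a flip or an unknown loop condition stops it, and
-- these are handled by `toss` and by induction.
steps : ∀ {Good} j {t κ κ′ ρ} → silently j κ ≡ just κ′ → Win Good t κ′ ρ → Win Good (j + t) κ ρ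
steps zero    refl w = w
steps {Good} (suc j) {t} {κ} {ρ = ρ} eq w with silent κ in eq′
... | just κ₁ = tick λ b → subst (λ κ → Win Good (j + t) κ ρ) (sym (silent-sound eq′ b)) (steps j eq w)

-- From winning derivations to halting and probability

private
  favourable : ∀ T {P : Pred (Vec Bool T) 0ℓ} → Decidable P → ℕ
  favourable T P? = length (filter P? (bitStrings T))

  length-filter-map : ∀ {A B : Set} (f : A → B) {P : Pred B 0ℓ} (P? : Decidable P) xs →
                      length (filter P? (List.map f xs)) ≡ length (filter (λ x → P? (f x)) xs)
  length-filter-map f P? []       = refl
  length-filter-map f P? (x ∷ xs) with does (P? (f x))
  ... | true  = cong suc (length-filter-map f P? xs)
  ... | false = length-filter-map f P? xs

  favourable-suc : ∀ T {P : Pred (Vec Bool (suc T)) 0ℓ} (P? : Decidable P) →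
              favourable (suc T) P? ≡ favourable T (λ ω → P? (false ∷ ω)) + favourable T (λ ω → P? (true ∷ ω))
  favourable-suc T P? = begin
    length (filter P? (xs ++ ys ++ [])) ≡⟨ cong length (Listₚ.filter-++ P? xs (ys ++ [])) ⟩
    length (filter P? xs ++ filter P? (ys ++ []))             ≡⟨ Listₚ.length-++ (filter P? xs) ⟩
    length (filter P? xs) + length (filter P? (ys ++ [])) ≡⟨ cong (λ zs → length (filter P? xs) + length (filter P? zs)) (Listₚ.++-identityʳ ys) ⟩
    length (filter P? xs) + length (filter P? ys) ≡⟨ cong₂ _+_ (length-filter-map (false ∷_) P? (bitStrings T)) (length-filter-map (true ∷_) P? (bitStrings T)) ⟩
    _ ∎
    where
    open ≡-Reasoning
    xs ys : List (Vec Bool (suc T))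
    xs = List.map (false ∷_) (bitStrings T)
    ys = List.map (true ∷_) (bitStrings T)

/-mean : ∀ a b d .{{_ : NonZero d}} .{{_ : NonZero (2 * d)}} →
         mean (+ a ℚ./ d) (+ b ℚ./ d) ≡ + (a + b) ℚ./ (2 * d)
/-mean a b d@(suc _) = ℚₚ.toℚᵘ-injective (begin
  ℚ.toℚᵘ (½ ℚ.* (+ a ℚ./ d ℚ.+ + b ℚ./ d))
    ≈⟨ ℚₚ.toℚᵘ-homo-* ½ (+ a ℚ./ d ℚ.+ + b ℚ./ d) ⟩
  ℚ.toℚᵘ ½ ℚᵘ.* ℚ.toℚᵘ (+ a ℚ./ d ℚ.+ + b ℚ./ d)
    ≈⟨ ℚᵘₚ.*-congˡ {ℚ.toℚᵘ ½} (ℚₚ.toℚᵘ-homo-+ (+ a ℚ./ d) (+ b ℚ./ d)) ⟩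
  ℚ.toℚᵘ ½ ℚᵘ.* (ℚ.toℚᵘ (+ a ℚ./ d) ℚᵘ.+ ℚ.toℚᵘ (+ b ℚ./ d))
    ≈⟨ ℚᵘₚ.*-congˡ {ℚ.toℚᵘ ½} (ℚᵘₚ.+-cong (ℚₚ.toℚᵘ-fromℚᵘ (+ a ℚᵘ./ d)) (ℚₚ.toℚᵘ-fromℚᵘ (+ b ℚᵘ./ d))) ⟩
  ℚ.toℚᵘ ½ ℚᵘ.* (+ a ℚᵘ./ d ℚᵘ.+ + b ℚᵘ./ d)
    ≈⟨ ℚᵘ.*≡* (eq (+ a) (+ b) (+ d)) ⟩
  + (a + b) ℚᵘ./ (2 * d)
    ≈⟨ ℚₚ.toℚᵘ-fromℚᵘ (+ (a + b) ℚᵘ./ (2 * d)) ⟨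
  ℚ.toℚᵘ (+ (a + b) ℚ./ (2 * d)) ∎)
  where
  open ℚᵘₚ.≃-Reasoning
  eq : ∀ a b d → (ℤ.1ℤ ℤ.* (a ℤ.* d ℤ.+ b ℤ.* d)) ℤ.* ((+ 2) ℤ.* d) ≡ (a ℤ.+ b) ℤ.* ((+ 2) ℤ.* (d ℤ.* d))
  eq = ℤSolver.solve-∀

private
  Pr-suc : ∀ T {P : Pred (Vec Bool (suc T)) 0ℓ} (P? : Decidable P) →
           Pr P? ≡ mean (Pr (λ ω → P? (false ∷ ω))) (Pr (λ ω → P? (true ∷ ω)))
  Pr-suc T P? = trans (cong (λ m → (+ m ℚ./ (2 ^ suc T))) (favourable-suc T P?))
    (sym (/-mean (favourable T (λ ω → P? (false ∷ ω))) (favourable T (λ ω → P? (true ∷ ω))) (2 ^ T)))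
    where
    instance _ = m^n≢0 2 T
             _ = m^n≢0 2 (suc T)

  run-halted : ∀ {T} (ω : Vec Bool T) {κ} → proj₁ κ ≡ [] → run ω κ ≡ κ
  run-halted []      {[] , σ} refl = refl
  run-halted (b ∷ ω) {[] , σ} refl = run-halted ω refl

  run-∼ : ∀ {T} (ω : Vec Bool T) {κ s} → κ ∼ ([] , s) → run ω κ ∼ ([] , s)
  run-∼ ω {[] , σ} {s} (same refl eq) = subst (_∼ ([] , s)) (sym (run-halted ω {[] , σ} refl)) (same refl eq)

-- Every leaf of a derivation is a halted configuration, and the coins left over there change
-- nothing.
Win⇒halts : ∀ {Good T κ κ′ ρ} → Win Good T κ′ ρ → κ ∼ κ′ → (ω : Vec Bool T) → proj₁ (run ω κ) ≡ []
Win⇒halts (good _ _) κ∼κ′ ω = commands (run-∼ ω κ∼κ′)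
Win⇒halts (bad _)    κ∼κ′ ω = commands (run-∼ ω κ∼κ′)
Win⇒halts (coin w₀ w₁ _) κ∼κ′ (false ∷ ω) = Win⇒halts w₀ (step-∼ false κ∼κ′) ω
Win⇒halts (coin w₀ w₁ _) κ∼κ′ (true  ∷ ω) = Win⇒halts w₁ (step-∼ true κ∼κ′) ω

private
  0≤Pr : ∀ {T} {P : Pred (Vec Bool T) 0ℓ} (P? : Decidable P) → 0ℚ ℚ.≤ Pr P?
  0≤Pr {T} P? = ℚₚ.nonNegative⁻¹ _ {{ℚₚ.normalize-nonNeg (favourable T P?) (2 ^ T)}}
    where instance _ = m^n≢0 2 T

  Pr-sure : ∀ {T} {P : Pred (Vec Bool T) 0ℓ} (P? : Decidable P) → (∀ ω → P ω) → Pr P? ≡ 1ℚ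
  Pr-sure {zero}  P? h with P? []
  ... | yes _ = refl
  ... | no ¬p = ⊥-elim (¬p (h []))
  Pr-sure {suc T} P? h = trans (Pr-suc T P?)
    (cong₂ mean (Pr-sure (λ ω → P? (false ∷ ω)) (λ ω → h (false ∷ ω)))
                (Pr-sure (λ ω → P? (true ∷ ω)) (λ ω → h (true ∷ ω))))

-- The event varies in the induction: fixing the first coin restricts it to one half of the coin
-- space, and `Pr` is the mean of the two restrictions.
Win⇒Pr : ∀ {Good T κ κ′ ρ} → Win Good T κ′ ρ → κ ∼ κ′ →
         {P : Pred (Vec Bool T) 0ℓ} (P? : Decidable P) →
         (∀ ω → Good (output (run ω κ)) → P ω) → ρ ℚ.≤ Pr P?
Win⇒Pr {Good} (good g ρ≤1) κ∼κ′ P? h = ℚₚ.≤-trans ρ≤1 (ℚₚ.≤-reflexive (sym (Pr-sure P?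
  λ ω → h ω (subst Good (sym (store (run-∼ ω κ∼κ′) 0)) g))))
Win⇒Pr (bad ρ≤0) κ∼κ′ P? h = ℚₚ.≤-trans ρ≤0 (0≤Pr P?)
Win⇒Pr {T = suc T} (coin w₀ w₁ ρ≤) κ∼κ′ P? h = ℚₚ.≤-trans ρ≤ (ℚₚ.≤-trans
  (mean-mono (Win⇒Pr w₀ (step-∼ false κ∼κ′) (λ ω → P? (false ∷ ω)) (λ ω → h (false ∷ ω)))
             (Win⇒Pr w₁ (step-∼ true κ∼κ′) (λ ω → P? (true ∷ ω)) (λ ω → h (true ∷ ω))))
  (ℚₚ.≤-reflexive (sym (Pr-suc T P?))))

-- Randomized computations and the algorithm

-- The free monad of one fair coin. Expectations are folds over it, so the algorithm is analysed
-- without fixing a sample space or counting the coins of idle time steps.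
data Comp (A : Set) : Set where
  ret  : A → Comp A
  draw : (Bool → Comp A) → Comp A

infixl 1 _>>=_

_>>=_ : ∀ {A B} → Comp A → (A → Comp B) → Comp B
ret a  >>= f = f a
draw g >>= f = draw λ b → g b >>= f

E : ∀ {A} → Comp A → (A → ℚ) → ℚ
E (ret a)  h = h a
E (draw f) h = mean (E (f false) h) (E (f true) h)

E->>= : ∀ {A B} (c : Comp A) (f : A → Comp B) h → E (c >>= f) h ≡ E c (λ a → E (f a) h)
E->>= (ret a)  f h = refl
E->>= (draw g) f h = cong₂ mean (E->>= (g false) f h) (E->>= (g true) f h)

E-mono : ∀ {A} (c : Comp A) {h h′ : A → ℚ} → (∀ a → h a ℚ.≤ h′ a) → E c h ℚ.≤ E c h′
E-mono (ret a)  le = le a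
E-mono (draw f) le = mean-mono (E-mono (f false) le) (E-mono (f true) le)

E-cong : ∀ {A} (c : Comp A) {h h′ : A → ℚ} → (∀ a → h a ≡ h′ a) → E c h ≡ E c h′
E-cong (ret a)  eq = eq a
E-cong (draw f) eq = cong₂ mean (E-cong (f false) eq) (E-cong (f true) eq)

E-affine : ∀ {A} (c : Comp A) α β (h : A → ℚ) → E c (λ a → α ℚ.+ β ℚ.* h a) ≡ α ℚ.+ β ℚ.* E c h
E-affine (ret a)  α β h = refl
E-affine (draw f) α β h = trans (cong₂ mean (E-affine (f false) α β h) (E-affine (f true) α β h))
                                (lemma α β (E (f false) h) (E (f true) h))
  where
  lemma : ∀ α β p q → ½ ℚ.* ((α ℚ.+ β ℚ.* p) ℚ.+ (α ℚ.+ β ℚ.* q)) ≡ α ℚ.+ β ℚ.* (½ ℚ.* (p ℚ.+ q))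
  lemma = RingSolver.solve-∀ ℚ-ring

E-const : ∀ {A} (c : Comp A) p → E c (λ _ → p) ≡ p
E-const (ret a)  p = refl
E-const (draw f) p = trans (cong₂ mean (E-const (f false) p) (E-const (f true) p)) (mean-idem p)

isTrue : ∀ {n} → Assignment n → Literal n → Bool
isTrue y (i , b) = if lookup y i then b else not b

clauseTrue : ∀ {n} → Assignment n → Clause n → Bool
clauseTrue y []      = false
clauseTrue y (l ∷ C) = if isTrue y l then true else clauseTrue y C

violated : ∀ {n} → Assignment n → CNF n → Maybe (Clause n)
violated y []      = nothing
violated y (C ∷ F) = if clauseTrue y C then violated y F else just C

nth : ∀ {A : Set} → List A → ℕ → Maybe A
nth []       j       = nothing
nth (x ∷ xs) zero    = just x
nth (x ∷ xs) (suc j) = nth xs j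

move : ∀ {n} → Assignment n → Maybe (Literal n) → Assignment n
move y nothing        = y
move y (just (i , b)) = y Vec.[ i ]≔ b

Noise : Set
Noise = Bool → Comp Bool

-- `fair` forgets its argument, so resampling with it is uniform from any assignment; `lazy` flips
-- the bit only if two coins both show true.
fair lazy : Noise
fair b = draw ret
lazy b = draw λ c → if c then draw (λ c → ret (if c then not b else b)) else ret b

resample : ∀ {n} → Noise → Assignment n → Comp (Assignment n)
resample ν []      = ret []
resample ν (b ∷ y) = ν b >>= λ b′ → resample ν y >>= λ y′ → ret (b′ ∷ y′)

E-resample-∷ : ∀ ν {m} b (y : Assignment m) (h : Assignment (suc m) → ℚ) →
  E (resample ν (b ∷ y)) h ≡ E (ν b) (λ b′ → E (resample ν y) (λ y′ → h (b′ ∷ y′)))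
E-resample-∷ ν b y h = trans (E->>= (ν b) _ h) (E-cong (ν b) λ b′ → E->>= (resample ν y) _ h)

bits : ℕ → ℕ → Comp ℕ
bits zero    v = ret v
bits (suc j) v = draw λ b → bits j (if b then suc (2 * v) else 2 * v)

iterate : ∀ {A : Set} → ℕ → (A → Comp A) → A → Comp A
iterate zero    f a = ret a
iterate (suc j) f a = f a >>= iterate j f

improve : ∀ {n} → Assignment n → Assignment n → Maybe (Assignment n) → Assignment n
improve z₀ z₁ nothing  = z₁
improve z₀ z₁ (just y) = if d-H z₀ z₁ <ᵇ d-H z₀ y then y else z₁

module Algorithm (β : ℕ) (leaf : ℕ → ℕ) where

  module _ {n} (F : CNF n) where

    -- Fuel pays for tests: the assignment reached by the last move is never tested, and merely
    -- recognising a solution takes one unit.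
    walk : ℕ → Assignment n → Comp (Maybe (Assignment n))
    walkFrom : ℕ → Assignment n → Maybe (Clause n) → Comp (Maybe (Assignment n))
    walk zero    y = ret nothing
    walk (suc t) y = walkFrom t y (violated y F)
    walkFrom t y nothing  = ret (just y)
    -- An index beyond the clause, due to a short clause or to a leftover coin outcome, leaves y
    -- where it is.
    walkFrom t y (just C) = bits β 0 >>= λ v → walk t (move y (nth C (leaf v)))

    search : ℕ → Noise → Assignment n → Comp (Maybe (Assignment n))
    search t ν z = resample ν z >>= walk t

    first : ℕ → Assignment n → Comp (Assignment n)
    first t z = search t fair z >>= λ r → ret (Maybe.fromMaybe z r)

    attempt : ℕ → Noise → Assignment n → Assignment n → Comp (Assignment n)
    attempt t ν z₀ z₁ = search t ν z₀ >>= λ r → ret (improve z₀ z₁ r)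

    round : ℕ → Assignment n → Assignment n → Comp (Assignment n)
    round t z₀ z₁ = attempt t fair z₀ z₁ >>= attempt t lazy z₀

    algorithm : ℕ → ℕ → Assignment n → Comp (Assignment n × Assignment n)
    algorithm t N z = iterate N (first t) z >>= λ z₀ → iterate N (round t z₀) z₀ >>= λ z₁ → ret (z₀ , z₁)

-- The program

tls : ℕ → Expr → Expr
tls zero    e = e
tls (suc j) e = tls j (tl e)

rights : ℕ → Tree → Tree
rights zero    t = t
rights (suc j) t = rights j (right t)

⟦tls⟧ : ∀ j e σ → ⟦ tls j e ⟧ σ ≡ rights j (⟦ e ⟧ σ)
⟦tls⟧ zero    e σ = refl
⟦tls⟧ (suc j) e σ = ⟦tls⟧ j (tl e) σ

push : ℕ → Expr → Expr
push zero    e = e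
push (suc c) e = cons nil (push c e)

⟦push⟧ : ∀ c e σ {m} → ⟦ e ⟧ σ ≡ encodeℕ m → ⟦ push c e ⟧ σ ≡ encodeℕ (c + m)
⟦push⟧ zero    e σ eq = eq
⟦push⟧ (suc c) e σ eq = cong (nil ∙_) (⟦push⟧ c e σ eq)

rights-nil : ∀ j → rights j nil ≡ nil
rights-nil zero    = refl
rights-nil (suc j) = rights-nil j

rights-encodeℕ : ∀ j m → rights j (encodeℕ m) ≡ encodeℕ (m ∸ j)
rights-encodeℕ zero    m       = refl
rights-encodeℕ (suc j) zero    = rights-nil j
rights-encodeℕ (suc j) (suc m) = rights-encodeℕ j m

-- Moving a list cell by cell reverses it. `onto` describes the stack after such a loop, `atop` the
-- list after it has been moved back.
onto atop : List Tree → Tree → Tree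
onto []      t = t
onto (u ∷ l) t = onto l (u ∙ t)
atop []      t = t
atop (u ∷ l) t = u ∙ atop l t

cells : ∀ {n} → Assignment n → List Tree
cells []      = []
cells (b ∷ y) = encodeBit b ∷ cells y

length-cells : ∀ {n} (y : Assignment n) → length (cells y) ≡ n
length-cells []      = refl
length-cells (b ∷ y) = cong suc (length-cells y)

encodeA : ∀ {n} → Assignment n → Tree
encodeA y = atop (cells y) nil

encodeMaybe : ∀ {A : Set} → (A → Tree) → Maybe A → Tree
encodeMaybe enc nothing  = nil
encodeMaybe enc (just x) = enc x

-- The additional cell keeps an empty clause, whose own encoding is nil, apart from the answer that
-- no clause is violated.
encodeViolated : ∀ {n} → Maybe (Clause n) → Tree
encodeViolated = encodeMaybe (λ C → encodeList encodeLiteral C ∙ nil)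

nth-rights : ∀ {A : Set} (enc : A → Tree) xs j →
             left (rights j (encodeList enc xs)) ≡ encodeMaybe enc (nth xs j)
nth-rights enc []       j       = cong left (rights-nil j)
nth-rights enc (x ∷ xs) zero    = refl
nth-rights enc (x ∷ xs) (suc j) = nth-rights enc xs j

-- Variables: 0 input and output, 1 fuel of a walk, 2 number of rounds,
-- 3 and 4 the current pair, 5 its distance, 6 the current assignment,
-- 7 a violated clause, 8 and 9 loop counters, 10 to 13 local to subroutines.

skip : Program
skip = 10 := var 10

seekIndex hit miss literals clauses check : Program
seekIndex = while (var 12) (12 := tl (var 12) ⨾ 13 := tl (var 13))
hit       = 7 := nil ⨾ 11 := nil
miss      = 11 := tl (var 11)
literals  = while (var 11)
  (12 := hd (hd (var 11)) ⨾ 13 := var 6 ⨾ seekIndex ⨾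
   cond (hd (var 13)) (cond (tl (hd (var 11))) hit miss) (cond (tl (hd (var 11))) miss hit))
clauses   = while (var 10)
  -- The clause is recorded as violated in advance; its first true literal erases the record.
  (7 := cons (hd (var 10)) nil ⨾ 11 := hd (var 10) ⨾ literals ⨾
   cond (var 7) (10 := nil) (10 := tl (var 10)))
check     = 7 := nil ⨾ 10 := tl (var 0) ⨾ clauses

-- A zipper: the bits before the chosen one are popped onto 12, the bit is replaced, and the prefix
-- is moved back.
seek unwind assign moveP : Program
seek   = while (var 11) (12 := cons (hd (var 13)) (var 12) ⨾ 13 := tl (var 13) ⨾ 11 := tl (var 11))
unwind = while (var 12) (6 := cons (hd (var 12)) (var 6) ⨾ 12 := tl (var 12))
assign = 11 := hd (var 10) ⨾ 12 := nil ⨾ 13 := var 6 ⨾ seek ⨾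
         6 := cons (tl (var 10)) (tl (var 13)) ⨾ unwind
moveP  = cond (var 10) assign skip

fairP lazyP : Program
fairP = flip 11
lazyP = flip 13 ⨾ cond (var 13)
  (flip 13 ⨾ cond (var 13) (cond (var 11) (11 := nil) (11 := cons nil nil)) skip) skip

copy sample : Program → Program
copy νP   = while (var 10) (11 := hd (var 10) ⨾ νP ⨾ 12 := cons (var 11) (var 12) ⨾ 10 := tl (var 10))
sample νP = 10 := var 3 ⨾ 12 := nil ⨾ copy νP ⨾ 6 := nil ⨾ unwind

increment count exceeds improveP : Program
increment = 12 := cons nil (var 12)
count     = while (var 10)
  (cond (hd (var 10)) (cond (hd (var 11)) skip increment) (cond (hd (var 11)) increment skip) ⨾
   10 := tl (var 10) ⨾ 11 := tl (var 11))
-- Numbers are unary and only nil can be tested: the record is cancelled cell by cell against the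
-- new distance, and a remainder in 11 means that the record is beaten.
exceeds   = while (var 10) (11 := tl (var 11) ⨾ 10 := tl (var 10))
improveP  = 10 := var 3 ⨾ 11 := var 6 ⨾ 12 := nil ⨾ count ⨾
            10 := var 5 ⨾ 11 := var 12 ⨾ exceeds ⨾
            cond (var 11) (4 := var 6 ⨾ 5 := var 12) skip

module Programs (β : ℕ) (leaf : ℕ → ℕ) (speed : ℕ) (growA growB : ℕ) where

  -- The coin tree is unrolled into nested conditionals. Its size depends on β only, hence on k, and
  -- at each leaf `leaf v` is a constant of the program.
  pick : ℕ → ℕ → Program
  pick zero    v = 10 := hd (tls (leaf v) (hd (var 7)))
  pick (suc j) v = flip 10 ⨾ cond (var 10) (pick j (suc (2 * v))) (pick j (2 * v))

  walkLoop walkP : Program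
  walkLoop = while (var 9) (check ⨾ cond (var 7) (pick β 0 ⨾ moveP ⨾ 9 := tl (var 9)) (9 := nil))
  -- A cell in 7 stands for failure, so a walk without fuel counts as lost.
  walkP    = 7 := cons nil nil ⨾ 9 := var 1 ⨾ walkLoop

  searchP : Program → Program → Program
  searchP νP accept = sample νP ⨾ walkP ⨾ cond (var 7) skip accept

  firstLoop roundLoop : Program
  firstLoop = while (var 8) (searchP fairP (3 := var 6) ⨾ 8 := tl (var 8))
  roundLoop = while (var 8) (searchP fairP improveP ⨾ searchP lazyP improveP ⨾ 8 := tl (var 8))

  -- `growStep` turns each block of growB cells, also an incomplete last one, into growA cells:
  -- multiplication by growA/growB rounded up. Repeating it n times yields the exponential number of
  -- rounds in unary.
  fuelLoop growLoop growStep : Program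
  fuelLoop = while (var 10) (1 := push speed (var 1) ⨾ 10 := tl (var 10))
  growStep = while (var 11) (2 := push growA (var 2) ⨾ 11 := tls growB (var 11))
  growLoop = while (var 10) (11 := var 2 ⨾ 2 := nil ⨾ growStep ⨾ 10 := tl (var 10))

  main : Program
  main = 3 := hd (var 0) ⨾
         1 := push (2 * speed) nil ⨾ 10 := hd (var 0) ⨾ fuelLoop ⨾
         2 := hd (var 0) ⨾ 10 := hd (var 0) ⨾ growLoop ⨾
         8 := var 2 ⨾ firstLoop ⨾
         -- Variable 5 has not been written so far; its nil encodes the distance 0 of z₀ from
         -- itself.
         4 := var 3 ⨾ 8 := var 2 ⨾ roundLoop ⨾
         0 := cons (var 3) (var 4)

-- Verification of the program

module Check {Good : Tree → Set} {n} (F : CNF n) where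

  memory : (fuel₀ rounds z₀ z₁ best y viol ctr fuel a b c d : Tree) → Memory
  memory fuel₀ rounds z₀ z₁ best y viol ctr fuel a b c d =
    encodeCNF F ∷ fuel₀ ∷ rounds ∷ z₀ ∷ z₁ ∷ best ∷ y ∷ viol ∷ ctr ∷ fuel ∷ a ∷ b ∷ c ∷ d ∷ []

  module _ {K : List Program} {t : ℕ} {fuel₀ rounds z₀ z₁ best ctr : Tree} where

    seekIndex-win : ∀ {m} (i : Fin m) (v : Assignment m) {ρ y viol fuel a b} →
      (∀ d → Win Good t (K , memory fuel₀ rounds z₀ z₁ best y viol ctr fuel a b nil (encodeBit (lookup v i) ∙ d)) ρ) →
      Win Good (toℕ i * 4 + (1 + t))
        (seekIndex ∷ K , memory fuel₀ rounds z₀ z₁ best y viol ctr fuel a b (encodeℕ (toℕ i)) (encodeA v)) ρ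
    seekIndex-win zero    (b ∷ v) w = steps 1 refl (w _)
    seekIndex-win (suc i) (b ∷ v) w = steps 4 refl (seekIndex-win i v w)

  literalTime : ℕ
  literalTime = 12 + n * 4

  module _ {K : List Program} {t : ℕ} {fuel₀ rounds z₀ z₁ best ctr : Tree} where

    private
      literal-bound : ∀ i → i ≤ n → ∀ u → 6 + (i * 4 + (1 + (2 + (3 + (1 + t))))) ≤ literalTime + u + (1 + t)
      literal-bound i i≤n u = begin
        6 + (i * 4 + (1 + (2 + (3 + (1 + t))))) ≡⟨ eq i t ⟩
        12 + i * 4 + (1 + t) ≤⟨ +-monoˡ-≤ (1 + t) (+-monoʳ-≤ 12 (*-monoˡ-≤ 4 i≤n)) ⟩
        12 + n * 4 + (1 + t)                     ≤⟨ +-monoˡ-≤ (1 + t) (m≤m+n literalTime u) ⟩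
        literalTime + u + (1 + t)                ∎
        where
        open ≤-Reasoning
        eq : ∀ i t → 6 + (i * 4 + (1 + (2 + (3 + (1 + t))))) ≡ 12 + i * 4 + (1 + t)
        eq = solve-∀

      literal-bound′ : ∀ i → i ≤ n → ∀ u → 6 + (i * 4 + (1 + (2 + (1 + (u + (1 + t)))))) ≤ literalTime + u + (1 + t)
      literal-bound′ i i≤n u = begin
        6 + (i * 4 + (1 + (2 + (1 + (u + (1 + t)))))) ≡⟨ eq i t u ⟩
        10 + i * 4 + u + (1 + t) ≤⟨ +-monoˡ-≤ (1 + t) (+-monoˡ-≤ u (+-mono-≤ (m≤n+m 10 2) (*-monoˡ-≤ 4 i≤n))) ⟩
        literalTime + u + (1 + t)                ∎
        where
        open ≤-Reasoning
        eq : ∀ i t u → 6 + (i * 4 + (1 + (2 + (1 + (u + (1 + t)))))) ≡ 10 + i * 4 + u + (1 + t)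
        eq = solve-∀

    literals-win : ∀ (y : Assignment n) (C : Clause n) {ρ viol fuel a c d} →
      (∀ c d → Win Good t (K , memory fuel₀ rounds z₀ z₁ best (encodeA y) (if clauseTrue y C then nil else viol) ctr fuel a nil c d) ρ) →
      Win Good (length C * literalTime + (1 + t))
        (literals ∷ K , memory fuel₀ rounds z₀ z₁ best (encodeA y) viol ctr fuel a (encodeList encodeLiteral C) c d) ρ
    literals-win y []            w = steps 1 refl (w _ _)
    literals-win y ((i , b) ∷ C) {ρ} {viol} {fuel} {a} w =
      go (literal-bound (toℕ i) (<⇒≤ (Finₚ.toℕ<n i)) (length C * literalTime))
         (literal-bound′ (toℕ i) (<⇒≤ (Finₚ.toℕ<n i)) (length C * literalTime)) (lookup y i) b refl w
      where
      u = length C * literalTime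
      -- The bit of y and the sign of the literal are made variables, so that a split on them
      -- reduces the conditionals of the program and of `clauseTrue` together.
      go : 6 + (toℕ i * 4 + (1 + (2 + (3 + (1 + t))))) ≤ literalTime + u + (1 + t) →
           6 + (toℕ i * 4 + (1 + (2 + (1 + (u + (1 + t)))))) ≤ literalTime + u + (1 + t) →
           ∀ b′ b → lookup y i ≡ b′ →
           (∀ c d → Win Good t (K , memory fuel₀ rounds z₀ z₁ best (encodeA y)
                      (if (if (if b′ then b else not b) then true else clauseTrue y C) then nil else viol) ctr fuel a nil c d) ρ) →
           ∀ {c d} →
           Win Good (literalTime + u + (1 + t))
             (literals ∷ K , memory fuel₀ rounds z₀ z₁ best (encodeA y) viol ctr fuel a ((encodeℕ (toℕ i) ∙ encodeBit b) ∙ encodeList encodeLiteral C) c d) ρ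
      go le₁ le₂ true  true  eq w = longer le₁ (steps 6 refl (seekIndex-win i y
        λ d → subst (λ b′ → Win Good _ (_ , memory _ _ _ _ _ _ _ _ _ _ _ _ (encodeBit b′ ∙ d)) _) (sym eq) (steps 6 refl (w _ _))))
      go le₁ le₂ false false eq w = longer le₁ (steps 6 refl (seekIndex-win i y
        λ d → subst (λ b′ → Win Good _ (_ , memory _ _ _ _ _ _ _ _ _ _ _ _ (encodeBit b′ ∙ d)) _) (sym eq) (steps 6 refl (w _ _))))
      go le₁ le₂ true  false eq w = longer le₂ (steps 6 refl (seekIndex-win i y
        λ d → subst (λ b′ → Win Good _ (_ , memory _ _ _ _ _ _ _ _ _ _ _ _ (encodeBit b′ ∙ d)) _) (sym eq) (steps 3 refl (literals-win y C w))))
      go le₁ le₂ false true  eq w = longer le₂ (steps 6 refl (seekIndex-win i y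
        λ d → subst (λ b′ → Win Good _ (_ , memory _ _ _ _ _ _ _ _ _ _ _ _ (encodeBit b′ ∙ d)) _) (sym eq) (steps 3 refl (literals-win y C w))))

module Subroutines {Good : Tree → Set} {n} (F : CNF n) where

  open Check {Good} F

  module _ {K : List Program} {t : ℕ} {fuel₀ rounds z₀ z₁ best ctr : Tree} where

    clauses-win : ∀ {k} (y : Assignment n) (G : CNF n) → IsKCNF k G → ∀ {ρ fuel b c d} →
      (∀ a b c d → Win Good t (K , memory fuel₀ rounds z₀ z₁ best (encodeA y) (encodeViolated (violated y G)) ctr fuel a b c d) ρ) →
      Win Good (length G * (9 + k * literalTime) + (1 + t))
        (clauses ∷ K , memory fuel₀ rounds z₀ z₁ best (encodeA y) nil ctr fuel (encodeList (encodeList encodeLiteral) G) b c d) ρ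
    clauses-win         y []      []        w = steps 1 refl (w _ _ _ _)
    clauses-win {k = k} y (C ∷ G) (C≤ ∷ G≤) {ρ} {fuel} w =
      longer bound (steps 6 refl (literals-win y C λ c d → go (clauseTrue y C) w))
      where
      u = length G * (9 + k * literalTime)
      bound : 6 + (length C * literalTime + (1 + (2 + (u + (1 + t))))) ≤ 9 + k * literalTime + u + (1 + t)
      bound = begin
        6 + (length C * literalTime + (1 + (2 + (u + (1 + t))))) ≡⟨ eq (length C * literalTime) u t ⟩
        9 + length C * literalTime + (u + (1 + t)) ≤⟨ +-monoˡ-≤ (u + (1 + t)) (+-monoʳ-≤ 9 (*-monoˡ-≤ literalTime C≤)) ⟩
        9 + k * literalTime + (u + (1 + t)) ≡⟨ +-assoc (9 + k * literalTime) u (1 + t) ⟨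
        9 + k * literalTime + u + (1 + t) ∎
        where
        open ≤-Reasoning
        eq : ∀ l u t → 6 + (l + (1 + (2 + (u + (1 + t))))) ≡ 9 + l + (u + (1 + t))
        eq = solve-∀
      go : ∀ true? →
           (∀ a b c d → Win Good t (K , memory fuel₀ rounds z₀ z₁ best (encodeA y) (encodeViolated (if true? then violated y G else just C)) ctr fuel a b c d) ρ) →
           ∀ {b c d} →
           Win Good (2 + (u + (1 + t)))
             (cond (var 7) (10 := nil) (10 := tl (var 10)) ∷ clauses ∷ K ,
              memory fuel₀ rounds z₀ z₁ best (encodeA y) (if true? then nil else (encodeList encodeLiteral C ∙ nil)) ctr fuel
                (encodeList encodeLiteral C ∙ encodeList (encodeList encodeLiteral) G) b c d) ρ
      go true  w = steps 2 refl (clauses-win y G G≤ w)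
      go false w = longer (+-monoʳ-≤ 2 (m≤n+m (1 + t) u)) (steps 3 refl (w _ _ _ _))

    check-win : ∀ {k} (y : Assignment n) → IsKCNF k F → ∀ {ρ viol fuel a b c d} →
      (∀ a b c d → Win Good t (K , memory fuel₀ rounds z₀ z₁ best (encodeA y) (encodeViolated (violated y F)) ctr fuel a b c d) ρ) →
      Win Good (4 + (length F * (9 + k * literalTime) + (1 + t)))
        (check ∷ K , memory fuel₀ rounds z₀ z₁ best (encodeA y) viol ctr fuel a b c d) ρ
    check-win y F≤ w = steps 4 refl (clauses-win y F F≤ w)

  module _ {K : List Program} {fuel₀ rounds z₀ z₁ best ctr : Tree} where

    unwind-win : ∀ l {t ρ y acc viol fuel a b d} →
      Win Good t (unwind ∷ K , memory fuel₀ rounds z₀ z₁ best (atop l y) viol ctr fuel a b acc d) ρ →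
      Win Good (length l * 4 + t) (unwind ∷ K , memory fuel₀ rounds z₀ z₁ best y viol ctr fuel a b (onto l acc) d) ρ
    unwind-win []          w = w
    unwind-win (u ∷ l) {t} w = longer (≤-reflexive (eq (length l) t)) (unwind-win l (steps 4 refl w))
      where
      eq : ∀ l t → l * 4 + (4 + t) ≡ 4 + l * 4 + t
      eq = solve-∀

  module _ {K : List Program} {t : ℕ} {fuel₀ rounds z₀ z₁ best ctr : Tree} where

    unwind-all : ∀ l {ρ viol fuel a b d} →
      Win Good t (K , memory fuel₀ rounds z₀ z₁ best (atop l nil) viol ctr fuel a b nil d) ρ →
      Win Good (length l * 4 + (1 + t)) (unwind ∷ K , memory fuel₀ rounds z₀ z₁ best nil viol ctr fuel a b (onto l nil) d) ρ
    unwind-all l w = unwind-win l (steps 1 refl w)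

    seek-win : ∀ {m} (i : Fin m) (y : Assignment m) b {ρ x viol fuel a acc} →
      (∀ l d → atop l (encodeBit b ∙ right d) ≡ encodeA (y Vec.[ i ]≔ b) → length l ≤ m →
       Win Good t (K , memory fuel₀ rounds z₀ z₁ best x viol ctr fuel a nil (onto l acc) d) ρ) →
      Win Good (toℕ i * 6 + (1 + t))
        (seek ∷ K , memory fuel₀ rounds z₀ z₁ best x viol ctr fuel a (encodeℕ (toℕ i)) acc (encodeA y)) ρ
    seek-win zero    (c ∷ y) b w = steps 1 refl (w [] _ refl z≤n)
    seek-win (suc i) (c ∷ y) b w = steps 6 refl (seek-win i y b
      λ l d eq l≤ → w (encodeBit c ∷ l) d (cong (encodeBit c ∙_) eq) (s≤s l≤))

  moveTime : ℕ
  moveTime = 12 + n * 10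

  module _ {K : List Program} {t : ℕ} {fuel₀ rounds z₀ z₁ best ctr : Tree} where

    moveP-win : ∀ (y : Assignment n) l {ρ viol fuel b c d} →
      (∀ a b c d → Win Good t (K , memory fuel₀ rounds z₀ z₁ best (encodeA (move y l)) viol ctr fuel a b c d) ρ) →
      Win Good (moveTime + t)
        (moveP ∷ K , memory fuel₀ rounds z₀ z₁ best (encodeA y) viol ctr fuel (encodeMaybe encodeLiteral l) b c d) ρ
    moveP-win y nothing        w = longer (s≤s (s≤s (m≤n+m t (10 + n * 10)))) (steps 2 refl (w _ _ _ _))
    moveP-win y (just (i , b)) {ρ} {viol} {fuel} w = longer bound (steps 8 refl (seek-win i y b λ l d eq l≤ →
      longer (+-monoʳ-≤ 2 (+-monoˡ-≤ (1 + t) (*-monoˡ-≤ 4 l≤)))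
        (steps 2 refl (unwind-win l (steps 1 refl
          (subst (λ y → Win Good t (K , memory fuel₀ rounds z₀ z₁ best y viol ctr fuel _ _ _ _) ρ) (sym eq) (w _ _ _ _)))))))
      where
      bound : 8 + (toℕ i * 6 + (1 + (2 + (n * 4 + (1 + t))))) ≤ moveTime + t
      bound = begin
        8 + (toℕ i * 6 + (1 + (2 + (n * 4 + (1 + t))))) ≤⟨ +-monoʳ-≤ 8 (+-monoˡ-≤ _ (*-monoˡ-≤ 6 (<⇒≤ (Finₚ.toℕ<n i)))) ⟩
        8 + (n * 6 + (1 + (2 + (n * 4 + (1 + t))))) ≡⟨ eq n t ⟩
        moveTime + t ∎
        where
        open ≤-Reasoning
        eq : ∀ n t → 8 + (n * 6 + (1 + (2 + (n * 4 + (1 + t))))) ≡ 12 + n * 10 + t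
        eq = solve-∀

  -- Quantified over the continuation, the memory and the payoff, so that the copying loop is
  -- verified once for both distributions.
  record NoiseWin (νP : Program) (ν : Noise) (τ : ℕ) : Set where
    field
      noise-win : ∀ {K t fuel₀ rounds z₀ z₁ best y viol ctr fuel a c d} b (h : Bool → ℚ) →
        (∀ b′ d → Win Good t (K , memory fuel₀ rounds z₀ z₁ best y viol ctr fuel a (encodeBit b′) c d) (h b′)) →
        Win Good (τ + t) (νP ∷ K , memory fuel₀ rounds z₀ z₁ best y viol ctr fuel a (encodeBit b) c d) (E (ν b) h)

  open NoiseWin

  fair-win : NoiseWin fairP fair 1
  fair-win .noise-win b h w = toss h λ b′ → w b′ _

  lazy-win : NoiseWin lazyP lazy 8
  lazy-win .noise-win {t = t} false h w = steps 1 refl (toss (λ c → E (if c then draw (λ c → ret (if c then true else false)) else ret false) h) λ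
    { false → longer (m≤n+m (2 + t) 4) (steps 2 refl (w false _))
    ; true  → steps 2 refl (toss (λ c → h (if c then true else false)) λ
      { false → longer (n≤1+n (2 + t)) (steps 2 refl (w false _))
      ; true  → steps 3 refl (w true _) }) })
  lazy-win .noise-win {t = t} true h w = steps 1 refl (toss (λ c → E (if c then draw (λ c → ret (if c then false else true)) else ret true) h) λ
    { false → longer (m≤n+m (2 + t) 4) (steps 2 refl (w true _))
    ; true  → steps 2 refl (toss (λ c → h (if c then false else true)) λ
      { false → longer (n≤1+n (2 + t)) (steps 2 refl (w true _))
      ; true  → steps 3 refl (w false _) }) })

  recast : ∀ {t κ ρ ρ′} → ρ ≡ ρ′ → Win Good t κ ρ′ → Win Good t κ ρ
  recast refl w = w

  module _ {K : List Program} {t : ℕ} {fuel₀ rounds z₀ z₁ best ctr : Tree} where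

    copy-win : ∀ {νP ν τ} → NoiseWin νP ν τ → ∀ {m} (z : Assignment m) (h : Assignment m → ℚ) {y viol fuel b acc d} →
      (∀ z′ b d → Win Good t (K , memory fuel₀ rounds z₀ z₁ best y viol ctr fuel nil b (onto (cells z′) acc) d) (h z′)) →
      Win Good (m * (7 + τ) + (1 + t))
        (copy νP ∷ K , memory fuel₀ rounds z₀ z₁ best y viol ctr fuel (encodeA z) b acc d) (E (resample ν z) h)
    copy-win         νw []      h w = steps 1 refl (w [] _ _)
    copy-win {ν = ν} {τ} νw {suc m} (c ∷ z) h w = recast (E-resample-∷ ν c z h) (longer (≤-reflexive (eq τ (m * (7 + τ)) t))
      (steps 4 refl (νw .noise-win c _ λ b′ d → steps 3 refl (copy-win νw z _ λ z′ → w (b′ ∷ z′)))))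
      where
      eq : ∀ τ u t → 4 + (τ + (3 + (u + (1 + t)))) ≡ 7 + τ + u + (1 + t)
      eq = solve-∀

  module _ {K : List Program} {t : ℕ} {fuel₀ rounds z₁ best ctr : Tree} where

    sample-win : ∀ {νP ν τ} → NoiseWin νP ν τ → ∀ (z : Assignment n) (h : Assignment n → ℚ) {y viol fuel a b c d} →
      (∀ y a b c d → Win Good t (K , memory fuel₀ rounds (encodeA z) z₁ best (encodeA y) viol ctr fuel a b c d) (h y)) →
      Win Good (9 + n * (11 + τ) + t)
        (sample νP ∷ K , memory fuel₀ rounds (encodeA z) z₁ best y viol ctr fuel a b c d) (E (resample ν z) h)
    sample-win {τ = τ} νw z h w = longer (≤-reflexive (eq n τ t)) (steps 5 refl (copy-win νw z h λ z′ b d → steps 2 refl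
      (longer (≤-reflexive (cong (λ m → m * 4 + (1 + t)) (length-cells z′))) (unwind-all (cells z′) (w z′ _ _ _ _)))))
      where
      eq : ∀ n τ t → 5 + (n * (7 + τ) + (1 + (2 + (n * 4 + (1 + t))))) ≡ 9 + n * (11 + τ) + t
      eq = solve-∀

-- Comparing and updating distances

d-H-refl : ∀ {n} (y : Assignment n) → d-H y y ≡ 0
d-H-refl []          = refl
d-H-refl (false ∷ y) = d-H-refl y
d-H-refl (true ∷ y)  = d-H-refl y

d-H≤n : ∀ {n} (y z : Assignment n) → d-H y z ≤ n
d-H≤n []          []          = z≤n
d-H≤n (false ∷ y) (false ∷ z) = m≤n⇒m≤1+n (d-H≤n y z)
d-H≤n (false ∷ y) (true ∷ z)  = s≤s (d-H≤n y z)
d-H≤n (true ∷ y)  (false ∷ z) = s≤s (d-H≤n y z)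
d-H≤n (true ∷ y)  (true ∷ z)  = m≤n⇒m≤1+n (d-H≤n y z)

truthy-∸ : ∀ i j → truthy (encodeℕ (j ∸ i)) ≡ (i <ᵇ j)
truthy-∸ zero    zero    = refl
truthy-∸ zero    (suc j) = refl
truthy-∸ (suc i) zero    = refl
truthy-∸ (suc i) (suc j) = truthy-∸ i j

module Improve {Good : Tree → Set} {n} (F : CNF n) where

  open Check {Good} F
  open Subroutines {Good} F

  improveTime : ℕ
  improveTime = 18 + n * 12

  module _ {K : List Program} {t : ℕ} {fuel₀ rounds z₀ z₁ best ctr : Tree} where

    count-win : ∀ {m} (u v : Assignment m) j {e} → d-H u v + j ≡ e → ∀ {ρ y viol fuel d} →
      (∀ b d → Win Good t (K , memory fuel₀ rounds z₀ z₁ best y viol ctr fuel nil b (encodeℕ e) d) ρ) →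
      Win Good (m * 8 + (1 + t))
        (count ∷ K , memory fuel₀ rounds z₀ z₁ best y viol ctr fuel (encodeA u) (encodeA v) (encodeℕ j) d) ρ
    count-win []          []          j refl w = steps 1 refl (w _ _)
    count-win (false ∷ u) (false ∷ v) j eq   w = steps 8 refl (count-win u v j eq w)
    count-win (true ∷ u)  (true ∷ v)  j eq   w = steps 8 refl (count-win u v j eq w)
    count-win (false ∷ u) (true ∷ v)  j eq   w = steps 8 refl (count-win u v (suc j) (trans (+-suc _ j) eq) w)
    count-win (true ∷ u)  (false ∷ v) j eq   w = steps 8 refl (count-win u v (suc j) (trans (+-suc _ j) eq) w)

    exceeds-win : ∀ i j {e} → j ∸ i ≡ e → ∀ {ρ y viol fuel c d} →
      Win Good t (K , memory fuel₀ rounds z₀ z₁ best y viol ctr fuel nil (encodeℕ e) c d) ρ →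
      Win Good (i * 4 + (1 + t))
        (exceeds ∷ K , memory fuel₀ rounds z₀ z₁ best y viol ctr fuel (encodeℕ i) (encodeℕ j) c d) ρ
    exceeds-win zero    j       refl w = steps 1 refl w
    exceeds-win (suc i) zero    refl w = steps 4 refl (exceeds-win i zero (0∸n≡0 i) w)
    exceeds-win (suc i) (suc j) eq   w = steps 4 refl (exceeds-win i j eq w)

  module _ {K : List Program} {t : ℕ} {fuel₀ rounds ctr : Tree} where

    improveP-win : ∀ (z₀ z₁ y : Assignment n) (h : Assignment n → ℚ) {viol fuel a b c d} →
      (∀ z₁ a b c d → Win Good t (K , memory fuel₀ rounds (encodeA z₀) (encodeA z₁) (encodeℕ (d-H z₀ z₁)) (encodeA y) viol ctr fuel a b c d) (h z₁)) →
      Win Good (improveTime + t)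
        (improveP ∷ K , memory fuel₀ rounds (encodeA z₀) (encodeA z₁) (encodeℕ (d-H z₀ z₁)) (encodeA y) viol ctr fuel a b c d)
        (h (improve z₀ z₁ (just y)))
    improveP-win z₀ z₁ y h {viol} {fuel} w = longer bound (steps 7 refl (count-win z₀ y 0 (+-identityʳ _) λ b d → steps 5 refl
      (exceeds-win (d-H z₀ z₁) (d-H z₀ y) refl (go _ refl))))
      where
      bound : 7 + (n * 8 + (1 + (5 + (d-H z₀ z₁ * 4 + (1 + (1 + (3 + t))))))) ≤ improveTime + t
      bound = begin
        7 + (n * 8 + (1 + (5 + (d-H z₀ z₁ * 4 + (1 + (1 + (3 + t))))))) ≤⟨ +-monoʳ-≤ 7 (+-monoʳ-≤ (n * 8) (+-monoʳ-≤ 6 (+-monoˡ-≤ (1 + (1 + (3 + t))) (*-monoˡ-≤ 4 (d-H≤n z₀ z₁))))) ⟩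
        7 + (n * 8 + (1 + (5 + (n * 4 + (1 + (1 + (3 + t))))))) ≡⟨ eq n t ⟩
        improveTime + t ∎
        where
        open ≤-Reasoning
        eq : ∀ n t → 7 + (n * 8 + (1 + (5 + (n * 4 + (1 + (1 + (3 + t))))))) ≡ 18 + n * 12 + t
        eq = solve-∀
      -- The remainder is made a variable so that it can be split into nil and a cell; the equation
      -- then settles the comparison in `improve`.
      go : ∀ u → u ≡ encodeℕ (d-H z₀ y ∸ d-H z₀ z₁) → ∀ {d} →
        Win Good (1 + (3 + t))
          (cond (var 11) (4 := var 6 ⨾ 5 := var 12) skip ∷ K ,
           memory fuel₀ rounds (encodeA z₀) (encodeA z₁) (encodeℕ (d-H z₀ z₁)) (encodeA y) viol ctr fuel nil
             u (encodeℕ (d-H z₀ y)) d)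
          (h (improve z₀ z₁ (just y)))
      go u eq with trans (cong truthy eq) (truthy-∸ (d-H z₀ z₁) (d-H z₀ y))
      go nil     eq | eq′ rewrite sym eq′ = longer (s≤s (s≤s (m≤n+m t 2))) (steps 2 refl (w z₁ _ _ _ _))
      go (_ ∙ _) eq | eq′ rewrite sym eq′ = steps 4 refl (w y _ _ _ _)

-- The loops and the main program

module Main (β : ℕ) (leaf : ℕ → ℕ) (speed growA growB : ℕ) where

  open Programs β leaf speed growA (suc growB)
  open Algorithm β leaf

  refuel : ℕ → ℕ → ℕ
  refuel zero    m = m
  refuel (suc i) m = refuel i (speed + m)

  -- The first argument only makes the recursion structural. Each call removes up to `suc growB`
  -- cells from m, and an incomplete last block still earns growA.
  grow : ℕ → ℕ → ℕ → ℕ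
  grow zero    m       w = w
  grow (suc f) zero    w = w
  grow (suc f) (suc m) w = grow f (m ∸ growB) (growA + w)

  rounds : ℕ → ℕ → ℕ
  rounds zero    w = w
  rounds (suc i) w = rounds i (grow w w 0)

  growTime : ℕ → ℕ → ℕ
  growTime zero    w = 1
  growTime (suc i) w = 8 + (w * 4 + growTime i (grow w w 0))

  module _ {Good : Tree → Set} {n} (F : CNF n) {k} (F≤ : IsKCNF k F) where

    open Check {Good} F
    open Subroutines {Good} F
    open Improve {Good} F

    checkTime walkStepTime : ℕ
    checkTime    = length F * (9 + k * literalTime)
    walkStepTime = 12 + (checkTime + (β * 3 + moveTime))

    module _ {K : List Program} {t : ℕ} {fuel₀ rounds z₀ z₁ best ctr : Tree} where

      pick-win : ∀ j v (C : Clause n) (h : ℕ → ℚ) {y fuel a b c d} →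
        (∀ v → Win Good t (K , memory fuel₀ rounds z₀ z₁ best y (encodeList encodeLiteral C ∙ nil) ctr fuel (encodeMaybe encodeLiteral (nth C (leaf v))) b c d) (h v)) →
        Win Good (j * 3 + (1 + t))
          (pick j v ∷ K , memory fuel₀ rounds z₀ z₁ best y (encodeList encodeLiteral C ∙ nil) ctr fuel a b c d)
          (E (bits j v) h)
      pick-win zero    v C h {y} {fuel} {a} {b} {c} {d} w = steps 1
        (cong (λ u → just (K , memory fuel₀ rounds z₀ z₁ best y (encodeList encodeLiteral C ∙ nil) ctr fuel u b c d))
          (trans (cong left (⟦tls⟧ (leaf v) _ _)) (nth-rights encodeLiteral C (leaf v)))) (w v)
      pick-win (suc j) v C h w = steps 1 refl (toss (λ b → E (bits j (if b then suc (2 * v) else 2 * v)) h) λ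
        { false → steps 1 refl (pick-win j (2 * v) C h w)
        ; true  → steps 1 refl (pick-win j (suc (2 * v)) C h w) })

    module _ {K : List Program} {t : ℕ} {fuel₀ rounds z₀ z₁ best ctr : Tree} where

      walkLoop-win : ∀ s (y : Assignment n) (h : Maybe (Assignment n) → ℚ) {u a b c d} →
        (∀ y a b c d → Win Good t (K , memory fuel₀ rounds z₀ z₁ best (encodeA y) nil ctr nil a b c d) (h (just y))) →
        (∀ y u a b c d → Win Good t (K , memory fuel₀ rounds z₀ z₁ best y (u ∙ nil) ctr nil a b c d) (h nothing)) →
        Win Good (s * walkStepTime + (1 + t))
          (walkLoop ∷ K , memory fuel₀ rounds z₀ z₁ best (encodeA y) (u ∙ nil) ctr (encodeℕ s) a b c d)
          (E (walk F s y) h)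
      walkLoop-win zero    y h found lost = steps 1 refl (lost _ _ _ _ _ _)
      walkLoop-win (suc s) y h found lost = longer (≤-reflexive (eq checkTime (β * 3) moveTime (s * walkStepTime) t))
        (steps 2 refl (check-win y F≤ λ a b c d → go (violated y F)))
        where
        eq : ∀ c p m u t → 2 + (4 + (c + (1 + (1 + (1 + (p + (1 + (1 + (m + (1 + (u + (1 + t)))))))))))) ≡
                           12 + (c + (p + m)) + u + (1 + t)
        eq = solve-∀
        go : ∀ v {a b c d} →
          Win Good (1 + (1 + (β * 3 + (1 + (1 + (moveTime + (1 + (s * walkStepTime + (1 + t)))))))))
            (cond (var 7) (pick β 0 ⨾ moveP ⨾ 9 := tl (var 9)) (9 := nil) ∷ walkLoop ∷ K ,
             memory fuel₀ rounds z₀ z₁ best (encodeA y) (encodeViolated v) ctr (nil ∙ encodeℕ s) a b c d)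
            (E (walkFrom F s y v) h)
        go nothing  = longer
          (≤-trans (m≤n+m (3 + t) _) (≤-reflexive (eq₂ (β * 3) moveTime (s * walkStepTime) t)))
          (steps 3 refl (found _ _ _ _ _))
          where
          eq₂ : ∀ p m u t → (p + m + u + 3) + (3 + t) ≡ 1 + (1 + (p + (1 + (1 + (m + (1 + (u + (1 + t))))))))
          eq₂ = solve-∀
        go (just C) = recast (E->>= (bits β 0) _ h) (steps 2 refl (pick-win β 0 C _ λ v → steps 1 refl
          (moveP-win y (nth C (leaf v)) λ a b c d → steps 1 refl (walkLoop-win s (move y (nth C (leaf v))) h found lost))))

    searchTime : ℕ → ℕ → ℕ
    searchTime τ s = 17 + (n * (11 + τ) + s * walkStepTime)

    module _ {K : List Program} {t : ℕ} {rounds z₁ best ctr : Tree} where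

      searchP-win : ∀ {νP ν τ} → NoiseWin νP ν τ → ∀ accept s z (h : Maybe (Assignment n) → ℚ) {y viol fuel a b c d} →
        (∀ y a b c d → Win Good t (accept ∷ K , memory (encodeℕ s) rounds (encodeA z) z₁ best (encodeA y) nil ctr nil a b c d) (h (just y))) →
        (∀ y viol a b c d → Win Good t (skip ∷ K , memory (encodeℕ s) rounds (encodeA z) z₁ best y viol ctr nil a b c d) (h nothing)) →
        Win Good (searchTime τ s + t)
          (searchP νP accept ∷ K , memory (encodeℕ s) rounds (encodeA z) z₁ best y viol ctr fuel a b c d)
          (E (search F s ν z) h)
      searchP-win {ν = ν} {τ} νw accept s z h found lost = longer (≤-reflexive (eq (n * (11 + τ)) (s * walkStepTime) t))
        (recast (E->>= (resample ν z) _ h) (steps 1 refl (sample-win νw z _ λ y a b c d → steps 5 refl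
          (walkLoop-win s y h (λ y a b c d → steps 1 refl (found y a b c d)) (λ y u a b c d → steps 1 refl (lost y _ a b c d))))))
        where
        eq : ∀ m u t → 1 + (9 + m + (5 + (u + (1 + (1 + t))))) ≡ 17 + (m + u) + t
        eq = solve-∀

    firstTime roundTime : ℕ → ℕ
    firstTime s = 4 + searchTime 1 s
    roundTime s = 4 + (searchTime 1 s + improveTime + (searchTime 8 s + improveTime))

    module _ {K : List Program} {t : ℕ} {rounds z₁ best : Tree} where

      firstLoop-win : ∀ s N (z : Assignment n) (h : Assignment n → ℚ) {y viol fuel a b c d} →
        (∀ z y viol fuel a b c d → Win Good t (K , memory (encodeℕ s) rounds (encodeA z) z₁ best y viol nil fuel a b c d) (h z)) →
        Win Good (N * firstTime s + (1 + t))
          (firstLoop ∷ K , memory (encodeℕ s) rounds (encodeA z) z₁ best y viol (encodeℕ N) fuel a b c d)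
          (E (iterate N (first F s) z) h)
      firstLoop-win s zero    z h w = steps 1 refl (w z _ _ _ _ _ _ _)
      firstLoop-win s (suc N) z h w = longer (≤-reflexive (eq (searchTime 1 s) (N * firstTime s) t))
        (recast (trans (E->>= (first F s z) _ h) (E->>= (search F s fair z) _ _))
          (steps 2 refl (searchP-win fair-win (3 := var 6) s z _
            (λ y a b c d → steps 2 refl (firstLoop-win s N y h w))
            (λ y viol a b c d → steps 2 refl (firstLoop-win s N z h w)))))
        where
        eq : ∀ m u t → 2 + (m + (2 + (u + (1 + t)))) ≡ 4 + m + u + (1 + t)
        eq = solve-∀

    module _ {K : List Program} {t : ℕ} {rounds : Tree} where

      attempt-win : ∀ {νP ν τ} → NoiseWin νP ν τ → ∀ s (z₀ z₁ : Assignment n) (h : Assignment n → ℚ) {y viol ctr fuel a b c d} →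
        (∀ z₁ y viol fuel a b c d → Win Good t (K , memory (encodeℕ s) rounds (encodeA z₀) (encodeA z₁) (encodeℕ (d-H z₀ z₁)) y viol ctr fuel a b c d) (h z₁)) →
        Win Good (searchTime τ s + (improveTime + t))
          (searchP νP improveP ∷ K , memory (encodeℕ s) rounds (encodeA z₀) (encodeA z₁) (encodeℕ (d-H z₀ z₁)) y viol ctr fuel a b c d)
          (E (attempt F s ν z₀ z₁) h)
      attempt-win {ν = ν} νw s z₀ z₁ h w = recast (E->>= (search F s ν z₀) _ h) (searchP-win νw improveP s z₀ _
        (λ y a b c d → improveP-win z₀ z₁ y h λ z₁ → w z₁ _ _ _)
        (λ y viol a b c d → longer (s≤s (m≤n+m t (17 + n * 12))) (steps 1 refl (w z₁ _ _ _ _ _ _ _))))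

    module _ {K : List Program} {t : ℕ} {rounds : Tree} where

      -- The stored distance is a separate `e` so that the nil of an unwritten variable can be read
      -- as the distance 0.
      roundLoop-win : ∀ s N (z₀ z₁ : Assignment n) {e} → d-H z₀ z₁ ≡ e → (h : Assignment n → ℚ) → ∀ {y viol fuel a b c d} →
        (∀ z₁ best y viol fuel a b c d → Win Good t (K , memory (encodeℕ s) rounds (encodeA z₀) (encodeA z₁) best y viol nil fuel a b c d) (h z₁)) →
        Win Good (N * roundTime s + (1 + t))
          (roundLoop ∷ K , memory (encodeℕ s) rounds (encodeA z₀) (encodeA z₁) (encodeℕ e) y viol (encodeℕ N) fuel a b c d)
          (E (iterate N (round F s z₀) z₁) h)
      roundLoop-win s zero    z₀ z₁ refl h w = steps 1 refl (w z₁ _ _ _ _ _ _ _ _)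
      roundLoop-win s (suc N) z₀ z₁ refl h w = longer (≤-reflexive (eq (searchTime 1 s) (searchTime 8 s) improveTime (N * roundTime s) t))
        (recast (trans (E->>= (round F s z₀ z₁) _ h) (E->>= (attempt F s fair z₀ z₁) _ _))
          (steps 2 refl (attempt-win fair-win s z₀ z₁ _ λ z₁ y viol fuel a b c d → steps 1 refl
            (attempt-win lazy-win s z₀ z₁ _ λ z₁ y viol fuel a b c d → steps 1 refl
              (roundLoop-win s N z₀ z₁ refl h w)))))
        where
        eq : ∀ m m′ i u t → 2 + (m + (i + (1 + (m′ + (i + (1 + (u + (1 + t)))))))) ≡ 4 + (m + i + (m′ + i)) + u + (1 + t)
        eq = solve-∀

-- The unary n in the input is at the same time an assignment, which spares the program a loop to
-- build its first one.
encodeℕ-A : ∀ n → encodeℕ n ≡ encodeA (Vec.replicate n false)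
encodeℕ-A zero    = refl
encodeℕ-A (suc n) = cong (nil ∙_) (encodeℕ-A n)

module MainWin (β : ℕ) (leaf : ℕ → ℕ) (speed growA growB : ℕ) where

  open Programs β leaf speed growA (suc growB)
  open Algorithm β leaf
  open Main β leaf speed growA growB

  module _ {Good : Tree → Set} {n} (F : CNF n) {k} (F≤ : IsKCNF k F) where

    open Check {Good} F
    open Subroutines {Good} F

    module _ {K : List Program} {z₀ z₁ best y viol ctr fuel : Tree} where

      fuelLoop-win : ∀ i m {t ρ rounds b c d} →
        Win Good t (K , memory (encodeℕ (refuel i m)) rounds z₀ z₁ best y viol ctr fuel nil b c d) ρ →
        Win Good (i * 4 + (1 + t)) (fuelLoop ∷ K , memory (encodeℕ m) rounds z₀ z₁ best y viol ctr fuel (encodeℕ i) b c d) ρ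
      fuelLoop-win zero    m w = steps 1 refl w
      fuelLoop-win (suc i) m {rounds = r} {b} {c} {d} w = steps 4
        (cong (λ u → just (fuelLoop ∷ K , memory u r z₀ z₁ best y viol ctr fuel (encodeℕ i) b c d))
          (⟦push⟧ speed (var 1) _ refl)) (fuelLoop-win i (speed + m) w)

      growStep-win : ∀ f m w → m ≤ f → ∀ {t ρ fuel₀ a c d} →
        Win Good t (K , memory fuel₀ (encodeℕ (grow f m w)) z₀ z₁ best y viol ctr fuel a nil c d) ρ →
        Win Good (f * 4 + (1 + t)) (growStep ∷ K , memory fuel₀ (encodeℕ w) z₀ z₁ best y viol ctr fuel a (encodeℕ m) c d) ρ
      growStep-win zero    zero    w _        W = steps 1 refl W
      growStep-win (suc f) zero    w _        W = longer (m≤n+m _ (4 + f * 4)) (steps 1 refl W)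
      growStep-win (suc f) (suc m) w (s≤s m≤f) {t} {ρ} {fuel₀} {a} {c} {d} W = steps 4
        (cong₂ (λ u v → just (growStep ∷ K , memory fuel₀ u z₀ z₁ best y viol ctr fuel a v c d))
          (⟦push⟧ growA (var 2) _ refl)
          (trans (⟦tls⟧ (suc growB) (var 11) _) (rights-encodeℕ growB m)))
        (growStep-win f (m ∸ growB) (growA + w) (≤-trans (m∸n≤m m growB) m≤f) W)

    module _ {K : List Program} {fuel₀ z₀ z₁ best y viol ctr fuel : Tree} where

      growLoop-win : ∀ i w {t ρ b c d} →
        (∀ b → Win Good t (K , memory fuel₀ (encodeℕ (rounds i w)) z₀ z₁ best y viol ctr fuel nil b c d) ρ) →
        Win Good (growTime i w + t) (growLoop ∷ K , memory fuel₀ (encodeℕ w) z₀ z₁ best y viol ctr fuel (encodeℕ i) b c d) ρ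
      growLoop-win zero    w W = steps 1 refl (W _)
      growLoop-win (suc i) w {t} W = longer (≤-reflexive (eq (w * 4) (growTime i (grow w w 0)) t))
        (steps 6 refl (growStep-win w w 0 ≤-refl (steps 1 refl (growLoop-win i (grow w w 0) W))))
        where
        eq : ∀ m u t → 6 + (m + (1 + (1 + (u + t)))) ≡ 8 + (m + u) + t
        eq = solve-∀

    walkLength : ℕ
    walkLength = refuel n (2 * speed + 0)

    mainTime : ℕ
    mainTime = 24 + (n * 4 + growTime n n + rounds n n * firstTime {Good} F F≤ walkLength + rounds n n * roundTime {Good} F F≤ walkLength)

    -- One derivation serves both claims: with h = 0 it gives halting in time, with the indicator of
    -- a diverse pair the success probability.
    main-win : ∀ (h : Assignment n × Assignment n → ℚ) → (∀ z → h z ℚ.≤ 1ℚ) →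
      (∀ z₀ z₁ → h (z₀ , z₁) ℚ.≤ 0ℚ ⊎ Good (encodeA z₀ ∙ encodeA z₁)) →
      Win Good mainTime (main ∷ [] , memory nil nil nil nil nil nil nil nil nil nil nil nil nil)
        (E (algorithm F walkLength (rounds n n) (Vec.replicate n false)) h)
    main-win h h≤1 h-good = longer (≤-reflexive (eq (n * 4) (growTime n n) _ _))
      (recast (trans (E->>= (iterate N (first F s) z) _ h) (E-cong (iterate N (first F s) z) λ z₀ → E->>= (iterate N (round F s z₀) z₀) _ h))
        (steps 2 (cong (λ u → just (_ ∷ [] , memory nil nil u nil nil nil nil nil nil nil nil nil nil)) (encodeℕ-A n))
        (steps 2 (cong (λ u → just (_ ∷ [] , memory u nil (encodeA z) nil nil nil nil nil nil nil nil nil nil)) (⟦push⟧ (2 * speed) nil (get (memory nil nil (encodeA z) nil nil nil nil nil nil nil nil nil nil)) {0} refl))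
        (steps 3 refl (fuelLoop-win n (2 * speed + 0)
        (steps 5 refl (growLoop-win n n λ b →
        (steps 3 refl (firstLoop-win F F≤ s N z _ λ z₀ y viol fuel a b c d →
        (steps 5 refl (roundLoop-win F F≤ s N z₀ z₀ (d-H-refl z₀) _ λ z₁ best y viol fuel a b c d → steps 1 refl (end z₀ z₁))))))))))))
      where
      s = walkLength
      N = rounds n n
      z = Vec.replicate n false
      eq : ∀ f g u v → 2 + (2 + (3 + (f + (1 + (5 + (g + (3 + (u + (1 + (5 + (v + (1 + (1 + 0))))))))))))) ≡
                       24 + (f + g + u + v)
      eq = solve-∀
      end : ∀ z₀ z₁ {s} → Win Good 0 ([] , (encodeA z₀ ∙ encodeA z₁) ∷ s) (h (z₀ , z₁))
      end z₀ z₁ with h-good z₀ z₁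
      ... | inj₁ h≤0 = bad h≤0
      ... | inj₂ g   = good g (h≤1 (z₀ , z₁))

-- Distances and disagreement

infix 4 _≼_

_≼_ : ℚ → ℚ → Set
_≼_ = ℚ._≤_

≼-refl : ∀ {p} → p ≼ p
≼-refl = ℚₚ.≤-refl

0≼1 : 0ℚ ≼ 1ℚ
0≼1 = ℚₚ.nonNegative⁻¹ 1ℚ

*-mono : ∀ {p p′ q q′} → 0ℚ ≼ p → p ≼ p′ → 0ℚ ≼ q → q ≼ q′ → p ℚ.* q ≼ p′ ℚ.* q′
*-mono {p} {p′} {q} {q′} 0≤p p≤p′ 0≤q q≤q′ = ℚₚ.≤-trans
  (ℚₚ.*-monoˡ-≤-nonNeg p {{ℚ.nonNegative 0≤p}} q≤q′)
  (ℚₚ.*-monoʳ-≤-nonNeg q′ {{ℚ.nonNegative (ℚₚ.≤-trans 0≤q q≤q′)}} p≤p′)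

*-monoʳ : ∀ {p q q′} → 0ℚ ≼ p → q ≼ q′ → p ℚ.* q ≼ p ℚ.* q′
*-monoʳ {p} 0≤p = ℚₚ.*-monoˡ-≤-nonNeg p {{ℚ.nonNegative 0≤p}}

0≼* : ∀ {p q} → 0ℚ ≼ p → 0ℚ ≼ q → 0ℚ ≼ p ℚ.* q
0≼* {p} {q} 0≤p 0≤q = subst (_≼ p ℚ.* q) (ℚₚ.*-zeroʳ p) (*-monoʳ 0≤p 0≤q)

0≼+ : ∀ {p q} → 0ℚ ≼ p → 0ℚ ≼ q → 0ℚ ≼ p ℚ.+ q
0≼+ = ℚₚ.+-mono-≤

0≼⇒≼ : ∀ {p q} → 0ℚ ≼ q ℚ.- p → p ≼ q
0≼⇒≼ {p} {q} le = subst₂ _≼_ (ℚₚ.+-identityʳ p) (lemma p q) (ℚₚ.+-monoʳ-≤ p le)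
  where
  lemma : ∀ p q → p ℚ.+ (q ℚ.- p) ≡ q
  lemma = RingSolver.solve-∀ ℚ-ring

≼⇒0≼ : ∀ {p q} → p ≼ q → 0ℚ ≼ q ℚ.- p
≼⇒0≼ {p} {q} le = subst (_≼ q ℚ.- p) (ℚₚ.+-inverseʳ p) (ℚₚ.+-monoˡ-≤ (ℚ.- p) le)

pow : ℚ → ℕ → ℚ
pow p zero    = 1ℚ
pow p (suc n) = p ℚ.* pow p n

0≼pow : ∀ {p} n → 0ℚ ≼ p → 0ℚ ≼ pow p n
0≼pow zero    0≤p = 0≼1
0≼pow (suc n) 0≤p = 0≼* 0≤p (0≼pow n 0≤p)

pow-mono : ∀ {p q} n → 0ℚ ≼ p → p ≼ q → pow p n ≼ pow q n
pow-mono zero    0≤p p≤q = ≼-refl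
pow-mono (suc n) 0≤p p≤q = *-mono 0≤p p≤q (0≼pow n 0≤p) (pow-mono n 0≤p p≤q)

pow-1 : ∀ n → pow 1ℚ n ≡ 1ℚ
pow-1 zero    = refl
pow-1 (suc n) = trans (ℚₚ.*-identityˡ (pow 1ℚ n)) (pow-1 n)

pow≼1 : ∀ {p} n → 0ℚ ≼ p → p ≼ 1ℚ → pow p n ≼ 1ℚ
pow≼1 {p} n 0≤p p≤1 = subst (pow p n ≼_) (pow-1 n) (pow-mono n 0≤p p≤1)

pow-+ : ∀ p m n → pow p (m + n) ≡ pow p m ℚ.* pow p n
pow-+ p zero    n = sym (ℚₚ.*-identityˡ (pow p n))
pow-+ p (suc m) n = trans (cong (p ℚ.*_) (pow-+ p m n)) (sym (ℚₚ.*-assoc p (pow p m) (pow p n)))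

pow-* : ∀ p q n → pow (p ℚ.* q) n ≡ pow p n ℚ.* pow q n
pow-* p q zero    = refl
pow-* p q (suc n) = trans (cong ((p ℚ.* q) ℚ.*_) (pow-* p q n)) (lemma p q (pow p n) (pow q n))
  where
  lemma : ∀ p q r s → (p ℚ.* q) ℚ.* (r ℚ.* s) ≡ (p ℚ.* r) ℚ.* (q ℚ.* s)
  lemma = RingSolver.solve-∀ ℚ-ring

pow-pow : ∀ p m n → pow p (m * n) ≡ pow (pow p n) m
pow-pow p zero    n = refl
pow-pow p (suc m) n = trans (pow-+ p n (m * n)) (cong (pow p n ℚ.*_) (pow-pow p m n))

pow-decreasing : ∀ {p m n} → 0ℚ ≼ p → p ≼ 1ℚ → m ≤ n → pow p n ≼ pow p m
pow-decreasing {p} {m} {n} 0≤p p≤1 m≤n = subst₂ _≼_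
  (trans (sym (pow-+ p m (n ∸ m))) (cong (pow p) (m+[n∸m]≡n m≤n))) (ℚₚ.*-identityʳ (pow p m))
  (*-monoʳ (0≼pow m 0≤p) (pow≼1 (n ∸ m) 0≤p p≤1))

E-* : ∀ {A} (c : Comp A) p (h : A → ℚ) → E c (λ a → p ℚ.* h a) ≡ p ℚ.* E c h
E-* (ret a)  p h = refl
E-* (draw f) p h = trans (cong₂ mean (E-* (f false) p h) (E-* (f true) p h)) (lemma p (E (f false) h) (E (f true) h))
  where
  lemma : ∀ p a b → ½ ℚ.* (p ℚ.* a ℚ.+ p ℚ.* b) ≡ p ℚ.* (½ ℚ.* (a ℚ.+ b))
  lemma = RingSolver.solve-∀ ℚ-ring

0≼E : ∀ {A} (c : Comp A) {h : A → ℚ} → (∀ a → 0ℚ ≼ h a) → 0ℚ ≼ E c h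
0≼E c {h} le = subst (_≼ E c h) (E-const c 0ℚ) (E-mono c le)

d-H-sym : ∀ {n} (y z : Assignment n) → d-H y z ≡ d-H z y
d-H-sym []          []          = refl
d-H-sym (false ∷ y) (false ∷ z) = d-H-sym y z
d-H-sym (false ∷ y) (true ∷ z)  = cong suc (d-H-sym y z)
d-H-sym (true ∷ y)  (false ∷ z) = cong suc (d-H-sym y z)
d-H-sym (true ∷ y)  (true ∷ z)  = d-H-sym y z

bitDistance : Bool → Bool → ℕ
bitDistance false false = 0
bitDistance false true  = 1
bitDistance true  false = 1
bitDistance true  true  = 0

d-H-∷ : ∀ {n} a b (y z : Assignment n) → d-H (a ∷ y) (b ∷ z) ≡ bitDistance a b + d-H y z
d-H-∷ false false y z = refl
d-H-∷ false true  y z = refl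
d-H-∷ true  false y z = refl
d-H-∷ true  true  y z = refl

bitDistance-triangle : ∀ a b c → bitDistance a c ≤ bitDistance a b + bitDistance b c
bitDistance-triangle false false c     = ≤-refl
bitDistance-triangle false true  false = z≤n
bitDistance-triangle false true  true  = ≤-refl
bitDistance-triangle true  false false = ≤-refl
bitDistance-triangle true  false true  = z≤n
bitDistance-triangle true  true  c     = ≤-refl

d-H-triangle : ∀ {n} (x y z : Assignment n) → d-H x z ≤ d-H x y + d-H y z
d-H-triangle []      []      []      = z≤n
d-H-triangle (a ∷ x) (b ∷ y) (c ∷ z) = begin
  d-H (a ∷ x) (c ∷ z)                                                    ≡⟨ d-H-∷ a c x z ⟩
  bitDistance a c + d-H x z ≤⟨ +-mono-≤ (bitDistance-triangle a b c) (d-H-triangle x y z) ⟩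
  bitDistance a b + bitDistance b c + (d-H x y + d-H y z) ≡⟨ eq (bitDistance a b) (bitDistance b c) (d-H x y) (d-H y z) ⟩
  bitDistance a b + d-H x y + (bitDistance b c + d-H y z) ≡⟨ cong₂ _+_ (d-H-∷ a b x y) (d-H-∷ b c y z) ⟨
  d-H (a ∷ x) (b ∷ y) + d-H (b ∷ y) (c ∷ z)                              ∎
  where
  open ≤-Reasoning
  eq : ∀ p q r s → p + q + (r + s) ≡ p + r + (q + s)
  eq = solve-∀

d-H-update : ∀ {n} (y : Assignment n) i b → d-H y (y Vec.[ i ]≔ b) ≤ 1
d-H-update (false ∷ y) zero    false = subst (_≤ 1) (sym (d-H-refl y)) z≤n
d-H-update (false ∷ y) zero    true  = s≤s (≤-reflexive (d-H-refl y))
d-H-update (true ∷ y)  zero    false = s≤s (≤-reflexive (d-H-refl y))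
d-H-update (true ∷ y)  zero    true  = subst (_≤ 1) (sym (d-H-refl y)) z≤n
d-H-update (false ∷ y) (suc i) b     = d-H-update y i b
d-H-update (true ∷ y)  (suc i) b     = d-H-update y i b

d-H-move : ∀ {n} (y : Assignment n) l → d-H y (move y l) ≤ 1
d-H-move y nothing        = subst (_≤ 1) (sym (d-H-refl y)) z≤n
d-H-move y (just (i , b)) = d-H-update y i b

d-H-correct : ∀ {n} (y z : Assignment n) i → lookup y i ≢ lookup z i →
              d-H y z ≡ suc (d-H (y Vec.[ i ]≔ lookup z i) z)
d-H-correct (false ∷ y) (false ∷ z) zero    ≢ = ⊥-elim (≢ refl)
d-H-correct (false ∷ y) (true ∷ z)  zero    ≢ = refl
d-H-correct (true ∷ y)  (false ∷ z) zero    ≢ = refl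
d-H-correct (true ∷ y)  (true ∷ z)  zero    ≢ = ⊥-elim (≢ refl)
d-H-correct (false ∷ y) (false ∷ z) (suc i) ≢ = d-H-correct y z i ≢
d-H-correct (false ∷ y) (true ∷ z)  (suc i) ≢ = cong suc (d-H-correct y z i ≢)
d-H-correct (true ∷ y)  (false ∷ z) (suc i) ≢ = cong suc (d-H-correct y z i ≢)
d-H-correct (true ∷ y)  (true ∷ z)  (suc i) ≢ = d-H-correct y z i ≢

isTrue-sound : ∀ {n} (y : Assignment n) i b → isTrue y (i , b) ≡ true → lookup y i ≡ b
isTrue-sound y i b     eq with lookup y i
isTrue-sound y i true  eq | true  = refl
isTrue-sound y i false eq | false = refl

isTrue-complete : ∀ {n} (y : Assignment n) i b → isTrue y (i , b) ≡ false → lookup y i ≢ b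
isTrue-complete y i b     eq with lookup y i
isTrue-complete y i true  () | true
isTrue-complete y i false eq | true  = λ ()
isTrue-complete y i true  eq | false = λ ()
isTrue-complete y i false () | false

clauseTrue-sound : ∀ {n} (y : Assignment n) C → clauseTrue y C ≡ true → Any (LitTrue y) C
clauseTrue-sound y ((i , b) ∷ C) eq with isTrue y (i , b) in eq′
... | true  = here (isTrue-sound y i b eq′)
... | false = there (clauseTrue-sound y C eq)

violated-sound : ∀ {n} (y : Assignment n) F → violated y F ≡ nothing → y ⊨ F
violated-sound y []      eq = []
violated-sound y (C ∷ F) eq with clauseTrue y C in eq′
... | true = clauseTrue-sound y C eq′ ∷ violated-sound y F eq

-- z makes some literal of C true and y makes all of them false, so y and z differ at its variable,
-- and setting that variable to satisfy the literal gives it the value it has in z.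
disagreement : ∀ {n} (y z : Assignment n) C → clauseTrue y C ≡ false → Any (LitTrue z) C →
  ∃[ j ] ∃[ i ] j < length C × nth C j ≡ just (i , lookup z i) × lookup y i ≢ lookup z i
disagreement y z ((i , b) ∷ C) eq any with isTrue y (i , b) in eq′
disagreement y z ((i , b) ∷ C) eq (here refl) | false = 0 , i , s≤s z≤n , refl , isTrue-complete y i b eq′
disagreement y z ((i , b) ∷ C) eq (there any) | false with disagreement y z C eq any
... | j , i′ , j< , nth≡ , ≢ = suc j , i′ , s≤s j< , nth≡ , ≢

violated-disagreement : ∀ {n k} (y z : Assignment n) F {C} → IsKCNF k F → z ⊨ F → violated y F ≡ just C →
  ∃[ j ] ∃[ i ] j < k × nth C j ≡ just (i , lookup z i) × lookup y i ≢ lookup z i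
violated-disagreement y z (C ∷ F) (C≤ ∷ F≤) (zC ∷ zF) eq with clauseTrue y C in eq′
violated-disagreement y z (C ∷ F) (C≤ ∷ F≤) (zC ∷ zF) refl | false with disagreement y z C eq′ zC
... | j , i , j< , nth≡ , ≢ = j , i , ≤-trans j< C≤ , nth≡ , ≢
violated-disagreement y z (C ∷ F) (C≤ ∷ F≤) (zC ∷ zF) eq | true = violated-disagreement y z F F≤ zF eq

-- The potential of a walk

-- For a step that lowers d with probability p and raises it otherwise, x ^ d is multiplied on
-- average by at least ℓ and X ^ d by at most ℓ. Hence x ^ d - w X ^ d gains the factor ℓ for every
-- w ≥ 0. Since p only bounds the probability of the right literal from below, `pick-likely` speaks
-- of lower bounds `lo` and `hi` on the payoff.
record Drift (β : ℕ) (leaf : ℕ → ℕ) (k : ℕ) : Set where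
  field
    p x X ℓ μ : ℚ
    0≼p  : 0ℚ ≼ p
    0<x  : 0ℚ ℚ.< x
    x≼X  : x ≼ X
    X≼1  : X ≼ 1ℚ
    1≼ℓ  : 1ℚ ≼ ℓ
    0≼μ  : 0ℚ ≼ μ
    ℓμ≡1 : ℓ ℚ.* μ ≡ 1ℚ
    x-drift : ℓ ℚ.* x ≼ p ℚ.+ (1ℚ ℚ.- p) ℚ.* (x ℚ.* x)
    X-drift : p ℚ.+ (1ℚ ℚ.- p) ℚ.* (X ℚ.* X) ≼ ℓ ℚ.* X
    pick-likely : ∀ j → j < k → ∀ (g : ℕ → ℚ) {lo hi} → lo ≼ hi → (∀ v → lo ≼ g v) →
      (∀ v → leaf v ≡ j → hi ≼ g v) → lo ℚ.+ p ℚ.* (hi ℚ.- lo) ≼ E (bits β 0) g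

module Walk {β leaf k} (drift : Drift β leaf k) where

  open Drift drift
  open Algorithm β leaf

  0≼x : 0ℚ ≼ x
  0≼x = ℚₚ.<⇒≤ 0<x

  0≼X : 0ℚ ≼ X
  0≼X = ℚₚ.≤-trans 0≼x x≼X

  x≼1 : x ≼ 1ℚ
  x≼1 = ℚₚ.≤-trans x≼X X≼1

  -- The second term makes the potential negative where d is large, so that
  -- solutions found far from z may be ignored.
  potential : ℚ → ℕ → ℚ
  potential w d = pow x d ℚ.- w ℚ.* pow X d

  module _ {w} (0≼w : 0ℚ ≼ w) where

    potential≼1 : ∀ d → potential w d ≼ 1ℚ
    potential≼1 d = 0≼⇒≼ (subst (0ℚ ≼_) (lemma (pow x d) (w ℚ.* pow X d))
      (0≼+ (≼⇒0≼ (pow≼1 d 0≼x x≼1)) (0≼* 0≼w (0≼pow d 0≼X))))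
      where
      lemma : ∀ a c → (1ℚ ℚ.- a) ℚ.+ c ≡ 1ℚ ℚ.- (a ℚ.- c)
      lemma = RingSolver.solve-∀ ℚ-ring

    module _ (e : ℕ) (0≼f : 0ℚ ≼ potential w (suc e)) where

      private
        a c : ℚ
        a = pow x e
        c = w ℚ.* pow X e

        0≼a : 0ℚ ≼ a
        0≼a = 0≼pow e 0≼x

        0≼c : 0ℚ ≼ c
        0≼c = 0≼* 0≼w (0≼pow e 0≼X)

        shift : ∀ X c → w ℚ.* (X ℚ.* c) ≡ X ℚ.* (w ℚ.* c)
        shift X c = lemma w X c
          where
          lemma : ∀ w X c → w ℚ.* (X ℚ.* c) ≡ X ℚ.* (w ℚ.* c)
          lemma = RingSolver.solve-∀ ℚ-ring

        f₁ : potential w (suc e) ≡ x ℚ.* a ℚ.- X ℚ.* c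
        f₁ = cong (λ r → x ℚ.* a ℚ.- r) (shift X (pow X e))

        f₂ : potential w (suc (suc e)) ≡ x ℚ.* (x ℚ.* a) ℚ.- X ℚ.* (X ℚ.* c)
        f₂ = cong (λ r → x ℚ.* (x ℚ.* a) ℚ.- r) (trans (shift X (X ℚ.* pow X e)) (cong (X ℚ.*_) (shift X (pow X e))))

        Xc≼xa : X ℚ.* c ≼ x ℚ.* a
        Xc≼xa = 0≼⇒≼ (subst (0ℚ ≼_) f₁ 0≼f)

        c≼a : c ≼ a
        c≼a = ℚₚ.*-cancelˡ-≤-pos x {{ℚ.positive 0<x}}
          (ℚₚ.≤-trans (ℚₚ.*-monoʳ-≤-nonNeg c {{ℚ.nonNegative 0≼c}} x≼X) Xc≼xa)

        descend : ∀ {a c} → 0ℚ ≼ c → c ≼ a → x ℚ.* a ℚ.- X ℚ.* c ≼ a ℚ.- c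
        descend {a} {c} 0≼c c≼a = 0≼⇒≼ (subst (0ℚ ≼_) (lemma x X a c)
          (0≼+ (0≼* (≼⇒0≼ x≼1) (≼⇒0≼ c≼a)) (0≼* (≼⇒0≼ x≼X) 0≼c)))
          where
          lemma : ∀ x X a c → (1ℚ ℚ.- x) ℚ.* (a ℚ.- c) ℚ.+ (X ℚ.- x) ℚ.* c ≡ (a ℚ.- c) ℚ.- (x ℚ.* a ℚ.- X ℚ.* c)
          lemma = RingSolver.solve-∀ ℚ-ring

      -- The potential need not be monotone in d, because the subtracted term may dominate. Where it
      -- is nonnegative, at `suc e`, it follows that c ≤ a, and this gives the decrease from e to e
      -- + 2, the range that a single move can reach.
      potential-down₁ : potential w (suc e) ≼ potential w e
      potential-down₁ = subst (_≼ potential w e) (sym f₁) (descend 0≼c c≼a)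

      potential-down₂ : potential w (suc (suc e)) ≼ potential w (suc e)
      potential-down₂ = subst₂ _≼_ (sym f₂) (sym f₁) (descend (0≼* 0≼X 0≼c) Xc≼xa)

      potential-grows : ℓ ℚ.* potential w (suc e) ≼
        potential w (suc (suc e)) ℚ.+ p ℚ.* (potential w e ℚ.- potential w (suc (suc e)))
      potential-grows = subst₂ (λ f₁ f₂ → ℓ ℚ.* f₁ ≼ f₂ ℚ.+ p ℚ.* (potential w e ℚ.- f₂)) (sym f₁) (sym f₂)
        -- The gap is a times the slack of `x-drift` plus c times the slack of `X-drift`.
        (0≼⇒≼ (subst (0ℚ ≼_) (lemma p x X ℓ a c)
          (0≼+ (0≼* (≼⇒0≼ x-drift) 0≼a) (0≼* (≼⇒0≼ X-drift) 0≼c))))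
        where
        lemma : ∀ p x X ℓ a c →
          (p ℚ.+ (1ℚ ℚ.- p) ℚ.* (x ℚ.* x) ℚ.- ℓ ℚ.* x) ℚ.* a ℚ.+ (ℓ ℚ.* X ℚ.- (p ℚ.+ (1ℚ ℚ.- p) ℚ.* (X ℚ.* X))) ℚ.* c ≡
          (x ℚ.* (x ℚ.* a) ℚ.- X ℚ.* (X ℚ.* c)) ℚ.+ p ℚ.* ((a ℚ.- c) ℚ.- (x ℚ.* (x ℚ.* a) ℚ.- X ℚ.* (X ℚ.* c))) ℚ.-
            ℓ ℚ.* (x ℚ.* a ℚ.- X ℚ.* c)
        lemma = RingSolver.solve-∀ ℚ-ring

    potential-near : ∀ {e d} → 0ℚ ≼ potential w (suc e) → e ≤ d → d ≤ suc (suc e) → potential w (suc (suc e)) ≼ potential w d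
    potential-near {e} {d} 0≼f e≤d d≤ with m≤n⇒m<n∨m≡n d≤
    ... | inj₂ refl = ≼-refl
    ... | inj₁ (s≤s d≤e+1) with m≤n⇒m<n∨m≡n d≤e+1
    ...   | inj₂ refl = potential-down₂ e 0≼f
    ...   | inj₁ (s≤s d≤e) with ≤-antisym d≤e e≤d
    ...     | refl = ℚₚ.≤-trans (potential-down₂ e 0≼f) (potential-down₁ e 0≼f)

    module _ {n} (F : CNF n) (F≤ : IsKCNF k F) {z : Assignment n} (z⊨F : z ⊨ F)
             (h : Maybe (Assignment n) → ℚ) (0≼h : ∀ r → 0ℚ ≼ h r)
             (found : ∀ y → y ⊨ F → potential w (d-H y z) ≼ h (just y)) where

      -- The term μ ^ t is the price of limited fuel. At t = 0 the bound is void because the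
      -- potential is at most 1. In a step the potential and the price both gain the factor ℓ = 1/μ,
      -- so a nonnegative difference does not shrink; a nonpositive one needs nothing but h ≥ 0.
      -- Thus growth is only used where the potential is nonnegative.
      walk-lower : ∀ t y → potential w (d-H y z) ℚ.- pow μ t ≼ E (walk F t y) h
      walk-lower zero y = ℚₚ.≤-trans (0≼⇒≼ (subst (0ℚ ≼_) (lemma (potential w (d-H y z))) (≼⇒0≼ (potential≼1 (d-H y z))))) (0≼h nothing)
        where
        lemma : ∀ f → 1ℚ ℚ.- f ≡ 0ℚ ℚ.- (f ℚ.- 1ℚ)
        lemma = RingSolver.solve-∀ ℚ-ring
      walk-lower (suc t) y with violated y F in eq
      ... | nothing = ℚₚ.≤-trans (0≼⇒≼ (subst (0ℚ ≼_) (lemma (potential w (d-H y z)) (pow μ (suc t))) (0≼pow (suc t) 0≼μ)))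
                        (found y (violated-sound y F eq))
        where
        lemma : ∀ f m → m ≡ f ℚ.- (f ℚ.- m)
        lemma = RingSolver.solve-∀ ℚ-ring
      ... | just C with violated-disagreement y z F F≤ z⊨F eq
      ...   | j , i , j<k , nth≡ , ≢ = subst₂ (λ d r → potential w d ℚ.- pow μ (suc t) ≼ r)
              (sym dist) (sym (E->>= (bits β 0) _ h)) (go (ℚₚ.≤-total (potential w (suc e)) (pow μ (suc t))))
        where
        e : ℕ
        e = d-H (y Vec.[ i ]≔ lookup z i) z
        dist : d-H y z ≡ suc e
        dist = d-H-correct y z i ≢
        y′ : ℕ → Assignment n
        y′ v = move y (nth C (leaf v))
        near₁ : ∀ v → e ≤ d-H (y′ v) z
        near₁ v = s≤s⁻¹ (subst (_≤ 1 + d-H (y′ v) z) dist (≤-trans (d-H-triangle y (y′ v) z) (+-monoˡ-≤ _ (d-H-move y (nth C (leaf v))))))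
        near₂ : ∀ v → d-H (y′ v) z ≤ suc (suc e)
        near₂ v = ≤-trans (d-H-triangle (y′ v) y z) (+-mono-≤ (subst (_≤ 1) (d-H-sym y (y′ v)) (d-H-move y (nth C (leaf v)))) (≤-reflexive dist))
        go : potential w (suc e) ≼ pow μ (suc t) ⊎ pow μ (suc t) ≼ potential w (suc e) →
             potential w (suc e) ℚ.- pow μ (suc t) ≼ E (bits β 0) (λ v → E (walk F t (y′ v)) h)
        go (inj₁ f≤m) = ℚₚ.≤-trans (0≼⇒≼ (subst (0ℚ ≼_) (lemma (potential w (suc e)) (pow μ (suc t))) (≼⇒0≼ f≤m)))
          (0≼E (bits β 0) λ v → 0≼E (walk F t (y′ v)) 0≼h)
          where
          lemma : ∀ f m → m ℚ.- f ≡ 0ℚ ℚ.- (f ℚ.- m)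
          lemma = RingSolver.solve-∀ ℚ-ring
        go (inj₂ m≤f) = begin
          f₁ ℚ.- μ ℚ.* m                                     ≤⟨ scale ⟩
          ℓ ℚ.* (f₁ ℚ.- μ ℚ.* m)                             ≡⟨ lemma₁ ℓ f₁ μ m ⟩
          ℓ ℚ.* f₁ ℚ.- (ℓ ℚ.* μ) ℚ.* m ≡⟨ cong (λ r → ℓ ℚ.* f₁ ℚ.- r) (trans (cong (ℚ._* m) ℓμ≡1) (ℚₚ.*-identityˡ m)) ⟩
          ℓ ℚ.* f₁ ℚ.- m ≤⟨ ℚₚ.+-monoˡ-≤ (ℚ.- m) (potential-grows e 0≼f₁) ⟩
          f₂ ℚ.+ p ℚ.* (f₀ ℚ.- f₂) ℚ.- m                     ≡⟨ lemma₂ f₂ p f₀ m ⟩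
          (f₂ ℚ.- m) ℚ.+ p ℚ.* ((f₀ ℚ.- m) ℚ.- (f₂ ℚ.- m))   ≤⟨ pick-likely j j<k _
                                                                   (ℚₚ.+-monoˡ-≤ (ℚ.- m) (ℚₚ.≤-trans (potential-down₂ e 0≼f₁) (potential-down₁ e 0≼f₁)))
                                                                   (λ v → ℚₚ.≤-trans (ℚₚ.+-monoˡ-≤ (ℚ.- m) (potential-near 0≼f₁ (near₁ v) (near₂ v))) (walk-lower t (y′ v)))
                                                                   hits ⟩
          E (bits β 0) (λ v → E (walk F t (y′ v)) h)         ∎
          where
          open ℚₚ.≤-Reasoning
          m f₀ f₁ f₂ : ℚ
          m = pow μ t
          f₀ = potential w e
          f₁ = potential w (suc e)
          f₂ = potential w (suc (suc e))
          0≼f₁ : 0ℚ ≼ f₁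
          0≼f₁ = ℚₚ.≤-trans (0≼pow (suc t) 0≼μ) m≤f
          scale : f₁ ℚ.- μ ℚ.* m ≼ ℓ ℚ.* (f₁ ℚ.- μ ℚ.* m)
          scale = subst (_≼ ℓ ℚ.* (f₁ ℚ.- μ ℚ.* m)) (ℚₚ.*-identityˡ (f₁ ℚ.- μ ℚ.* m))
            (ℚₚ.*-monoʳ-≤-nonNeg (f₁ ℚ.- μ ℚ.* m) {{ℚ.nonNegative (≼⇒0≼ m≤f)}} 1≼ℓ)
          hits : ∀ v → leaf v ≡ j → f₀ ℚ.- m ≼ E (walk F t (y′ v)) h
          hits v refl = subst (λ l → potential w e ℚ.- m ≼ E (walk F t (move y l)) h) (sym nth≡)
            (walk-lower t (y Vec.[ i ]≔ lookup z i))
          lemma₁ : ∀ ℓ f μ m → ℓ ℚ.* (f ℚ.- μ ℚ.* m) ≡ ℓ ℚ.* f ℚ.- (ℓ ℚ.* μ) ℚ.* m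
          lemma₁ = RingSolver.solve-∀ ℚ-ring
          lemma₂ : ∀ f₂ p f₀ m → f₂ ℚ.+ p ℚ.* (f₀ ℚ.- f₂) ℚ.- m ≡ (f₂ ℚ.- m) ℚ.+ p ℚ.* ((f₀ ℚ.- m) ℚ.- (f₂ ℚ.- m))
          lemma₂ = RingSolver.solve-∀ ℚ-ring

-- The two starting distributions and amplification

-- Each bit of a uniform assignment differs from that of z with probability ½, independently, and
-- contributes the factor (1 + x)/2.
E-fair : ∀ x {n} (y z : Assignment n) → E (resample fair y) (λ y′ → pow x (d-H y′ z)) ≡ pow (mean 1ℚ x) n
E-fair x []      []      = refl
E-fair x {suc n} (b ∷ y) (c ∷ z) = trans (E-resample-∷ fair b y (λ y′ → pow x (d-H y′ (c ∷ z)))) (go c)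
  where
  u = pow (mean 1ℚ x) n
  lemma : ∀ x u → ½ ℚ.* (u ℚ.+ x ℚ.* u) ≡ (½ ℚ.* (1ℚ ℚ.+ x)) ℚ.* u
  lemma = RingSolver.solve-∀ ℚ-ring
  lemma′ : ∀ x u → ½ ℚ.* (x ℚ.* u ℚ.+ u) ≡ (½ ℚ.* (1ℚ ℚ.+ x)) ℚ.* u
  lemma′ = RingSolver.solve-∀ ℚ-ring
  other : E (resample fair y) (λ y′ → x ℚ.* pow x (d-H y′ z)) ≡ x ℚ.* u
  other = trans (E-* (resample fair y) x _) (cong (x ℚ.*_) (E-fair x y z))
  go : ∀ c → mean (E (resample fair y) (λ y′ → pow x (d-H (false ∷ y′) (c ∷ z))))
                  (E (resample fair y) (λ y′ → pow x (d-H (true ∷ y′) (c ∷ z)))) ≡ mean 1ℚ x ℚ.* u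
  go false = trans (cong₂ mean (E-fair x y z) other) (lemma x u)
  go true  = trans (cong₂ mean other (E-fair x y z)) (lemma′ x u)

¼ ¾ : ℚ
¼ = ½ ℚ.* ½
¾ = ½ ℚ.+ ¼

0≼½ : 0ℚ ≼ ½
0≼½ = ℚₚ.nonNegative⁻¹ ½

hitChance : ∀ {n} → Assignment n → Assignment n → ℚ
hitChance []      []      = 1ℚ
hitChance (b ∷ y) (c ∷ z) = pow ¼ (bitDistance b c) ℚ.* pow ¾ (1 ∸ bitDistance b c) ℚ.* hitChance y z

E-lazy : ∀ {n} (y z : Assignment n) (g : Assignment n → ℚ) → (∀ y′ → 0ℚ ≼ g y′) → 1ℚ ≼ g z →
         hitChance y z ≼ E (resample lazy y) g
E-lazy []      []      g 0≼g 1≼g = 1≼g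
E-lazy {suc n} (b ∷ y) (c ∷ z) g 0≼g 1≼g = subst (hitChance (b ∷ y) (c ∷ z) ≼_) (sym (E-resample-∷ lazy b y g)) (go b c 1≼g)
  where
  q = hitChance y z
  at : Bool → ℚ
  at b′ = E (resample lazy y) (λ y′ → g (b′ ∷ y′))
  0≼at : ∀ b′ → 0ℚ ≼ at b′
  0≼at b′ = 0≼E (resample lazy y) λ y′ → 0≼g (b′ ∷ y′)
  stay : ∀ a r → q ≼ a → 0ℚ ≼ r → (1ℚ ℚ.* (¾ ℚ.* 1ℚ)) ℚ.* q ≼ mean a (mean a r)
  stay a r q≤a 0≤r = 0≼⇒≼ (subst (0ℚ ≼_) (lemma q a r) (0≼+ (0≼* (ℚₚ.nonNegative⁻¹ ¾) (≼⇒0≼ q≤a)) (0≼* (ℚₚ.nonNegative⁻¹ ¼) 0≤r)))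
    where
    lemma : ∀ q a r → (½ ℚ.+ ½ ℚ.* ½) ℚ.* (a ℚ.- q) ℚ.+ (½ ℚ.* ½) ℚ.* r ≡
                      ½ ℚ.* (a ℚ.+ ½ ℚ.* (a ℚ.+ r)) ℚ.- (1ℚ ℚ.* ((½ ℚ.+ ½ ℚ.* ½) ℚ.* 1ℚ)) ℚ.* q
    lemma = RingSolver.solve-∀ ℚ-ring
  leave : ∀ a r → q ≼ r → 0ℚ ≼ a → ((¼ ℚ.* 1ℚ) ℚ.* 1ℚ) ℚ.* q ≼ mean a (mean a r)
  leave a r q≤r 0≤a = 0≼⇒≼ (subst (0ℚ ≼_) (lemma q a r) (0≼+ (0≼* (ℚₚ.nonNegative⁻¹ ¾) 0≤a) (0≼* (ℚₚ.nonNegative⁻¹ ¼) (≼⇒0≼ q≤r))))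
    where
    lemma : ∀ q a r → (½ ℚ.+ ½ ℚ.* ½) ℚ.* a ℚ.+ (½ ℚ.* ½) ℚ.* (r ℚ.- q) ≡
                      ½ ℚ.* (a ℚ.+ ½ ℚ.* (a ℚ.+ r)) ℚ.- (((½ ℚ.* ½) ℚ.* 1ℚ) ℚ.* 1ℚ) ℚ.* q
    lemma = RingSolver.solve-∀ ℚ-ring
  go : ∀ b c → 1ℚ ≼ g (c ∷ z) →
       pow ¼ (bitDistance b c) ℚ.* pow ¾ (1 ∸ bitDistance b c) ℚ.* q ≼ E (lazy b) at
  go false false 1≼g = stay (at false) (at true) (E-lazy y z _ (λ y′ → 0≼g (false ∷ y′)) 1≼g) (0≼at true)
  go true  true  1≼g = stay (at true) (at false) (E-lazy y z _ (λ y′ → 0≼g (true ∷ y′)) 1≼g) (0≼at false)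
  go false true  1≼g = leave (at false) (at true) (E-lazy y z _ (λ y′ → 0≼g (true ∷ y′)) 1≼g) (0≼at false)
  go true  false 1≼g = leave (at true) (at false) (E-lazy y z _ (λ y′ → 0≼g (false ∷ y′)) 1≼g) (0≼at true)

Always : ∀ {A} → (A → Set) → Comp A → Set
Always P (ret a)  = P a
Always P (draw f) = ∀ b → Always P (f b)

Always-all : ∀ {A} {P : A → Set} (c : Comp A) → (∀ a → P a) → Always P c
Always-all (ret a)  p = p a
Always-all (draw f) p = λ b → Always-all (f b) p

Always->>= : ∀ {A B} {P : A → Set} {Q : B → Set} (c : Comp A) {f : A → Comp B} →
             Always P c → (∀ {a} → P a → Always Q (f a)) → Always Q (c >>= f)
Always->>= (ret a)  p q = q p
Always->>= (draw g) p q = λ b → Always->>= (g b) (p b) q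

Always-iterate : ∀ {A} {P : A → Set} {f : A → Comp A} → (∀ a → P a → Always P (f a)) → ∀ N a → P a → Always P (iterate N f a)
Always-iterate         all zero    a p = p
Always-iterate {f = f} all (suc N) a p = Always->>= (f a) (all a p) λ {b} → Always-iterate all N b

E-mono-on : ∀ {A} {P : A → Set} (c : Comp A) {h h′ : A → ℚ} → Always P c → (∀ {a} → P a → h a ≼ h′ a) → E c h ≼ E c h′
E-mono-on (ret a)  p le = le p
E-mono-on (draw f) p le = mean-mono (E-mono-on (f false) (p false) le) (E-mono-on (f true) (p true) le)

-- 1 - boost ρ v = (1 - ρ) (1 - v): the chance of failure shrinks by the factor 1 - ρ.
boost : ℚ → ℚ → ℚ
boost ρ v = v ℚ.+ ρ ℚ.* (1ℚ ℚ.- v)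

boost-0 : ∀ v → boost 0ℚ v ≡ v
boost-0 v = lemma v
  where
  lemma : ∀ v → v ℚ.+ 0ℚ ℚ.* (1ℚ ℚ.- v) ≡ v
  lemma = RingSolver.solve-∀ ℚ-ring

boost-affine : ∀ ρ v → ρ ℚ.+ (1ℚ ℚ.- ρ) ℚ.* v ≡ boost ρ v
boost-affine ρ v = lemma ρ v
  where
  lemma : ∀ ρ v → ρ ℚ.+ (1ℚ ℚ.- ρ) ℚ.* v ≡ v ℚ.+ ρ ℚ.* (1ℚ ℚ.- v)
  lemma = RingSolver.solve-∀ ℚ-ring

E-boost : ∀ {A} (c : Comp A) ρ (h : A → ℚ) → E c (λ a → boost ρ (h a)) ≡ boost ρ (E c h)
E-boost c ρ h = trans (E-cong c λ a → sym (boost-affine ρ (h a)))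
  (trans (E-affine c ρ (1ℚ ℚ.- ρ) h) (boost-affine ρ (E c h)))

-- Boosts compose because they act as factors on the chance of failure; boost 0 says that the
-- expected score does not drop. I carries what must survive every step, such as being a solution.
Boosts : ∀ {A : Set} → (A → Set) → (A → ℚ) → ℚ → (A → Comp A) → Set
Boosts I h ρ f = ∀ a → I a → Always I (f a) × boost ρ (h a) ≼ E (f a) h

module _ {A : Set} {I : A → Set} {h : A → ℚ} where

  boosts-thenˡ : ∀ {f g ρ} → Boosts I h ρ f → Boosts I h 0ℚ g → Boosts I h ρ (λ a → f a >>= g)
  boosts-thenˡ {f} {g} F G a Ia = Always->>= (f a) (proj₁ (F a Ia)) (λ {b} Ib → proj₁ (G b Ib)) ,
    ℚₚ.≤-trans (proj₂ (F a Ia)) (subst (E (f a) h ≼_) (sym (E->>= (f a) g h))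
      (E-mono-on (f a) (proj₁ (F a Ia)) λ {b} Ib → subst (_≼ E (g b) h) (boost-0 (h b)) (proj₂ (G b Ib))))

  boosts-thenʳ : ∀ {f g ρ} → ρ ≼ 1ℚ → Boosts I h 0ℚ f → Boosts I h ρ g → Boosts I h ρ (λ a → f a >>= g)
  boosts-thenʳ {f} {g} {ρ} ρ≤1 F G a Ia = Always->>= (f a) (proj₁ (F a Ia)) (λ {b} Ib → proj₁ (G b Ib)) , (begin
    boost ρ (h a)                          ≡⟨ boost-affine ρ (h a) ⟨
    ρ ℚ.+ (1ℚ ℚ.- ρ) ℚ.* h a ≤⟨ ℚₚ.+-monoʳ-≤ ρ (*-monoʳ (≼⇒0≼ ρ≤1) (subst (_≼ E (f a) h) (boost-0 (h a)) (proj₂ (F a Ia)))) ⟩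
    ρ ℚ.+ (1ℚ ℚ.- ρ) ℚ.* E (f a) h         ≡⟨ boost-affine ρ (E (f a) h) ⟩
    boost ρ (E (f a) h)                    ≡⟨ E-boost (f a) ρ h ⟨
    E (f a) (λ b → boost ρ (h b)) ≤⟨ E-mono-on (f a) (proj₁ (F a Ia)) (λ {b} Ib → proj₂ (G b Ib)) ⟩
    E (f a) (λ b → E (g b) h)              ≡⟨ E->>= (f a) g h ⟨
    E (f a >>= g) h                        ∎)
    where open ℚₚ.≤-Reasoning

  boosts-iterate : ∀ {f ρ} → ρ ≼ 1ℚ → Boosts I h ρ f → ∀ N → Boosts I h (1ℚ ℚ.- pow (1ℚ ℚ.- ρ) N) (iterate N f)
  boosts-iterate {f} {ρ} ρ≤1 B zero a Ia = Ia , ℚₚ.≤-reflexive (lemma (h a))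
    where
    lemma : ∀ v → v ℚ.+ (1ℚ ℚ.- 1ℚ) ℚ.* (1ℚ ℚ.- v) ≡ v
    lemma = RingSolver.solve-∀ ℚ-ring
  boosts-iterate {f} {ρ} ρ≤1 B (suc N) a Ia = Always->>= (f a) (proj₁ (B a Ia)) (λ {b} Ib → proj₁ (IH b Ib)) , (begin
    boost (1ℚ ℚ.- σ ℚ.* s) (h a)              ≡⟨ lemma ρ s (h a) ⟩
    (1ℚ ℚ.- s) ℚ.+ s ℚ.* boost ρ (h a) ≤⟨ ℚₚ.+-monoʳ-≤ (1ℚ ℚ.- s) (*-monoʳ (0≼pow N (≼⇒0≼ ρ≤1)) (proj₂ (B a Ia))) ⟩
    (1ℚ ℚ.- s) ℚ.+ s ℚ.* E (f a) h            ≡⟨ lemma₂ s (E (f a) h) ⟩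
    boost (1ℚ ℚ.- s) (E (f a) h)              ≡⟨ E-boost (f a) (1ℚ ℚ.- s) h ⟨
    E (f a) (λ b → boost (1ℚ ℚ.- s) (h b)) ≤⟨ E-mono-on (f a) (proj₁ (B a Ia)) (λ {b} Ib → proj₂ (IH b Ib)) ⟩
    E (f a) (λ b → E (iterate N f b) h)       ≡⟨ E->>= (f a) (iterate N f) h ⟨
    E (f a >>= iterate N f) h                 ∎)
    where
    open ℚₚ.≤-Reasoning
    IH = boosts-iterate ρ≤1 B N
    σ s : ℚ
    σ = 1ℚ ℚ.- ρ
    s = pow σ N
    lemma : ∀ ρ s v → v ℚ.+ (1ℚ ℚ.- (1ℚ ℚ.- ρ) ℚ.* s) ℚ.* (1ℚ ℚ.- v) ≡ (1ℚ ℚ.- s) ℚ.+ s ℚ.* (v ℚ.+ ρ ℚ.* (1ℚ ℚ.- v))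
    lemma = RingSolver.solve-∀ ℚ-ring
    lemma₂ : ∀ s e → (1ℚ ℚ.- s) ℚ.+ s ℚ.* e ≡ e ℚ.+ (1ℚ ℚ.- s) ℚ.* (1ℚ ℚ.- e)
    lemma₂ = RingSolver.solve-∀ ℚ-ring

E-combine : ∀ {A} (c : Comp A) (g g′ : A → ℚ) w m →
  E c (λ a → g a ℚ.- w ℚ.* g′ a ℚ.- m) ≡ E c g ℚ.- w ℚ.* E c g′ ℚ.- m
E-combine (ret a)  g g′ w m = refl
E-combine (draw f) g g′ w m = trans (cong₂ mean (E-combine (f false) g g′ w m) (E-combine (f true) g g′ w m))
  (lemma (E (f false) g) (E (f false) g′) (E (f true) g) (E (f true) g′) w m)
  where
  lemma : ∀ a a′ b b′ w m → ½ ℚ.* ((a ℚ.- w ℚ.* a′ ℚ.- m) ℚ.+ (b ℚ.- w ℚ.* b′ ℚ.- m)) ≡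
          ½ ℚ.* (a ℚ.+ b) ℚ.- w ℚ.* (½ ℚ.* (a′ ℚ.+ b′)) ℚ.- m
  lemma = RingSolver.solve-∀ ℚ-ring

isTrue-true : ∀ {n} (y : Assignment n) i b → lookup y i ≡ b → isTrue y (i , b) ≡ true
isTrue-true y i b eq with isTrue y (i , b) in eq′
... | true  = refl
... | false = ⊥-elim (isTrue-complete y i b eq′ eq)

clauseTrue-complete : ∀ {n} (y : Assignment n) {C} → Any (LitTrue y) C → clauseTrue y C ≡ true
clauseTrue-complete y {(i , b) ∷ C} (here eq) rewrite isTrue-true y i b eq = refl
clauseTrue-complete y {l ∷ C} (there any) with isTrue y l
... | true  = refl
... | false = clauseTrue-complete y any

violated-complete : ∀ {n} (y : Assignment n) {F} → y ⊨ F → violated y F ≡ nothing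
violated-complete y []         = refl
violated-complete y (any ∷ yF) rewrite clauseTrue-complete y any = violated-complete y yF

indicator : {P : Set} → Dec P → ℚ
indicator (yes _) = 1ℚ
indicator (no _)  = 0ℚ

indicator-yes : {P : Set} (P? : Dec P) → P → indicator P? ≡ 1ℚ
indicator-yes (yes _) p = refl
indicator-yes (no ¬p) p = ⊥-elim (¬p p)

0≼indicator : {P : Set} (P? : Dec P) → 0ℚ ≼ indicator P?
0≼indicator (yes _) = 0≼1
0≼indicator (no _)  = ≼-refl

indicator≼1 : {P : Set} (P? : Dec P) → indicator P? ≼ 1ℚ
indicator≼1 (yes _) = ≼-refl
indicator≼1 (no _)  = 0≼1

boost-1 : ∀ ρ → boost ρ 1ℚ ≡ 1ℚ
boost-1 = lemma
  where
  lemma : ∀ ρ → 1ℚ ℚ.+ ρ ℚ.* (1ℚ ℚ.- 1ℚ) ≡ 1ℚ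
  lemma = RingSolver.solve-∀ ℚ-ring

boost-none : ∀ ρ → boost ρ 0ℚ ≡ ρ
boost-none = lemma
  where
  lemma : ∀ ρ → 0ℚ ℚ.+ ρ ℚ.* (1ℚ ℚ.- 0ℚ) ≡ ρ
  lemma = RingSolver.solve-∀ ℚ-ring

-- The two phases

module Phases {β leaf k} (drift : Drift β leaf k) {n} (F : CNF n) (F≤ : IsKCNF k F) (t : ℕ) where

  open Drift drift
  open Walk drift
  open Algorithm β leaf

  Sat? : Maybe (Assignment n) → Set
  Sat? nothing  = ⊤
  Sat? (just y) = y ⊨ F

  walk-sat : ∀ t y → Always Sat? (walk F t y)
  walk-sat zero    y = tt
  walk-sat (suc t) y with violated y F in eq
  ... | nothing = violated-sound y F eq
  ... | just C  = Always->>= {P = λ _ → ⊤} (bits β 0) (Always-all (bits β 0) λ _ → tt) λ {v} _ → walk-sat t (move y (nth C (leaf v)))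

  search-sat : ∀ ν z → Always Sat? (search F t ν z)
  search-sat ν z = Always->>= {P = λ _ → ⊤} (resample ν z) (Always-all (resample ν z) λ _ → tt) λ {y} _ → walk-sat t y

  -- A probability bound phrased with test functions, so that it applies directly to the payoff of
  -- whatever follows the search.
  Finds : Noise → ℚ → (ℕ → Set) → Assignment n → Set
  Finds ν ρ Far z₀ = ∀ (h : Maybe (Assignment n) → ℚ) → (∀ r → 0ℚ ≼ h r) →
    (∀ y → y ⊨ F → Far (d-H z₀ y) → 1ℚ ≼ h (just y)) → ρ ≼ E (search F t ν z₀) h

  finds-nothing : ∀ ν Far z₀ → Finds ν 0ℚ Far z₀
  finds-nothing ν Far z₀ h 0≼h _ = 0≼E (search F t ν z₀) 0≼h

  -- Solutions that are not Far may also stop the walk. They do no damage if their potential is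
  -- nonpositive, since then h ≥ 0 pays for them; `near` asks for exactly this.
  finds-fair : ∀ {w Far z₀ z} → 0ℚ ≼ w → z ⊨ F → (∀ y → y ⊨ F → Far (d-H z₀ y) ⊎ potential w (d-H y z) ≼ 0ℚ) →
    Finds fair (pow (mean 1ℚ x) n ℚ.- w ℚ.* pow (mean 1ℚ X) n ℚ.- pow μ t) Far z₀
  finds-fair {w} {Far} {z₀} {z} 0≼w z⊨F near h 0≼h found = subst₂ _≼_
    (trans (E-combine (resample fair z₀) (λ y → pow x (d-H y z)) (λ y → pow X (d-H y z)) w (pow μ t))
           (cong₂ (λ a b → a ℚ.- w ℚ.* b ℚ.- pow μ t) (E-fair x z₀ z) (E-fair X z₀ z)))
    (sym (E->>= (resample fair z₀) (walk F t) h))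
    (E-mono (resample fair z₀) (walk-lower 0≼w F F≤ z⊨F h 0≼h cases t))
    where
    cases : ∀ y → y ⊨ F → potential w (d-H y z) ≼ h (just y)
    cases y y⊨F with near y y⊨F
    ... | inj₁ far = ℚₚ.≤-trans (potential≼1 0≼w (d-H y z)) (found y y⊨F far)
    ... | inj₂ f≤0 = ℚₚ.≤-trans f≤0 (0≼h (just y))

  finds-lazy : ∀ {Far z₀ z} → 1 ≤ t → z ⊨ F → Far (d-H z₀ z) → Finds lazy (hitChance z₀ z) Far z₀
  finds-lazy {Far} {z₀} {z} 1≤t z⊨F far h 0≼h found = subst (hitChance z₀ z ≼_) (sym (E->>= (resample lazy z₀) (walk F t) h))
    (E-lazy z₀ z _ (λ y → 0≼E (walk F t y) 0≼h) (at-z 1≤t))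
    where
    at-z : ∀ {t} → 1 ≤ t → 1ℚ ≼ E (walk F t z) h
    at-z {suc t} _ = subst (λ r → 1ℚ ≼ E (walkFrom F t z r) h) (sym (violated-complete z z⊨F)) (found z z⊨F far)

  -- A later round may replace a solution, but only by another one, because a search reports nothing
  -- else.
  first-boosts : ∀ {ρ} → (∀ z → Finds fair ρ (λ _ → ⊤) z) → Boosts (λ _ → ⊤) (λ z → indicator (z ⊨? F)) ρ (first F t)
  first-boosts {ρ} finds z _ = Always-all (first F t z) (λ _ → tt) ,
    subst (boost ρ (indicator (z ⊨? F)) ≼_) (sym (E->>= (search F t fair z) _ _)) (go (z ⊨? F) refl)
    where
    payoff : Maybe (Assignment n) → ℚ
    payoff r = indicator (Maybe.fromMaybe z r ⊨? F)
    go : (z⊨?F : Dec (z ⊨ F)) → (z ⊨? F) ≡ z⊨?F → boost ρ (indicator z⊨?F) ≼ E (search F t fair z) payoff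
    go (yes z⊨F) eq = subst₂ _≼_ (trans (E-const (search F t fair z) 1ℚ) (sym (boost-1 ρ))) refl
      (E-mono-on (search F t fair z) (search-sat fair z) λ
        { {nothing} _   → ℚₚ.≤-reflexive (sym (cong indicator eq))
        ; {just y}  y⊨F → ℚₚ.≤-reflexive (sym (indicator-yes (y ⊨? F) y⊨F)) })
    go (no _) eq = subst (_≼ E (search F t fair z) payoff) (sym (boost-none ρ))
      (finds z payoff (λ r → 0≼indicator (Maybe.fromMaybe z r ⊨? F))
        λ y y⊨F _ → ℚₚ.≤-reflexive (sym (indicator-yes (y ⊨? F) y⊨F)))

  module _ {Far : ℕ → Set} (far? : ∀ d → Dec (Far d)) (Far-up : ∀ {d e} → d ≤ e → Far d → Far e) (z₀ : Assignment n) where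

    score : Assignment n → ℚ
    score z₁ = indicator (far? (d-H z₀ z₁))

    improve-sat : ∀ z₁ → z₁ ⊨ F → ∀ {r} → Sat? r → improve z₀ z₁ r ⊨ F
    improve-sat z₁ z₁⊨F {nothing} _   = z₁⊨F
    improve-sat z₁ z₁⊨F {just y}  y⊨F with d-H z₀ z₁ <ᵇ d-H z₀ y
    ... | true  = y⊨F
    ... | false = z₁⊨F

    improve-≥ : ∀ z₁ r → d-H z₀ z₁ ≤ d-H z₀ (improve z₀ z₁ r)
    improve-≥ z₁ nothing  = ≤-refl
    improve-≥ z₁ (just y) with d-H z₀ z₁ <ᵇ d-H z₀ y in eq
    ... | true  = <⇒≤ (<ᵇ⇒< _ _ (subst T (sym eq) tt))
    ... | false = ≤-refl

    improve-≥′ : ∀ z₁ y → d-H z₀ y ≤ d-H z₀ (improve z₀ z₁ (just y))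
    improve-≥′ z₁ y with d-H z₀ z₁ <ᵇ d-H z₀ y in eq
    ... | true  = ≤-refl
    ... | false = ≮⇒≥ λ lt → subst T eq (<⇒<ᵇ lt)

    attempt-sat : ∀ ν z₁ → z₁ ⊨ F → Always (_⊨ F) (attempt F t ν z₀ z₁)
    attempt-sat ν z₁ z₁⊨F = Always->>= (search F t ν z₀) (search-sat ν z₀) (improve-sat z₁ z₁⊨F)

    round-sat : ∀ z₁ → z₁ ⊨ F → Always (_⊨ F) (round F t z₀ z₁)
    round-sat z₁ z₁⊨F = Always->>= (attempt F t fair z₀ z₁) (attempt-sat fair z₁ z₁⊨F) λ {z₁} → attempt-sat lazy z₁

    attempt-boosts : ∀ {ν ρ} → Finds ν ρ Far z₀ → Boosts (_⊨ F) score ρ (attempt F t ν z₀)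
    attempt-boosts {ν} {ρ} finds z₁ z₁⊨F = attempt-sat ν z₁ z₁⊨F ,
      subst (boost ρ (score z₁) ≼_) (sym (E->>= (search F t ν z₀) _ _)) (go (far? (d-H z₀ z₁)))
      where
      payoff : Maybe (Assignment n) → ℚ
      payoff r = score (improve z₀ z₁ r)
      go : (f? : Dec (Far (d-H z₀ z₁))) → boost ρ (indicator f?) ≼ E (search F t ν z₀) payoff
      go (yes far) = subst₂ _≼_ (trans (E-const (search F t ν z₀) 1ℚ) (sym (boost-1 ρ))) refl
        (E-mono (search F t ν z₀) λ r → ℚₚ.≤-reflexive (sym (indicator-yes (far? _) (Far-up (improve-≥ z₁ r) far))))
      go (no _) = subst (_≼ E (search F t ν z₀) payoff) (sym (boost-none ρ))
        (finds payoff (λ r → 0≼indicator (far? _))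
          λ y _ far → ℚₚ.≤-reflexive (sym (indicator-yes (far? _) (Far-up (improve-≥′ z₁ y) far))))

    -- It suffices that one of the two attempts is effective: the other has boost 0, as `improve`
    -- never decreases the distance from z₀.
    round-boosts : ∀ {ρ} → ρ ≼ 1ℚ → Finds fair ρ Far z₀ ⊎ Finds lazy ρ Far z₀ → Boosts (_⊨ F) score ρ (round F t z₀)
    round-boosts {ρ} ρ≤1 (inj₁ finds) = boosts-thenˡ {h = score} {f = attempt F t fair z₀} {g = attempt F t lazy z₀} {ρ = ρ} (attempt-boosts finds) (attempt-boosts (finds-nothing lazy Far z₀))
    round-boosts ρ≤1 (inj₂ finds) = boosts-thenʳ {h = score} {f = attempt F t fair z₀} {g = attempt F t lazy z₀} ρ≤1 (attempt-boosts (finds-nothing fair Far z₀)) (attempt-boosts finds)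

  -- Given any solution z₀ from the first phase, the second succeeds with probability at least s,
  -- whence the product. `Far 0` is the case of a nonpositive ratio, in which the second phase only
  -- has to preserve being a solution.
  algorithm-succeeds : ∀ {ρ} {Far : ℕ → Set} (far? : ∀ d → Dec (Far d)) → (∀ {d e} → d ≤ e → Far d → Far e) → 0ℚ ≼ ρ → ρ ≼ 1ℚ →
    (∀ z → Finds fair ρ (λ _ → ⊤) z) → (∀ z₀ → z₀ ⊨ F → (Far 0 ⊎ (Finds fair ρ Far z₀ ⊎ Finds lazy ρ Far z₀))) →
    ∀ N z (h : Assignment n × Assignment n → ℚ) → (∀ zs → 0ℚ ≼ h zs) →
    (∀ z₀ z₁ → z₀ ⊨ F → z₁ ⊨ F → Far (d-H z₀ z₁) → 1ℚ ≼ h (z₀ , z₁)) →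
    let s = 1ℚ ℚ.- pow (1ℚ ℚ.- ρ) N in s ℚ.* s ≼ E (algorithm F t N z) h
  algorithm-succeeds {ρ} {Far} far? Far-up 0≤ρ ρ≤1 finds₁ finds₂ N z h 0≤h reward = begin
    s ℚ.* s ≤⟨ *-monoʳ 0≤s (boost≥ (proj₂ (boosts-iterate {f = first F t} ρ≤1 (first-boosts finds₁) N z tt)) (0≼indicator (z ⊨? F))) ⟩
    s ℚ.* E (iterate N (first F t) z) sat                 ≡⟨ E-* (iterate N (first F t) z) s sat ⟨
    E (iterate N (first F t) z) (λ z₀ → s ℚ.* sat z₀) ≤⟨ E-mono (iterate N (first F t) z) (λ z₀ → second z₀ (z₀ ⊨? F)) ⟩
    E (iterate N (first F t) z) (λ z₀ → E (iterate N (round F t z₀) z₀ >>= λ z₁ → ret (z₀ , z₁)) h) ≡⟨ E->>= (iterate N (first F t) z) _ h ⟨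
    E (algorithm F t N z) h ∎
    where
    open ℚₚ.≤-Reasoning
    s : ℚ
    s = 1ℚ ℚ.- pow (1ℚ ℚ.- ρ) N
    sat : Assignment n → ℚ
    sat z₀ = indicator (z₀ ⊨? F)
    σ≤1 : 1ℚ ℚ.- ρ ≼ 1ℚ
    σ≤1 = 0≼⇒≼ (subst (0ℚ ≼_) (lemma ρ) 0≤ρ)
      where
      lemma : ∀ ρ → ρ ≡ 1ℚ ℚ.- (1ℚ ℚ.- ρ)
      lemma = RingSolver.solve-∀ ℚ-ring
    0≤s : 0ℚ ≼ s
    0≤s = ≼⇒0≼ (pow≼1 N (≼⇒0≼ ρ≤1) σ≤1)
    s≤1 : s ≼ 1ℚ
    s≤1 = 0≼⇒≼ (subst (0ℚ ≼_) (lemma (pow (1ℚ ℚ.- ρ) N)) (0≼pow N (≼⇒0≼ ρ≤1)))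
      where
      lemma : ∀ q → q ≡ 1ℚ ℚ.- (1ℚ ℚ.- q)
      lemma = RingSolver.solve-∀ ℚ-ring
    boost≥ : ∀ {v e} → boost s v ≼ e → 0ℚ ≼ v → s ≼ e
    boost≥ {v} le 0≤v = ℚₚ.≤-trans (0≼⇒≼ (subst (0ℚ ≼_) (lemma s v) (0≼* (≼⇒0≼ s≤1) 0≤v))) le
      where
      lemma : ∀ s v → (1ℚ ℚ.- s) ℚ.* v ≡ (v ℚ.+ s ℚ.* (1ℚ ℚ.- v)) ℚ.- s
      lemma = RingSolver.solve-∀ ℚ-ring
    second : ∀ z₀ (z₀⊨?F : Dec (z₀ ⊨ F)) → s ℚ.* indicator z₀⊨?F ≼ E (iterate N (round F t z₀) z₀ >>= λ z₁ → ret (z₀ , z₁)) h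
    second z₀ (no _)    = subst (_≼ E (iterate N (round F t z₀) z₀ >>= λ z₁ → ret (z₀ , z₁)) h) (sym (ℚₚ.*-zeroʳ s)) (0≼E (iterate N (round F t z₀) z₀ >>= λ z₁ → ret (z₀ , z₁)) 0≤h)
    second z₀ (yes z₀⊨F) = subst₂ _≼_ (sym (ℚₚ.*-identityʳ s)) (sym (E->>= (iterate N (round F t z₀) z₀) _ h)) (go (finds₂ z₀ z₀⊨F))
      where
      to-h : ∀ {z₁} → z₁ ⊨ F → score far? Far-up z₀ z₁ ≼ h (z₀ , z₁)
      to-h {z₁} z₁⊨F with far? (d-H z₀ z₁)
      ... | yes far = reward z₀ z₁ z₀⊨F z₁⊨F far
      ... | no _    = 0≤h (z₀ , z₁)
      go : Far 0 ⊎ (Finds fair ρ Far z₀ ⊎ Finds lazy ρ Far z₀) → s ≼ E (iterate N (round F t z₀) z₀) (λ z₁ → h (z₀ , z₁))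
      go (inj₂ finds) with boosts-iterate {h = score far? Far-up z₀} {f = round F t z₀} ρ≤1 (round-boosts far? Far-up z₀ ρ≤1 finds) N z₀ z₀⊨F
      ... | sat , b = boost≥ (ℚₚ.≤-trans b (E-mono-on (iterate N (round F t z₀) z₀) sat to-h)) (0≼indicator (far? (d-H z₀ z₀)))
      go (inj₁ far) = ℚₚ.≤-trans s≤1 (subst (_≼ E (iterate N (round F t z₀) z₀) (λ z₁ → h (z₀ , z₁))) (E-const (iterate N (round F t z₀) z₀) 1ℚ)
        (E-mono-on (iterate N (round F t z₀) z₀) (Always-iterate (round-sat far? Far-up z₀) N z₀ z₀⊨F)
          λ {z₁} z₁⊨F → reward z₀ z₁ z₀⊨F z₁⊨F (Far-up z≤n far)))

-- Fractions

-- The fraction a/(d+1).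
frac : ℕ → ℕ → ℚ
frac a d = + a ℚ./ suc d

private
  toℚᵘ-frac : ∀ a d → ℚ.toℚᵘ (frac a d) ℚᵘ.≃ ℚᵘ.mkℚᵘ (+ a) d
  toℚᵘ-frac a d = ℚₚ.toℚᵘ-fromℚᵘ (ℚᵘ.mkℚᵘ (+ a) d)

frac-≼ : ∀ {a b c d} → a * suc d ≤ c * suc b → frac a b ≼ frac c d
frac-≼ {a} {b} {c} {d} le = ℚₚ.toℚᵘ-cancel-≤ (ℚᵘₚ.≤-respˡ-≃ (ℚᵘₚ.≃-sym (toℚᵘ-frac a b)) (ℚᵘₚ.≤-respʳ-≃ (ℚᵘₚ.≃-sym (toℚᵘ-frac c d))
  (ℚᵘ.*≤* (subst₂ ℤ._≤_ (ℤₚ.pos-* a (suc d)) (ℤₚ.pos-* c (suc b)) (ℤ.+≤+ le)))))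

frac-< : ∀ {a b c d} → a * suc d < c * suc b → frac a b ℚ.< frac c d
frac-< {a} {b} {c} {d} lt = ℚₚ.toℚᵘ-cancel-< (ℚᵘₚ.<-respˡ-≃ (ℚᵘₚ.≃-sym (toℚᵘ-frac a b)) (ℚᵘₚ.<-respʳ-≃ (ℚᵘₚ.≃-sym (toℚᵘ-frac c d))
  (ℚᵘ.*<* (subst₂ ℤ._<_ (ℤₚ.pos-* a (suc d)) (ℤₚ.pos-* c (suc b)) (ℤ.+<+ lt)))))

frac-<⁻¹ : ∀ {a b c d} → frac a b ℚ.< frac c d → a * suc d < c * suc b
frac-<⁻¹ {a} {b} {c} {d} lt with ℚᵘₚ.<-respˡ-≃ (toℚᵘ-frac a b) (ℚᵘₚ.<-respʳ-≃ (toℚᵘ-frac c d) (ℚₚ.toℚᵘ-mono-< lt))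
... | ℚᵘ.*<* lt′ = ℤₚ.drop‿+<+ (subst₂ ℤ._<_ (sym (ℤₚ.pos-* a (suc d))) (sym (ℤₚ.pos-* c (suc b))) lt′)

frac-≼⁻¹ : ∀ {a b c d} → frac a b ≼ frac c d → a * suc d ≤ c * suc b
frac-≼⁻¹ {a} {b} {c} {d} le with ℚᵘₚ.≤-respˡ-≃ (toℚᵘ-frac a b) (ℚᵘₚ.≤-respʳ-≃ (toℚᵘ-frac c d) (ℚₚ.toℚᵘ-mono-≤ le))
... | ℚᵘ.*≤* le′ = ℤₚ.drop‿+≤+ (subst₂ ℤ._≤_ (sym (ℤₚ.pos-* a (suc d))) (sym (ℤₚ.pos-* c (suc b))) le′)

frac-≡ : ∀ {a b c d} → a * suc d ≡ c * suc b → frac a b ≡ frac c d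
frac-≡ {a} {b} {c} {d} eq = ℚₚ.≤-antisym (frac-≼ {a} {b} {c} {d} (≤-reflexive eq)) (frac-≼ {c} {d} {a} {b} (≤-reflexive (sym eq)))

frac-* : ∀ a b c d → frac a b ℚ.* frac c d ≡ frac (a * c) (d + b * suc d)
frac-* a b c d = ℚₚ.toℚᵘ-injective (begin
  ℚ.toℚᵘ (frac a b ℚ.* frac c d)              ≈⟨ ℚₚ.toℚᵘ-homo-* (frac a b) (frac c d) ⟩
  ℚ.toℚᵘ (frac a b) ℚᵘ.* ℚ.toℚᵘ (frac c d)    ≈⟨ ℚᵘₚ.*-cong (toℚᵘ-frac a b) (toℚᵘ-frac c d) ⟩
  ℚᵘ.mkℚᵘ (+ a) b ℚᵘ.* ℚᵘ.mkℚᵘ (+ c) d ≈⟨ ℚᵘ.*≡* (cong (ℤ._* + (suc b * suc d)) (sym (ℤₚ.pos-* a c))) ⟩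
  ℚᵘ.mkℚᵘ (+ (a * c)) (d + b * suc d)         ≈⟨ toℚᵘ-frac (a * c) (d + b * suc d) ⟨
  ℚ.toℚᵘ (frac (a * c) (d + b * suc d))       ∎)
  where open ℚᵘₚ.≃-Reasoning

frac-+ : ∀ a b c d → frac a b ℚ.+ frac c d ≡ frac (a * suc d + c * suc b) (d + b * suc d)
frac-+ a b c d = ℚₚ.toℚᵘ-injective (begin
  ℚ.toℚᵘ (frac a b ℚ.+ frac c d)              ≈⟨ ℚₚ.toℚᵘ-homo-+ (frac a b) (frac c d) ⟩
  ℚ.toℚᵘ (frac a b) ℚᵘ.+ ℚ.toℚᵘ (frac c d)    ≈⟨ ℚᵘₚ.+-cong (toℚᵘ-frac a b) (toℚᵘ-frac c d) ⟩
  ℚᵘ.mkℚᵘ (+ a) b ℚᵘ.+ ℚᵘ.mkℚᵘ (+ c) d        ≈⟨ ℚᵘ.*≡* (cong (ℤ._* + (suc b * suc d))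
    (trans (cong₂ ℤ._+_ (sym (ℤₚ.pos-* a (suc d))) (sym (ℤₚ.pos-* c (suc b)))) (sym (ℤₚ.pos-+ (a * suc d) (c * suc b))))) ⟩
  ℚᵘ.mkℚᵘ (+ (a * suc d + c * suc b)) (d + b * suc d) ≈⟨ toℚᵘ-frac (a * suc d + c * suc b) (d + b * suc d) ⟨
  ℚ.toℚᵘ (frac (a * suc d + c * suc b) (d + b * suc d)) ∎)
  where open ℚᵘₚ.≃-Reasoning

frac-complement : ∀ a r d → a + r ≡ suc d → 1ℚ ℚ.- frac a d ≡ frac r d
frac-complement a r d eq = trans (cong (ℚ._- frac a d) (sym whole)) (lemma (frac a d) (frac r d))
  where
  whole : frac a d ℚ.+ frac r d ≡ 1ℚ
  whole = trans (frac-+ a d r d) (trans (frac-≡ {a * suc d + r * suc d} {d + d * suc d} {1} {0} (trans (eq₁ a r (suc d)) (trans (cong (_* suc d) eq) (sym (*-identityˡ (suc d * suc d)))))) refl)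
    where
    eq₁ : ∀ a r d → (a * d + r * d) * 1 ≡ (a + r) * d
    eq₁ = solve-∀
  lemma : ∀ p q → (p ℚ.+ q) ℚ.- p ≡ q
  lemma = RingSolver.solve-∀ ℚ-ring

frac-+-common : ∀ a c d → frac a d ℚ.+ frac c d ≡ frac (a + c) d
frac-+-common a c d = trans (frac-+ a d c d) (frac-≡ {a * suc d + c * suc d} {d + d * suc d} {a + c} {d} (eq a c d))
  where
  eq : ∀ a c d → (a * suc d + c * suc d) * suc d ≡ (a + c) * suc (d + d * suc d)
  eq = solve-∀

⟪_⟫ : ℕ → ℚ
⟪ n ⟫ = frac n 0

⟪⟫-+ : ∀ m n → ⟪ m + n ⟫ ≡ ⟪ m ⟫ ℚ.+ ⟪ n ⟫
⟪⟫-+ m n = trans (cong₂ (λ a b → frac (a + b) 0) (sym (*-identityʳ m)) (sym (*-identityʳ n))) (sym (frac-+ m 0 n 0))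

⟪⟫-* : ∀ m n → ⟪ m * n ⟫ ≡ ⟪ m ⟫ ℚ.* ⟪ n ⟫
⟪⟫-* m n = sym (frac-* m 0 n 0)

⟪⟫-mono : ∀ {m n} → m ≤ n → ⟪ m ⟫ ≼ ⟪ n ⟫
⟪⟫-mono {m} {n} le = frac-≼ {m} {0} {n} {0} (*-monoˡ-≤ 1 le)

⟪⟫-pow : ∀ m n → ⟪ m ^ n ⟫ ≡ pow ⟪ m ⟫ n
⟪⟫-pow m zero    = refl
⟪⟫-pow m (suc n) = trans (⟪⟫-* m (m ^ n)) (cong (⟪ m ⟫ ℚ.*_) (⟪⟫-pow m n))

0≼frac : ∀ a d → 0ℚ ≼ frac a d
0≼frac a d = frac-≼ {0} {0} {a} {d} z≤n

frac≼1 : ∀ {a d} → a ≤ suc d → frac a d ≼ 1ℚ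
frac≼1 {a} {d} le = frac-≼ {a} {d} {1} {0} (subst₂ _≤_ (sym (*-identityʳ a)) (sym (*-identityˡ (suc d))) le)

denominator : ∀ a d → frac a d ℚ.* ⟪ suc d ⟫ ≡ ⟪ a ⟫
denominator a d = trans (frac-* a d (suc d) 0) (frac-≡ {a * suc d} {d * 1} {a} {0} (eq a d))
  where
  eq : ∀ a d → a * suc d * 1 ≡ a * suc (d * 1)
  eq = solve-∀

-- Bernoulli's inequality for 1/p ≥ 1 + η, multiplied out: it bounds p ^ n by 1/(1 + n η) without a
-- division.
bernoulli : ∀ {p η} → 0ℚ ≼ p → 0ℚ ≼ η → p ℚ.* (1ℚ ℚ.+ η) ≼ 1ℚ → ∀ n → pow p n ℚ.* (1ℚ ℚ.+ ⟪ n ⟫ ℚ.* η) ≼ 1ℚ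
bernoulli {p} {η} 0≤p 0≤η le zero    = ℚₚ.≤-reflexive (lemma η)
  where
  lemma : ∀ η → 1ℚ ℚ.* (1ℚ ℚ.+ 0ℚ ℚ.* η) ≡ 1ℚ
  lemma = RingSolver.solve-∀ ℚ-ring
bernoulli {p} {η} 0≤p 0≤η le (suc n) = begin
  p ℚ.* s ℚ.* (1ℚ ℚ.+ ⟪ suc n ⟫ ℚ.* η) ≡⟨ cong (λ m → p ℚ.* s ℚ.* (1ℚ ℚ.+ m ℚ.* η)) (⟪⟫-+ 1 n) ⟩
  p ℚ.* s ℚ.* (1ℚ ℚ.+ (1ℚ ℚ.+ ⟪ n ⟫) ℚ.* η) ≤⟨ 0≼⇒≼ (subst (0ℚ ≼_) (lemma p s η ⟪ n ⟫) (0≼* (0≼* 0≤p 0≤s) (0≼* (0≼* (0≼frac n 0) 0≤η) 0≤η))) ⟩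
  (p ℚ.* (1ℚ ℚ.+ η)) ℚ.* (s ℚ.* (1ℚ ℚ.+ ⟪ n ⟫ ℚ.* η)) ≤⟨ *-mono (0≼* 0≤p (0≼+ 0≼1 0≤η)) le (0≼* 0≤s (0≼+ 0≼1 (0≼* (0≼frac n 0) 0≤η))) (bernoulli 0≤p 0≤η le n) ⟩
  1ℚ ∎
  where
  open ℚₚ.≤-Reasoning
  s = pow p n
  0≤s = 0≼pow n 0≤p
  lemma : ∀ p s η m → p ℚ.* s ℚ.* (m ℚ.* η ℚ.* η) ≡
    (p ℚ.* (1ℚ ℚ.+ η)) ℚ.* (s ℚ.* (1ℚ ℚ.+ m ℚ.* η)) ℚ.- p ℚ.* s ℚ.* (1ℚ ℚ.+ (1ℚ ℚ.+ m) ℚ.* η)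
  lemma = RingSolver.solve-∀ ℚ-ring

-- The constants

module _ (leaf : ℕ → ℕ) (j : ℕ) where

  hits : ℕ → ℕ → ℕ
  hits a zero    = 0
  hits a (suc l) = (if leaf a ≡ᵇ j then 1 else 0) + hits (suc a) l

  hits-+ : ∀ a l l′ → hits a (l + l′) ≡ hits a l + hits (a + l) l′
  hits-+ a zero    l′ = cong (λ b → hits b l′) (sym (+-identityʳ a))
  hits-+ a (suc l) l′ = trans (cong (_+_ (if leaf a ≡ᵇ j then 1 else 0))
    (trans (hits-+ (suc a) l l′) (cong (λ b → hits (suc a) l + hits b l′) (sym (+-suc a l)))))
    (sym (+-assoc (if leaf a ≡ᵇ j then 1 else 0) (hits (suc a) l) (hits (a + suc l) l′)))

  hits-all : ∀ a l → (∀ i → i < l → leaf (a + i) ≡ j) → hits a l ≡ l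
  hits-all a zero    all = refl
  hits-all a (suc l) all = cong₂ _+_ (one (leaf a) (trans (cong leaf (sym (+-identityʳ a))) (all 0 (s≤s z≤n))))
    (hits-all (suc a) l λ i i<l → trans (cong leaf (sym (+-suc a i))) (all (suc i) (s≤s i<l)))
    where
    one : ∀ m → m ≡ j → (if m ≡ᵇ j then 1 else 0) ≡ 1
    one m refl with m ≡ᵇ m in eq
    ... | true  = refl
    ... | false = ⊥-elim (subst T eq (≡⇒≡ᵇ m m refl))

  -- With b coins left at v, the remaining outcomes are the 2 ^ b numbers from v 2 ^ b on; `hits`
  -- counts those that select j.
  E-bits : ∀ (g : ℕ → ℚ) {lo hi} → lo ≼ hi → (∀ v → lo ≼ g v) → (∀ v → leaf v ≡ j → hi ≼ g v) →
    ∀ b v → lo ℚ.+ (⟪ hits (v * 2 ^ b) (2 ^ b) ⟫ ℚ.* pow ½ b) ℚ.* (hi ℚ.- lo) ≼ E (bits b v) g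
  E-bits g {lo} {hi} lo≤hi low high zero v = subst (λ u → lo ℚ.+ (⟪ hits u 1 ⟫ ℚ.* 1ℚ) ℚ.* (hi ℚ.- lo) ≼ g v) (sym (*-identityʳ v)) go
    where
    all : ∀ lo hi → lo ℚ.+ (1ℚ ℚ.* 1ℚ) ℚ.* (hi ℚ.- lo) ≡ hi
    all = RingSolver.solve-∀ ℚ-ring
    none : ∀ lo hi → lo ℚ.+ (0ℚ ℚ.* 1ℚ) ℚ.* (hi ℚ.- lo) ≡ lo
    none = RingSolver.solve-∀ ℚ-ring
    go : lo ℚ.+ (⟪ hits v 1 ⟫ ℚ.* 1ℚ) ℚ.* (hi ℚ.- lo) ≼ g v
    go with leaf v ≡ᵇ j in eq
    ... | true  = subst (_≼ g v) (sym (all lo hi)) (high v (≡ᵇ⇒≡ (leaf v) j (subst T (sym eq) tt)))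
    ... | false = subst (_≼ g v) (sym (none lo hi)) (low v)
  E-bits g {lo} {hi} lo≤hi low high (suc b) v = begin
    lo ℚ.+ (⟪ hits (v * 2 ^ suc b) (2 ^ suc b) ⟫ ℚ.* (½ ℚ.* pow ½ b)) ℚ.* (hi ℚ.- lo) ≡⟨ cong (λ m → lo ℚ.+ (m ℚ.* (½ ℚ.* pow ½ b)) ℚ.* (hi ℚ.- lo)) (trans (cong ⟪_⟫ split) (⟪⟫-+ h₀ h₁)) ⟩
    lo ℚ.+ ((⟪ h₀ ⟫ ℚ.+ ⟪ h₁ ⟫) ℚ.* (½ ℚ.* pow ½ b)) ℚ.* (hi ℚ.- lo) ≡⟨ lemma lo (hi ℚ.- lo) ⟪ h₀ ⟫ ⟪ h₁ ⟫ (pow ½ b) ⟩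
    mean (lo ℚ.+ (⟪ h₀ ⟫ ℚ.* pow ½ b) ℚ.* (hi ℚ.- lo)) (lo ℚ.+ (⟪ h₁ ⟫ ℚ.* pow ½ b) ℚ.* (hi ℚ.- lo)) ≤⟨ mean-mono (E-bits g lo≤hi low high b (2 * v)) (E-bits g lo≤hi low high b (suc (2 * v))) ⟩
    mean (E (bits b (2 * v)) g) (E (bits b (suc (2 * v))) g) ∎
    where
    open ℚₚ.≤-Reasoning
    h₀ h₁ : ℕ
    h₀ = hits (2 * v * 2 ^ b) (2 ^ b)
    h₁ = hits (suc (2 * v) * 2 ^ b) (2 ^ b)
    split : hits (v * 2 ^ suc b) (2 ^ suc b) ≡ h₀ + h₁
    split = trans (cong₂ hits (eq₁ v (2 ^ b)) (eq₂ (2 ^ b))) (trans (hits-+ (2 * v * 2 ^ b) (2 ^ b) (2 ^ b))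
      (cong (λ u → h₀ + hits u (2 ^ b)) (eq₃ v (2 ^ b))))
      where
      eq₁ : ∀ v q → v * (2 * q) ≡ 2 * v * q
      eq₁ = solve-∀
      eq₂ : ∀ q → 2 * q ≡ q + q
      eq₂ = solve-∀
      eq₃ : ∀ v q → 2 * v * q + q ≡ suc (2 * v) * q
      eq₃ = solve-∀
    lemma : ∀ lo δ h₀ h₁ q → lo ℚ.+ ((h₀ ℚ.+ h₁) ℚ.* (½ ℚ.* q)) ℚ.* δ ≡
      ½ ℚ.* ((lo ℚ.+ (h₀ ℚ.* q) ℚ.* δ) ℚ.+ (lo ℚ.+ (h₁ ℚ.* q) ℚ.* δ))
    lemma = RingSolver.solve-∀ ℚ-ring

block-hits : ∀ m .{{_ : NonZero m}} j N → suc j * m ≤ N → m ≤ hits (_/ m) j 0 N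
block-hits m j N le = begin
  m                                       ≡⟨ hits-all (_/ m) j (j * m) m quotient ⟨
  hits (_/ m) j (j * m) m                 ≤⟨ m≤m+n _ _ ⟩
  hits (_/ m) j (j * m) m + hits (_/ m) j (j * m + m) (N ∸ suc j * m) ≡⟨ hits-+ (_/ m) j (j * m) m _ ⟨
  hits (_/ m) j (j * m) (m + (N ∸ suc j * m)) ≤⟨ m≤n+m _ _ ⟩
  hits (_/ m) j 0 (j * m) + hits (_/ m) j (j * m) (m + (N ∸ suc j * m)) ≡⟨ hits-+ (_/ m) j 0 (j * m) _ ⟨
  hits (_/ m) j 0 (j * m + (m + (N ∸ suc j * m))) ≡⟨ cong (hits (_/ m) j 0) (trans (eq (j * m) m (N ∸ suc j * m)) (m+[n∸m]≡n le)) ⟩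
  hits (_/ m) j 0 N                       ∎
  where
  open ≤-Reasoning
  eq : ∀ a b c → a + (b + c) ≡ b + a + c
  eq = solve-∀
  quotient : ∀ i → i < m → (j * m + i) / m ≡ j
  quotient i i<m = trans (DivMod.+-distrib-/-∣ˡ i (divides j refl))
    (trans (cong₂ _+_ (DivMod.m*n/n≡m j m) (DivMod.m<n⇒m/n≡0 i<m)) (+-identityʳ j))

½-inverse : ∀ b → ⟪ 2 ^ b ⟫ ℚ.* pow ½ b ≡ 1ℚ
½-inverse b = trans (cong (ℚ._* pow ½ b) (⟪⟫-pow 2 b)) (trans (sym (pow-* ⟪ 2 ⟫ ½ b)) (pow-1 b))

-- This is why 2k coins suffice: a block of ⌊4 ^ k / k⌋ outcomes then has length m ≥ 3k, and
-- rounding down costs at most the step from 1/k to 3/(3k+1).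
3k²≤4^k : ∀ k → 3 * (k * k) ≤ 2 ^ (2 * k)
3k²≤4^k zero          = z≤n
3k²≤4^k (suc zero)    = s≤s (s≤s (s≤s z≤n))
3k²≤4^k (suc (suc i)) = begin
  3 * ((2 + i) * (2 + i))     ≤⟨ m≤m+n _ (9 * (i * i) + 12 * i) ⟩
  3 * ((2 + i) * (2 + i)) + (9 * (i * i) + 12 * i) ≡⟨ eq i ⟩
  4 * (3 * (suc i * suc i))   ≤⟨ *-monoʳ-≤ 4 (3k²≤4^k (suc i)) ⟩
  4 * 2 ^ (2 * suc i)         ≡⟨ trans (cong (2 ^_) (eq₂ i)) (^-distribˡ-+-* 2 2 (2 * suc i)) ⟨
  2 ^ (2 * (2 + i))           ∎
  where
  open ≤-Reasoning
  eq : ∀ i → 3 * ((2 + i) * (2 + i)) + (9 * (i * i) + 12 * i) ≡ 4 * (3 * (suc i * suc i))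
  eq = solve-∀
  eq₂ : ∀ i → 2 * (2 + i) ≡ 2 + 2 * suc i
  eq₂ = solve-∀

module Constants (κ : ℕ) where

  k β m : ℕ
  k = 3 + κ
  β = 2 * k
  m = 2 ^ β / k

  3k≤m : 3 * k ≤ m
  3k≤m = begin
    3 * k             ≡⟨ DivMod.m*n/n≡m (3 * k) k ⟨
    3 * k * k / k     ≤⟨ DivMod./-monoˡ-≤ k (subst (_≤ 2 ^ β) (sym (*-assoc 3 k k)) (3k²≤4^k k)) ⟩
    m                 ∎
    where open ≤-Reasoning

  instance m-nonZero : NonZero m
           m-nonZero = >-nonZero (≤-trans (s≤s z≤n) 3k≤m)

  leaf : ℕ → ℕ
  leaf v = v / m

  -- p = 3/(3k+1) < 1/k leaves room for the rounding in pick, and x = 2/(2k-1) satisfies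
  -- e^(1/k) < 1 + x and x < p/(1-p).  X = 1/(k-2) is where (1+X)^(k-1)/X is least,
  -- ℓ solves ℓ x = p + (1-p) x², and μ = 1/ℓ.
  p x X ℓ μ : ℚ
  p = frac 3 (9 + 3 * κ)
  x = frac 2 (4 + 2 * κ)
  X = frac 1 κ
  ℓ = frac (103 + 72 * κ + 12 * (κ * κ)) (99 + 70 * κ + 12 * (κ * κ))
  μ = frac (100 + 70 * κ + 12 * (κ * κ)) (102 + 72 * κ + 12 * (κ * κ))

  private
    1-p : 1ℚ ℚ.- p ≡ frac (7 + 3 * κ) (9 + 3 * κ)
    1-p = frac-complement 3 (7 + 3 * κ) (9 + 3 * κ) refl

    after : ∀ a d → let e = d + d * suc d in
            p ℚ.+ (1ℚ ℚ.- p) ℚ.* (frac a d ℚ.* frac a d) ≡ frac (3 * suc e + (7 + 3 * κ) * (a * a)) (e + (9 + 3 * κ) * suc e)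
    after a d = trans (cong₂ (λ q s → p ℚ.+ q ℚ.* s) 1-p (frac-* a d a d))
      (trans (cong₂ ℚ._+_ (frac-≡ {3} {9 + 3 * κ} {3 * suc e} {e + (9 + 3 * κ) * suc e} (eq e (9 + 3 * κ)))
                          (frac-* (7 + 3 * κ) (9 + 3 * κ) (a * a) e))
        (frac-+-common (3 * suc e) ((7 + 3 * κ) * (a * a)) (e + (9 + 3 * κ) * suc e)))
      where
      e = d + d * suc d
      eq : ∀ e d → 3 * suc (e + d * suc e) ≡ 3 * suc e * suc d
      eq = solve-∀

    L = 103 + 72 * κ + 12 * (κ * κ)
    M = 99 + 70 * κ + 12 * (κ * κ)

  x-drift : ℓ ℚ.* x ≼ p ℚ.+ (1ℚ ℚ.- p) ℚ.* (x ℚ.* x)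
  x-drift = subst₂ _≼_ (sym (frac-* L M 2 d)) (sym (after 2 d))
    (frac-≼ {L * 2} {d + M * suc d} {3 * suc e + (7 + 3 * κ) * (2 * 2)} {e + (9 + 3 * κ) * suc e} (≤-reflexive (eq κ)))
    where
    d = 4 + 2 * κ
    e = d + d * suc d
    eq : ∀ κ → let d = 4 + 2 * κ ; e = d + d * suc d in
      (103 + 72 * κ + 12 * (κ * κ)) * 2 * suc (e + (9 + 3 * κ) * suc e) ≡
      (3 * suc e + (7 + 3 * κ) * (2 * 2)) * suc (d + (99 + 70 * κ + 12 * (κ * κ)) * suc d)
    eq = solve-∀

  -- The quadratic p + (1-p) t² - ℓ t vanishes at x and stays negative up to its other root p/((1-p)
  -- x) = (6k-3)/(6k-4), which exceeds 1 and hence X. The check itself exhibits the difference of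
  -- the cross products.
  X-drift : p ℚ.+ (1ℚ ℚ.- p) ℚ.* (X ℚ.* X) ≼ ℓ ℚ.* X
  X-drift = subst₂ _≼_ (sym (after 1 κ)) (sym (frac-* L M 1 κ))
    (frac-≼ {3 * suc e + (7 + 3 * κ) * (1 * 1)} {e + (9 + 3 * κ) * suc e} {L * 1} {κ + M * suc κ}
      (≤-trans (m≤m+n _ _) (≤-reflexive (eq κ))))
    where
    e = κ + κ * suc κ
    eq : ∀ κ → let e = κ + κ * suc κ in
      (3 * suc e + (7 + 3 * κ) * (1 * 1)) * suc (κ + (99 + 70 * κ + 12 * (κ * κ)) * suc κ) + (10 + 3 * κ) * suc κ * (3 + 45 * κ + 18 * (κ * κ)) ≡
      (103 + 72 * κ + 12 * (κ * κ)) * 1 * suc (e + (9 + 3 * κ) * suc e)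
    eq = solve-∀

  private
    3N≤ : 3 * 2 ^ β ≤ m * (10 + 3 * κ)
    3N≤ = begin
      3 * 2 ^ β                     ≡⟨ cong (3 *_) (DivMod.m≡m%n+[m/n]*n (2 ^ β) k) ⟩
      3 * (2 ^ β % k + m * k) ≤⟨ *-monoʳ-≤ 3 (+-monoˡ-≤ (m * k) (<⇒≤ (DivMod.m%n<n (2 ^ β) k))) ⟩
      3 * (k + m * k)               ≡⟨ *-distribˡ-+ 3 k (m * k) ⟩
      3 * k + 3 * (m * k)           ≤⟨ +-monoˡ-≤ (3 * (m * k)) 3k≤m ⟩
      m + 3 * (m * k)               ≡⟨ eq m κ ⟩
      m * (10 + 3 * κ)              ∎
      where
      open ≤-Reasoning
      eq : ∀ m κ → m + 3 * (m * (3 + κ)) ≡ m * (10 + 3 * κ)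
      eq = solve-∀

    p≼hits : ∀ j → j < k → p ≼ ⟪ hits leaf j 0 (2 ^ β) ⟫ ℚ.* pow ½ β
    p≼hits j j<k = begin
      p                                       ≡⟨ ℚₚ.*-identityʳ p ⟨
      p ℚ.* 1ℚ                                ≡⟨ cong (p ℚ.*_) (½-inverse β) ⟨
      p ℚ.* (⟪ 2 ^ β ⟫ ℚ.* pow ½ β)           ≡⟨ ℚₚ.*-assoc p ⟪ 2 ^ β ⟫ (pow ½ β) ⟨
      (p ℚ.* ⟪ 2 ^ β ⟫) ℚ.* pow ½ β ≤⟨ ℚₚ.*-monoʳ-≤-nonNeg (pow ½ β) {{ℚ.nonNegative (0≼pow β 0≼½)}} enough ⟩
      ⟪ hits leaf j 0 (2 ^ β) ⟫ ℚ.* pow ½ β   ∎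
      where
      open ℚₚ.≤-Reasoning
      enough : p ℚ.* ⟪ 2 ^ β ⟫ ≼ ⟪ hits leaf j 0 (2 ^ β) ⟫
      enough = ℚₚ.≤-trans (subst (_≼ ⟪ m ⟫) (sym (frac-* 3 (9 + 3 * κ) (2 ^ β) 0))
          (frac-≼ {3 * 2 ^ β} {0 + (9 + 3 * κ) * 1} {m} {0}
            (subst₂ _≤_ (sym (*-identityʳ (3 * 2 ^ β))) (cong (λ d → m * suc d) (sym (*-identityʳ (9 + 3 * κ)))) 3N≤)))
        (⟪⟫-mono (block-hits m j (2 ^ β) (≤-trans (*-monoˡ-≤ m j<k)
          (≤-trans (≤-reflexive (*-comm k m)) (DivMod.m/n*n≤m (2 ^ β) k)))))

  drift : Drift β leaf k
  drift = record
    { p = p ; x = x ; X = X ; ℓ = ℓ ; μ = μ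
    ; 0≼p = 0≼frac 3 (9 + 3 * κ)
    ; 0<x = frac-< {0} {0} {2} {4 + 2 * κ} (s≤s z≤n)
    ; x≼X = frac-≼ {2} {4 + 2 * κ} {1} {κ} (≤-trans (m≤m+n _ 3) (≤-reflexive (eq₁ κ)))
    ; X≼1 = frac≼1 {1} {κ} (s≤s z≤n)
    ; 1≼ℓ = frac-≼ {1} {0} {L} {M} (≤-trans (m≤m+n _ (3 + 2 * κ)) (≤-reflexive (eq₂ κ)))
    ; 0≼μ = 0≼frac (100 + 70 * κ + 12 * (κ * κ)) (102 + 72 * κ + 12 * (κ * κ))
    ; ℓμ≡1 = trans (frac-* L M (suc M) (102 + 72 * κ + 12 * (κ * κ)))
               (frac-≡ {L * suc M} {(102 + 72 * κ + 12 * (κ * κ)) + M * suc (102 + 72 * κ + 12 * (κ * κ))} {1} {0} (eq₃ (102 + 72 * κ + 12 * (κ * κ)) M))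
    ; x-drift = x-drift
    ; X-drift = X-drift
    ; pick-likely = λ j j<k g {lo} {hi} lo≤hi low high → ℚₚ.≤-trans
        (ℚₚ.+-monoʳ-≤ lo (ℚₚ.*-monoʳ-≤-nonNeg (hi ℚ.- lo) {{ℚ.nonNegative (≼⇒0≼ lo≤hi)}} (p≼hits j j<k)))
        (E-bits leaf j g lo≤hi low high β 0)
    }
    where
    eq₁ : ∀ κ → 2 * suc κ + 3 ≡ 1 * suc (4 + 2 * κ)
    eq₁ = solve-∀
    eq₂ : ∀ κ → 1 * suc (99 + 70 * κ + 12 * (κ * κ)) + (3 + 2 * κ) ≡ (103 + 72 * κ + 12 * (κ * κ)) * 1
    eq₂ = solve-∀
    eq₃ : ∀ l m → suc l * suc m * 1 ≡ 1 * suc (l + m * suc l)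
    eq₃ = solve-∀

  -- Large enough for speed · (ℓ - 1) ≥ 1, so that by Bernoulli this many steps halve the price of
  -- limited fuel.
  speed : ℕ
  speed = 12 * (k * k)

  μ-speed : pow μ speed ≼ ½
  μ-speed = begin
    pow μ speed                         ≡⟨ lemma (pow μ speed) ⟩
    ½ ℚ.* (pow μ speed ℚ.* (1ℚ ℚ.+ 1ℚ)) ≤⟨ *-monoʳ 0≼½ (*-monoʳ (0≼pow speed 0≼μ) (ℚₚ.+-monoʳ-≤ 1ℚ 1≤)) ⟩
    ½ ℚ.* (pow μ speed ℚ.* (1ℚ ℚ.+ ⟪ speed ⟫ ℚ.* η)) ≤⟨ *-monoʳ 0≼½ (bernoulli 0≼μ (0≼frac (3 + 2 * κ) M) (ℚₚ.≤-reflexive μ[1+η]) speed) ⟩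
    ½ ℚ.* 1ℚ                            ≡⟨⟩
    ½                                   ∎
    where
    open ℚₚ.≤-Reasoning
    open Drift drift using (0≼μ; ℓμ≡1)
    η = frac (3 + 2 * κ) M
    lemma : ∀ q → q ≡ ½ ℚ.* (q ℚ.* (1ℚ ℚ.+ 1ℚ))
    lemma = RingSolver.solve-∀ ℚ-ring
    eq : ∀ κ → (1 * suc (99 + 70 * κ + 12 * (κ * κ)) + (3 + 2 * κ) * 1) ≡ 103 + 72 * κ + 12 * (κ * κ)
    eq = solve-∀
    1+η : 1ℚ ℚ.+ η ≡ ℓ
    1+η = trans (frac-+ 1 0 (3 + 2 * κ) M) (frac-≡ {1 * suc M + (3 + 2 * κ) * 1} {M + 0} {L} {M} (trans (cong (_* suc M) (eq κ)) (cong (λ d → L * suc d) (sym (+-identityʳ M)))))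
    μ[1+η] : μ ℚ.* (1ℚ ℚ.+ η) ≡ 1ℚ
    μ[1+η] = trans (cong (μ ℚ.*_) 1+η) (trans (ℚₚ.*-comm μ ℓ) ℓμ≡1)
    1≤ : 1ℚ ≼ ⟪ speed ⟫ ℚ.* η
    1≤ = subst (1ℚ ≼_) (sym (frac-* speed 0 (3 + 2 * κ) M)) (frac-≼ {1} {0} {speed * (3 + 2 * κ)} {M + 0}
      (≤-trans (m≤m+n _ (224 + 362 * κ + 168 * (κ * κ) + 24 * (κ * κ * κ))) (≤-reflexive (eq₄ κ))))
      where
      eq₄ : ∀ κ → 1 * suc (99 + 70 * κ + 12 * (κ * κ) + 0) + (224 + 362 * κ + 168 * (κ * κ) + 24 * (κ * κ * κ)) ≡
            12 * ((3 + κ) * (3 + κ)) * (3 + 2 * κ) * 1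
      eq₄ = solve-∀

  u : ℚ
  u = frac (7 + 2 * κ) (9 + 4 * κ)

  mean-x : mean 1ℚ x ≡ u
  mean-x = trans (cong (½ ℚ.*_) (frac-+ 1 0 2 (4 + 2 * κ))) (trans (frac-* 1 1 (1 * suc (4 + 2 * κ) + 2 * 1) (4 + 2 * κ + 0))
    (frac-≡ {1 * (1 * suc (4 + 2 * κ) + 2 * 1)} {(4 + 2 * κ + 0) + 1 * suc (4 + 2 * κ + 0)} {7 + 2 * κ} {9 + 4 * κ} (eq κ)))
    where
    eq : ∀ κ → 1 * (1 * suc (4 + 2 * κ) + 2 * 1) * suc (9 + 4 * κ) ≡ (7 + 2 * κ) * suc ((4 + 2 * κ + 0) + 1 * suc (4 + 2 * κ + 0))
    eq = solve-∀

  ½≼u : ½ ≼ u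
  ½≼u = frac-≼ {1} {1} {7 + 2 * κ} {9 + 4 * κ} (≤-trans (m≤m+n _ 4) (≤-reflexive (eq κ)))
    where
    eq : ∀ κ → 1 * suc (9 + 4 * κ) + 4 ≡ (7 + 2 * κ) * 2
    eq = solve-∀

  0≼u : 0ℚ ≼ u
  0≼u = ℚₚ.≤-trans 0≼½ ½≼u

  u≼1 : u ≼ 1ℚ
  u≼1 = frac≼1 {7 + 2 * κ} {9 + 4 * κ} (+-mono-≤ (m≤m+n 7 3) (*-monoˡ-≤ κ {2} {4} (s≤s (s≤s z≤n))))

  -- The two units of `speed` beyond n supply the factor 1/4; the other n are compared with u ^ n by
  -- u ≥ ½.
  μ-walk : ∀ n → pow μ ((2 + n) * speed) ≼ ¼ ℚ.* pow u n
  μ-walk n = begin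
    pow μ ((2 + n) * speed)       ≡⟨ pow-pow μ (2 + n) speed ⟩
    pow (pow μ speed) (2 + n)     ≤⟨ pow-mono (2 + n) (0≼pow speed (Drift.0≼μ drift)) μ-speed ⟩
    ½ ℚ.* (½ ℚ.* pow ½ n)         ≡⟨ ℚₚ.*-assoc ½ ½ (pow ½ n) ⟨
    ¼ ℚ.* pow ½ n                 ≤⟨ *-monoʳ (ℚₚ.nonNegative⁻¹ ¼) (pow-mono n 0≼½ ½≼u) ⟩
    ¼ ℚ.* pow u n                 ∎
    where open ℚₚ.≤-Reasoning

-- The number of rounds

module Growth (κ : ℕ) where

  open Constants κ

  -- A/B = 2/(1+x) is the base of the running time.
  A g B : ℕ
  A = 10 + 4 * κ
  g = 6 + 2 * κ
  B = suc g

  open Main β leaf speed A g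

  grow-zero : ∀ f w → grow f 0 w ≡ w
  grow-zero zero    w = refl
  grow-zero (suc f) w = refl

  grow-≥ : ∀ f m w → m ≤ f → w * B + m * A ≤ grow f m w * B
  grow-≥ zero    zero    w _ = ≤-reflexive (+-identityʳ (w * B))
  grow-≥ (suc f) zero    w _ = ≤-reflexive (+-identityʳ (w * B))
  grow-≥ (suc f) (suc m) w (s≤s m≤f) = begin
    w * B + suc m * A                   ≤⟨ +-monoʳ-≤ (w * B) (*-monoˡ-≤ A (s≤s (m≤n+m∸n m g))) ⟩
    w * B + suc (g + (m ∸ g)) * A       ≡⟨ eq w g (m ∸ g) A ⟩
    (A + w) * B + (m ∸ g) * A           ≤⟨ grow-≥ f (m ∸ g) (A + w) (≤-trans (m∸n≤m m g) m≤f) ⟩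
    grow f (m ∸ g) (A + w) * B          ∎
    where
    open ≤-Reasoning
    eq : ∀ w g d A → w * suc g + suc (g + d) * A ≡ (A + w) * suc g + d * A
    eq = solve-∀

  -- Only the last block can be incomplete, by at most g cells, and on this scale a cell is worth A.
  grow-≤ : ∀ f m w → grow f m w * B ≤ w * B + m * A + g * A
  grow-≤ zero    m       w = ≤-trans (m≤m+n _ _) (≤-reflexive (sym (+-assoc (w * B) (m * A) (g * A))))
  grow-≤ (suc f) zero    w = ≤-trans (m≤m+n _ _) (≤-reflexive (sym (+-assoc (w * B) 0 (g * A))))
  grow-≤ (suc f) (suc m) w = cases (≤-total m g)
    where
    open ≤-Reasoning
    eq : ∀ A w g → (A + w) * suc g ≡ w * suc g + A + g * A
    eq = solve-∀
    eq₂ : ∀ A w g d → (A + w) * suc g + d * A + g * A ≡ w * suc g + suc (g + d) * A + g * A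
    eq₂ = solve-∀
    cases : m ≤ g ⊎ g ≤ m → grow f (m ∸ g) (A + w) * B ≤ w * B + suc m * A + g * A
    cases (inj₁ m≤g) = begin
      grow f (m ∸ g) (A + w) * B      ≡⟨ cong (λ d → grow f d (A + w) * B) (m≤n⇒m∸n≡0 m≤g) ⟩
      grow f 0 (A + w) * B ≡⟨ cong (_* B) {grow f 0 (A + w)} {A + w} (grow-zero f (A + w)) ⟩
      (A + w) * B                     ≡⟨ eq A w g ⟩
      w * B + A + g * A               ≤⟨ +-monoˡ-≤ (g * A) (+-monoʳ-≤ (w * B) (m≤m+n A (m * A))) ⟩
      w * B + suc m * A + g * A       ∎
    cases (inj₂ g≤m) = begin
      grow f (m ∸ g) (A + w) * B                ≤⟨ grow-≤ f (m ∸ g) (A + w) ⟩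
      (A + w) * B + (m ∸ g) * A + g * A         ≡⟨ eq₂ A w g (m ∸ g) ⟩
      w * B + suc (g + (m ∸ g)) * A + g * A ≡⟨ cong (λ m → w * B + suc m * A + g * A) {g + (m ∸ g)} {m} (m+[n∸m]≡n g≤m) ⟩
      w * B + suc m * A + g * A                 ∎

  B≤A : B ≤ A
  B≤A = +-mono-≤ (m≤m+n 7 3) (*-monoˡ-≤ κ {2} {4} (s≤s (s≤s z≤n)))

  rounds-≥ : ∀ i w → w * A ^ i ≤ rounds i w * B ^ i
  rounds-≥ zero    w = ≤-refl
  rounds-≥ (suc i) w = begin
    w * (A * A ^ i)             ≡⟨ *-assoc w A (A ^ i) ⟨
    w * A * A ^ i               ≤⟨ *-monoˡ-≤ (A ^ i) (grow-≥ w w 0 ≤-refl) ⟩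
    w′ * B * A ^ i              ≡⟨ eq w′ B (A ^ i) ⟩
    B * (w′ * A ^ i)            ≤⟨ *-monoʳ-≤ B (rounds-≥ i w′) ⟩
    B * (rounds i w′ * B ^ i)   ≡⟨ eq₂ B (rounds i w′) (B ^ i) ⟩
    rounds i w′ * (B * B ^ i)   ∎
    where
    open ≤-Reasoning
    w′ = grow w w 0
    eq : ∀ w b a → w * b * a ≡ b * (w * a)
    eq = solve-∀
    eq₂ : ∀ b r p → b * (r * p) ≡ r * (b * p)
    eq₂ = solve-∀

  -- The constant A B absorbs the rounding errors: it grows by more than they add.
  rounds-≤ : ∀ i w → (rounds i w + A * B) * B ^ i ≤ (w + A * B) * A ^ i
  rounds-≤ zero    w = ≤-refl
  rounds-≤ (suc i) w = begin
    (rounds i w′ + A * B) * (B * B ^ i)     ≡⟨ eq (rounds i w′ + A * B) B (B ^ i) ⟩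
    B * ((rounds i w′ + A * B) * B ^ i)     ≤⟨ *-monoʳ-≤ B (rounds-≤ i w′) ⟩
    B * ((w′ + A * B) * A ^ i)              ≡⟨ eq₂ B (w′ + A * B) (A ^ i) ⟩
    (w′ + A * B) * B * A ^ i                ≡⟨ cong (_* A ^ i) (*-distribʳ-+ B w′ (A * B)) ⟩
    (w′ * B + A * B * B) * A ^ i ≤⟨ *-monoˡ-≤ (A ^ i) (+-monoˡ-≤ (A * B * B) (grow-≤ w w 0)) ⟩
    -- 15 + 18κ + 4κ² is B (A - B) - g, the surplus that remains after the rounding error.
    (w * A + g * A + A * B * B) * A ^ i ≤⟨ *-monoˡ-≤ (A ^ i) (≤-trans (m≤m+n (w * A + g * A + A * B * B) (A * (15 + 4 * (κ * κ) + 18 * κ))) (≤-reflexive (slack w κ))) ⟩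
    (w + A * B) * A * A ^ i                 ≡⟨ *-assoc (w + A * B) A (A ^ i) ⟩
    (w + A * B) * (A * A ^ i)               ∎
    where
    open ≤-Reasoning
    w′ = grow w w 0
    eq : ∀ r b p → r * (b * p) ≡ b * (r * p)
    eq = solve-∀
    eq₂ : ∀ b r p → b * (r * p) ≡ r * b * p
    eq₂ = solve-∀
    slack : ∀ w κ → let A = 10 + 4 * κ ; g = 6 + 2 * κ ; B = suc g in
      w * A + g * A + A * B * B + A * (15 + 4 * (κ * κ) + 18 * κ) ≡ (w + A * B) * A
    slack = solve-∀

  w≤grow : ∀ w → w ≤ grow w w 0
  w≤grow w = *-cancelʳ-≤ w (grow w w 0) B (≤-trans (*-monoʳ-≤ w B≤A) (grow-≥ w w 0 ≤-refl))

  w≤rounds : ∀ i w → w ≤ rounds i w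
  w≤rounds zero    w = ≤-refl
  w≤rounds (suc i) w = ≤-trans (w≤grow w) (w≤rounds i (grow w w 0))

  growTime-≤ : ∀ i w → growTime i w ≤ 1 + i * (8 + rounds i w * 4)
  growTime-≤ zero    w = ≤-refl
  growTime-≤ (suc i) w = begin
    8 + (w * 4 + growTime i w′) ≤⟨ +-monoʳ-≤ 8 (+-mono-≤ (*-monoˡ-≤ 4 (w≤rounds (suc i) w)) (growTime-≤ i w′)) ⟩
    8 + (r * 4 + (1 + i * (8 + r * 4))) ≡⟨ eq r i ⟩
    1 + suc i * (8 + r * 4)             ∎
    where
    open ≤-Reasoning
    w′ = grow w w 0
    r = rounds i w′
    eq : ∀ r i → 8 + (r * 4 + (1 + i * (8 + r * 4))) ≡ 1 + suc i * (8 + r * 4)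
    eq = solve-∀

  refuel-≡ : ∀ i m → refuel i m ≡ i * speed + m
  refuel-≡ zero    m = refl
  refuel-≡ (suc i) m = trans (refuel-≡ i (speed + m)) (eq (i * speed) speed m)
    where
    eq : ∀ p q m → p + (q + m) ≡ q + p + m
    eq = solve-∀

  u^n : ∀ n → pow u n ℚ.* ⟪ A ^ n ⟫ ≡ ⟪ B ^ n ⟫
  u^n n = trans (cong (pow u n ℚ.*_) (⟪⟫-pow A n)) (trans (sym (pow-* u ⟪ A ⟫ n))
    (trans (cong (λ q → pow q n) (denominator B (9 + 4 * κ))) (sym (⟪⟫-pow B n))))

  -- What is left of u ^ n after one half has been given to the subtracted X-term and one quarter to
  -- limited fuel.
  rate : ℕ → ℚ
  rate n = ¼ ℚ.* pow u n

  0≼rate : ∀ n → 0ℚ ≼ rate n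
  0≼rate n = 0≼* (ℚₚ.nonNegative⁻¹ ¼) (0≼pow n 0≼u)

  rate≼1 : ∀ n → rate n ≼ 1ℚ
  rate≼1 n = ℚₚ.≤-trans (*-monoʳ (ℚₚ.nonNegative⁻¹ ¼) (pow≼1 n 0≼u u≼1)) (ℚₚ.≤ᵇ⇒≤ {¼ ℚ.* 1ℚ} {1ℚ} tt)

  rounds-rate : ∀ n → ⟪ n ⟫ ℚ.* ¼ ≼ ⟪ rounds n n ⟫ ℚ.* rate n
  rounds-rate n = subst (⟪ n ⟫ ℚ.* ¼ ≼_) (lemma ⟪ rounds n n ⟫ (pow u n) ¼)
    (ℚₚ.*-monoʳ-≤-nonNeg ¼ {⟪ n ⟫} {⟪ rounds n n ⟫ ℚ.* pow u n} (ℚₚ.*-cancelʳ-≤-pos {⟪ n ⟫} {⟪ rounds n n ⟫ ℚ.* pow u n} ⟪ A ^ n ⟫ {{ℚ.positive 0<Aⁿ}} le))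
    where
    lemma : ∀ r v q → (r ℚ.* v) ℚ.* q ≡ r ℚ.* (q ℚ.* v)
    lemma = RingSolver.solve-∀ ℚ-ring
    0<Aⁿ : 0ℚ ℚ.< ⟪ A ^ n ⟫
    0<Aⁿ = frac-< {0} {0} {A ^ n} {0} (subst (0 <_) (sym (*-identityʳ (A ^ n))) (m^n>0 A n))
    le : ⟪ n ⟫ ℚ.* ⟪ A ^ n ⟫ ≼ (⟪ rounds n n ⟫ ℚ.* pow u n) ℚ.* ⟪ A ^ n ⟫
    le = subst₂ _≼_ (⟪⟫-* n (A ^ n)) (trans (⟪⟫-* (rounds n n) (B ^ n))
      (trans (cong (⟪ rounds n n ⟫ ℚ.*_) (sym (u^n n))) (sym (ℚₚ.*-assoc ⟪ rounds n n ⟫ (pow u n) ⟪ A ^ n ⟫))))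
      (⟪⟫-mono (rounds-≥ n n))

  -- Because the count of rounds grows from n rather than from 1, rounds times rate is at least n/4.
  -- As (1-ρ)(1+ρ) ≤ 1, `bernoulli` then bounds the failure by 1/(1 + n/4).
  failure-≤ : ∀ n → pow (1ℚ ℚ.- rate n) (rounds n n) ≼ frac 4 (3 + n)
  failure-≤ n = ℚₚ.*-cancelʳ-≤-pos (1ℚ ℚ.+ ⟪ n ⟫ ℚ.* ¼) {{ℚ.positive positive}} (begin
    s ℚ.* (1ℚ ℚ.+ ⟪ n ⟫ ℚ.* ¼) ≤⟨ *-monoʳ (0≼pow (rounds n n) 0≤1-ρ) (ℚₚ.+-monoʳ-≤ 1ℚ (rounds-rate n)) ⟩
    s ℚ.* (1ℚ ℚ.+ ⟪ rounds n n ⟫ ℚ.* rate n) ≤⟨ bernoulli 0≤1-ρ (0≼rate n) (0≼⇒≼ (subst (0ℚ ≼_) (lemma (rate n)) (0≼* (0≼rate n) (0≼rate n)))) (rounds n n) ⟩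
    1ℚ                                              ≡⟨ one ⟨
    frac 4 (3 + n) ℚ.* (1ℚ ℚ.+ ⟪ n ⟫ ℚ.* ¼)         ∎)
    where
    open ℚₚ.≤-Reasoning
    s = pow (1ℚ ℚ.- rate n) (rounds n n)
    0≤1-ρ : 0ℚ ≼ 1ℚ ℚ.- rate n
    0≤1-ρ = ≼⇒0≼ (rate≼1 n)
    positive : 0ℚ ℚ.< 1ℚ ℚ.+ ⟪ n ⟫ ℚ.* ¼
    positive = ℚₚ.<-≤-trans (ℚₚ.positive⁻¹ 1ℚ) (subst (_≼ 1ℚ ℚ.+ ⟪ n ⟫ ℚ.* ¼) (ℚₚ.+-identityʳ 1ℚ)
      (ℚₚ.+-monoʳ-≤ 1ℚ (0≼* (0≼frac n 0) (ℚₚ.nonNegative⁻¹ ¼))))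
    lemma : ∀ ρ → ρ ℚ.* ρ ≡ 1ℚ ℚ.- (1ℚ ℚ.- ρ) ℚ.* (1ℚ ℚ.+ ρ)
    lemma = RingSolver.solve-∀ ℚ-ring
    one : frac 4 (3 + n) ℚ.* (1ℚ ℚ.+ ⟪ n ⟫ ℚ.* ¼) ≡ 1ℚ
    one = trans (cong (λ q → frac 4 (3 + n) ℚ.* (1ℚ ℚ.+ q)) (frac-* n 0 1 3)) (trans (cong (frac 4 (3 + n) ℚ.*_) (frac-+ 1 0 (n * 1) 3))
      (trans (frac-* 4 (3 + n) (1 * 4 + n * 1 * 1) 3) (frac-≡ {4 * (1 * 4 + n * 1 * 1)} {3 + (3 + n) * 4} {1} {0} (eq n))))
      where
      eq : ∀ n → 4 * (1 * 4 + n * 1 * 1) * 1 ≡ 1 * suc (3 + (3 + n) * 4)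
      eq = solve-∀

  success-≥ : ∀ n → let s = 1ℚ ℚ.- pow (1ℚ ℚ.- rate n) (rounds n n) in 1ℚ ℚ.- frac 8 (3 + n) ≼ s ℚ.* s
  success-≥ n = begin
    1ℚ ℚ.- frac 8 (3 + n)                 ≡⟨ cong (λ q → 1ℚ ℚ.- q) (frac-+-common 4 4 (3 + n)) ⟨
    1ℚ ℚ.- (frac 4 (3 + n) ℚ.+ frac 4 (3 + n)) ≤⟨ ℚₚ.+-monoʳ-≤ 1ℚ (ℚₚ.neg-antimono-≤ (ℚₚ.+-mono-≤ (failure-≤ n) (failure-≤ n))) ⟩
    1ℚ ℚ.- (s ℚ.+ s)                      ≤⟨ 0≼⇒≼ (subst (0ℚ ≼_) (lemma s) (0≼* 0≤s 0≤s)) ⟩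
    (1ℚ ℚ.- s) ℚ.* (1ℚ ℚ.- s)             ∎
    where
    open ℚₚ.≤-Reasoning
    s = pow (1ℚ ℚ.- rate n) (rounds n n)
    0≤s : 0ℚ ≼ s
    0≤s = 0≼pow (rounds n n) (≼⇒0≼ (rate≼1 n))
    lemma : ∀ s → s ℚ.* s ≡ (1ℚ ℚ.- s) ℚ.* (1ℚ ℚ.- s) ℚ.- (1ℚ ℚ.- (s ℚ.+ s))
    lemma = RingSolver.solve-∀ ℚ-ring

-- Powers, the diameter and the chance of a direct hit

^-distribʳ-* : ∀ a b n → (a * b) ^ n ≡ a ^ n * b ^ n
^-distribʳ-* a b zero    = refl
^-distribʳ-* a b (suc n) = trans (cong (a * b *_) (^-distribʳ-* a b n)) (eq a b (a ^ n) (b ^ n))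
  where
  eq : ∀ a b p q → a * b * (p * q) ≡ a * p * (b * q)
  eq = solve-∀

^-comm : ∀ a m n → (a ^ m) ^ n ≡ (a ^ n) ^ m
^-comm a m n = trans (^-*-assoc a m n) (trans (cong (a ^_) (*-comm m n)) (sym (^-*-assoc a n m)))

^-cancel-≤ : ∀ n .{{_ : NonZero n}} {a b} → a ^ n ≤ b ^ n → a ≤ b
^-cancel-≤ n {a} {b} le with a ≤? b
... | yes a≤b = a≤b
... | no  a≰b = ⊥-elim (<⇒≱ (^-monoˡ-< n (≰⇒> a≰b)) le)

-- With x = N s / d this is (1 + x/N)^N ≤ (2 + x)/(2 - x), where r = d (2 - x).
power-≤ : ∀ d s N r → N * s + r ≡ 2 * d → (d + s) ^ N * r ≤ d ^ N * (2 * d + N * s)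
power-≤ d s zero    r eq = ≤-reflexive (cong (_+ 0) (trans eq (sym (+-identityʳ (2 * d)))))
power-≤ d s (suc N) zero eq = ≤-trans (≤-reflexive (*-zeroʳ ((d + s) ^ suc N))) z≤n
power-≤ d s (suc N) r@(suc _) eq = *-cancelʳ-≤ _ _ (r + s) (*-cancelˡ-≤ 2 (begin
  2 * ((d + s) * P * r * (r + s))                        ≡⟨ eq₁ d s P r ⟩
  (2 * d + 2 * s) * r * (P * (r + s)) ≤⟨ *-monoʳ-≤ ((2 * d + 2 * s) * r) (power-≤ d s N (r + s) (trans (eq₂ (N * s) r s) eq)) ⟩
  (2 * d + 2 * s) * r * (Q * (2 * d + v))                ≡⟨ eq₃ (2 * d + 2 * s) r Q (2 * d + v) ⟩
  Q * ((2 * d + 2 * s) * r * (2 * d + v)) ≡⟨ cong (λ D → Q * ((D + 2 * s) * r * (D + v))) (sym eq) ⟩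
  Q * ((s + v + r + 2 * s) * r * (s + v + r + v)) ≤⟨ *-monoʳ-≤ Q (≤-trans (m≤m+n _ _) (≤-reflexive (eq₄ s v r))) ⟩
  Q * ((s + v + r) * (r + s) * (s + v + r + (s + v))) ≡⟨ cong (λ D → Q * (D * (r + s) * (D + (s + v)))) eq ⟩
  Q * (2 * d * (r + s) * (2 * d + (s + v)))              ≡⟨ eq₅ Q d (r + s) (2 * d + (s + v)) ⟩
  2 * (d * Q * (2 * d + suc N * s) * (r + s))            ∎))
  where
  open ≤-Reasoning
  P = (d + s) ^ N
  Q = d ^ N
  v = N * s
  eq₁ : ∀ d s P r → 2 * ((d + s) * P * r * (r + s)) ≡ (2 * d + 2 * s) * r * (P * (r + s))
  eq₁ = solve-∀
  eq₂ : ∀ v r s → v + (r + s) ≡ s + v + r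
  eq₂ = solve-∀
  eq₃ : ∀ a r Q b → a * r * (Q * b) ≡ Q * (a * r * b)
  eq₃ = solve-∀
  eq₄ : ∀ s v r → (s + v + r + 2 * s) * r * (s + v + r + v) + 2 * s * (v * v + s * s + 2 * (v * s) + r * s) ≡
                  (s + v + r) * (r + s) * (s + v + r + (s + v))
  eq₄ = solve-∀
  eq₅ : ∀ Q d a b → Q * (2 * d * a * b) ≡ 2 * (d * Q * b * a)
  eq₅ = solve-∀

farthest : ∀ {n} (F : CNF n) z₀ → z₀ ⊨ F → ∃[ z ] z ⊨ F × Diam F ≤ 2 * d-H z₀ z
farthest F z₀ z₀⊨F with Extrema.argmax-sel id 0 (List.map (uncurry d-H) (List.cartesianProduct (Ω F) (Ω F)))
-- The maximum may be attained by its default 0, and then z₀ itself will do.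
... | inj₁ D≡0 = z₀ , z₀⊨F , subst (_≤ 2 * d-H z₀ z₀) (sym D≡0) z≤n
... | inj₂ D∈ with Membership.∈-map⁻ _ D∈
... | (a , b) , ab∈ , D≡ with Membership.∈-cartesianProduct⁻ (Ω F) (Ω F) ab∈
... | a∈ , b∈ with proj₂ (Membership.∈-filter⁻ (_⊨? F) {xs = bitStrings _} a∈) | proj₂ (Membership.∈-filter⁻ (_⊨? F) {xs = bitStrings _} b∈) | ≤-total (d-H z₀ a) (d-H z₀ b)
... | a⊨F | b⊨F | inj₁ a≤b = b , b⊨F , (begin
    Diam F                    ≡⟨ D≡ ⟩
    d-H a b                   ≤⟨ d-H-triangle a z₀ b ⟩
    d-H a z₀ + d-H z₀ b       ≡⟨ cong (_+ d-H z₀ b) (d-H-sym a z₀) ⟩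
    d-H z₀ a + d-H z₀ b       ≤⟨ +-mono-≤ a≤b (m≤m+n (d-H z₀ b) 0) ⟩
    2 * d-H z₀ b              ∎)
  where open ≤-Reasoning
... | a⊨F | b⊨F | inj₂ b≤a = a , a⊨F , (begin
    Diam F                    ≡⟨ D≡ ⟩
    d-H a b                   ≤⟨ d-H-triangle a z₀ b ⟩
    d-H a z₀ + d-H z₀ b       ≡⟨ cong (_+ d-H z₀ b) (d-H-sym a z₀) ⟩
    d-H z₀ a + d-H z₀ b       ≤⟨ +-monoʳ-≤ (d-H z₀ a) (≤-trans b≤a (m≤m+n (d-H z₀ a) 0)) ⟩
    2 * d-H z₀ a              ∎)
  where open ≤-Reasoning

hitChance-4^n : ∀ {n} (y z : Assignment n) → hitChance y z ℚ.* ⟪ 4 ^ n ⟫ ≡ ⟪ 3 ^ (n ∸ d-H y z) ⟫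
hitChance-4^n []      []      = refl
hitChance-4^n {suc n} (b ∷ y) (c ∷ z) = go b c
  where
  q = hitChance y z
  same-bit : ((1ℚ ℚ.* (¾ ℚ.* 1ℚ)) ℚ.* q) ℚ.* ⟪ 4 ^ suc n ⟫ ≡ ⟪ 3 ^ (suc n ∸ d-H y z) ⟫
  same-bit = begin
    ((1ℚ ℚ.* (¾ ℚ.* 1ℚ)) ℚ.* q) ℚ.* ⟪ 4 * 4 ^ n ⟫ ≡⟨ cong (((1ℚ ℚ.* (¾ ℚ.* 1ℚ)) ℚ.* q) ℚ.*_) (⟪⟫-* 4 (4 ^ n)) ⟩
    ((1ℚ ℚ.* (¾ ℚ.* 1ℚ)) ℚ.* q) ℚ.* (⟪ 4 ⟫ ℚ.* ⟪ 4 ^ n ⟫)   ≡⟨ lemma ¾ q ⟪ 4 ⟫ ⟪ 4 ^ n ⟫ ⟩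
    (¾ ℚ.* ⟪ 4 ⟫) ℚ.* (q ℚ.* ⟪ 4 ^ n ⟫) ≡⟨ cong (⟪ 3 ⟫ ℚ.*_) (hitChance-4^n y z) ⟩
    ⟪ 3 ⟫ ℚ.* ⟪ 3 ^ (n ∸ d-H y z) ⟫                         ≡⟨ ⟪⟫-* 3 (3 ^ (n ∸ d-H y z)) ⟨
    ⟪ 3 ^ suc (n ∸ d-H y z) ⟫ ≡⟨ cong (λ m → ⟪ 3 ^ m ⟫) (+-∸-assoc 1 (d-H≤n y z)) ⟨
    ⟪ 3 ^ (suc n ∸ d-H y z) ⟫                               ∎
    where
    open ≡-Reasoning
    lemma : ∀ a q f r → ((1ℚ ℚ.* (a ℚ.* 1ℚ)) ℚ.* q) ℚ.* (f ℚ.* r) ≡ (a ℚ.* f) ℚ.* (q ℚ.* r)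
    lemma = RingSolver.solve-∀ ℚ-ring
  other-bit : (((¼ ℚ.* 1ℚ) ℚ.* 1ℚ) ℚ.* q) ℚ.* ⟪ 4 ^ suc n ⟫ ≡ ⟪ 3 ^ (n ∸ d-H y z) ⟫
  other-bit = begin
    (((¼ ℚ.* 1ℚ) ℚ.* 1ℚ) ℚ.* q) ℚ.* ⟪ 4 * 4 ^ n ⟫ ≡⟨ cong ((((¼ ℚ.* 1ℚ) ℚ.* 1ℚ) ℚ.* q) ℚ.*_) (⟪⟫-* 4 (4 ^ n)) ⟩
    (((¼ ℚ.* 1ℚ) ℚ.* 1ℚ) ℚ.* q) ℚ.* (⟪ 4 ⟫ ℚ.* ⟪ 4 ^ n ⟫)   ≡⟨ lemma ¼ q ⟪ 4 ⟫ ⟪ 4 ^ n ⟫ ⟩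
    (¼ ℚ.* ⟪ 4 ⟫) ℚ.* (q ℚ.* ⟪ 4 ^ n ⟫)                     ≡⟨ ℚₚ.*-identityˡ (q ℚ.* ⟪ 4 ^ n ⟫) ⟩
    q ℚ.* ⟪ 4 ^ n ⟫                                         ≡⟨ hitChance-4^n y z ⟩
    ⟪ 3 ^ (n ∸ d-H y z) ⟫                                   ∎
    where
    open ≡-Reasoning
    lemma : ∀ a q f r → (((a ℚ.* 1ℚ) ℚ.* 1ℚ) ℚ.* q) ℚ.* (f ℚ.* r) ≡ (a ℚ.* f) ℚ.* (q ℚ.* r)
    lemma = RingSolver.solve-∀ ℚ-ring
  go : ∀ b c → hitChance (b ∷ y) (c ∷ z) ℚ.* ⟪ 4 ^ suc n ⟫ ≡ ⟪ 3 ^ (suc n ∸ d-H (b ∷ y) (c ∷ z)) ⟫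
  go false false = same-bit
  go false true  = other-bit
  go true  false = other-bit
  go true  true  = same-bit

-- Weighing the distant solutions

module Tail (κ : ℕ) (1≤κ : 1 ≤ κ) where

  open Constants κ

  D : ℕ
  D = 6 + 9 * κ + 2 * (κ * κ)

  -- θ = x/X and a = (1+X)/(1+x).
  θ a bound : ℚ
  θ     = frac (2 + 2 * κ) (4 + 2 * κ)
  a     = frac (10 + 9 * κ + 2 * (κ * κ)) D
  -- What `power-≤` yields for a ^ (k-1), as a = 1 + 3/(D+1).
  bound = frac (20 + 21 * κ + 4 * (κ * κ)) (7 + 15 * κ + 4 * (κ * κ))

  0≼θ : 0ℚ ≼ θ
  0≼θ = 0≼frac (2 + 2 * κ) (4 + 2 * κ)

  θ≼1 : θ ≼ 1ℚ
  θ≼1 = frac≼1 {2 + 2 * κ} {4 + 2 * κ} (+-monoˡ-≤ (2 * κ) (m≤m+n 2 3))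

  θX≡x : θ ℚ.* X ≡ x
  θX≡x = trans (frac-* (2 + 2 * κ) (4 + 2 * κ) 1 κ)
    (frac-≡ {(2 + 2 * κ) * 1} {κ + (4 + 2 * κ) * suc κ} {2} {4 + 2 * κ} (eq κ))
    where
    eq : ∀ κ → (2 + 2 * κ) * 1 * suc (4 + 2 * κ) ≡ 2 * suc (κ + (4 + 2 * κ) * suc κ)
    eq = solve-∀

  mean-X : mean 1ℚ X ≡ a ℚ.* u
  mean-X = trans (cong (½ ℚ.*_) (frac-+ 1 0 1 κ)) (trans (frac-* 1 1 (1 * suc κ + 1 * 1) (κ + 0))
    (trans (frac-≡ {1 * (1 * suc κ + 1 * 1)} {(κ + 0) + 1 * suc (κ + 0)} {(10 + 9 * κ + 2 * (κ * κ)) * (7 + 2 * κ)} {(9 + 4 * κ) + D * suc (9 + 4 * κ)} (eq κ))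
      (sym (frac-* (10 + 9 * κ + 2 * (κ * κ)) D (7 + 2 * κ) (9 + 4 * κ)))))
    where
    eq : ∀ κ → 1 * (1 * suc κ + 1 * 1) * suc ((9 + 4 * κ) + (6 + 9 * κ + 2 * (κ * κ)) * suc (9 + 4 * κ)) ≡
               (10 + 9 * κ + 2 * (κ * κ)) * (7 + 2 * κ) * suc ((κ + 0) + 1 * suc (κ + 0))
    eq = solve-∀

  0≼a : 0ℚ ≼ a
  0≼a = 0≼frac (10 + 9 * κ + 2 * (κ * κ)) D

  1≼a : 1ℚ ≼ a
  1≼a = frac-≼ {1} {0} {10 + 9 * κ + 2 * (κ * κ)} {D} (≤-trans (m≤m+n _ 3) (≤-reflexive (eq κ)))
    where
    eq : ∀ κ → 1 * suc (6 + 9 * κ + 2 * (κ * κ)) + 3 ≡ (10 + 9 * κ + 2 * (κ * κ)) * 1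
    eq = solve-∀

  0≼bound : 0ℚ ≼ bound
  0≼bound = 0≼frac (20 + 21 * κ + 4 * (κ * κ)) (7 + 15 * κ + 4 * (κ * κ))

  a-power : pow a (2 + κ) ≼ bound
  a-power = ℚₚ.*-cancelʳ-≤-pos (⟪ suc D ^ N ⟫ ℚ.* ⟪ r ⟫) {{ℚ.positive (subst (0ℚ ℚ.<_) (⟪⟫-* (suc D ^ N) r)
      (frac-< {0} {0} {suc D ^ N * r} {0} (subst (0 <_) (sym (*-identityʳ _)) (*-mono-≤ {1} {suc D ^ N} {1} {r} (m^n>0 (suc D) N) (s≤s z≤n)))))}}
    (subst₂ _≼_ lhs rhs (⟪⟫-mono (power-≤ (suc D) 3 N r (eq κ))))
    where
    N r : ℕ
    N = 2 + κ
    r = 8 + 15 * κ + 4 * (κ * κ)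
    eq : ∀ κ → (2 + κ) * 3 + (8 + 15 * κ + 4 * (κ * κ)) ≡ 2 * (7 + 9 * κ + 2 * (κ * κ))
    eq = solve-∀
    eq₂ : ∀ κ → 2 * (7 + 9 * κ + 2 * (κ * κ)) + (2 + κ) * 3 ≡ 20 + 21 * κ + 4 * (κ * κ)
    eq₂ = solve-∀
    eq₃ : ∀ κ → 7 + 9 * κ + 2 * (κ * κ) + 3 ≡ 10 + 9 * κ + 2 * (κ * κ)
    eq₃ = solve-∀
    lhs : ⟪ (suc D + 3) ^ N * r ⟫ ≡ pow a N ℚ.* (⟪ suc D ^ N ⟫ ℚ.* ⟪ r ⟫)
    lhs = begin
      ⟪ (suc D + 3) ^ N * r ⟫                   ≡⟨ ⟪⟫-* ((suc D + 3) ^ N) r ⟩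
      ⟪ (suc D + 3) ^ N ⟫ ℚ.* ⟪ r ⟫             ≡⟨ cong (λ m → ⟪ m ^ N ⟫ ℚ.* ⟪ r ⟫) (eq₃ κ) ⟩
      ⟪ (10 + 9 * κ + 2 * (κ * κ)) ^ N ⟫ ℚ.* ⟪ r ⟫ ≡⟨ cong (ℚ._* ⟪ r ⟫) (⟪⟫-pow (10 + 9 * κ + 2 * (κ * κ)) N) ⟩
      pow ⟪ 10 + 9 * κ + 2 * (κ * κ) ⟫ N ℚ.* ⟪ r ⟫ ≡⟨ cong (λ q → pow q N ℚ.* ⟪ r ⟫) (denominator (10 + 9 * κ + 2 * (κ * κ)) D) ⟨
      pow (a ℚ.* ⟪ suc D ⟫) N ℚ.* ⟪ r ⟫         ≡⟨ cong (ℚ._* ⟪ r ⟫) (pow-* a ⟪ suc D ⟫ N) ⟩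
      pow a N ℚ.* pow ⟪ suc D ⟫ N ℚ.* ⟪ r ⟫ ≡⟨ cong (λ q → pow a N ℚ.* q ℚ.* ⟪ r ⟫) (⟪⟫-pow (suc D) N) ⟨
      pow a N ℚ.* ⟪ suc D ^ N ⟫ ℚ.* ⟪ r ⟫       ≡⟨ ℚₚ.*-assoc (pow a N) ⟪ suc D ^ N ⟫ ⟪ r ⟫ ⟩
      pow a N ℚ.* (⟪ suc D ^ N ⟫ ℚ.* ⟪ r ⟫)     ∎
      where open ≡-Reasoning
    rhs : ⟪ suc D ^ N * (2 * suc D + N * 3) ⟫ ≡ bound ℚ.* (⟪ suc D ^ N ⟫ ℚ.* ⟪ r ⟫)
    rhs = begin
      ⟪ suc D ^ N * (2 * suc D + N * 3) ⟫       ≡⟨ ⟪⟫-* (suc D ^ N) (2 * suc D + N * 3) ⟩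
      ⟪ suc D ^ N ⟫ ℚ.* ⟪ 2 * suc D + N * 3 ⟫   ≡⟨ cong (λ m → ⟪ suc D ^ N ⟫ ℚ.* ⟪ m ⟫) (eq₂ κ) ⟩
      ⟪ suc D ^ N ⟫ ℚ.* ⟪ 20 + 21 * κ + 4 * (κ * κ) ⟫ ≡⟨ cong (⟪ suc D ^ N ⟫ ℚ.*_) (denominator (20 + 21 * κ + 4 * (κ * κ)) (7 + 15 * κ + 4 * (κ * κ))) ⟨
      ⟪ suc D ^ N ⟫ ℚ.* (bound ℚ.* ⟪ r ⟫)       ≡⟨ lemma ⟪ suc D ^ N ⟫ bound ⟪ r ⟫ ⟩
      bound ℚ.* (⟪ suc D ^ N ⟫ ℚ.* ⟪ r ⟫)       ∎
      where
      open ≡-Reasoning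
      lemma : ∀ d b r → d ℚ.* (b ℚ.* r) ≡ b ℚ.* (d ℚ.* r)
      lemma = RingSolver.solve-∀ ℚ-ring

  bound≼2 : bound ≼ ⟪ 2 ⟫
  bound≼2 = frac-≼ {20 + 21 * κ + 4 * (κ * κ)} {7 + 15 * κ + 4 * (κ * κ)} {2} {0} (begin
    (20 + 21 * κ + 4 * (κ * κ)) * 1                       ≡⟨ eq κ ⟩
    4 * 1 + (16 + 21 * κ + 4 * (κ * κ))                   ≤⟨ +-monoˡ-≤ _ (*-monoʳ-≤ 4 1≤κ) ⟩
    4 * κ + (16 + 21 * κ + 4 * (κ * κ))                   ≤⟨ m≤m+n _ (4 * (κ * κ) + 5 * κ) ⟩
    4 * κ + (16 + 21 * κ + 4 * (κ * κ)) + (4 * (κ * κ) + 5 * κ)  ≡⟨ eq₂ κ ⟩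
    2 * suc (7 + 15 * κ + 4 * (κ * κ))                    ∎)
    where
    open ≤-Reasoning
    eq : ∀ κ → (20 + 21 * κ + 4 * (κ * κ)) * 1 ≡ 4 * 1 + (16 + 21 * κ + 4 * (κ * κ))
    eq = solve-∀
    eq₂ : ∀ κ → 4 * κ + (16 + 21 * κ + 4 * (κ * κ)) + (4 * (κ * κ) + 5 * κ) ≡ 2 * suc (7 + 15 * κ + 4 * (κ * κ))
    eq₂ = solve-∀

  h : ℚ
  h = frac 1 (39 + 82 * κ + 50 * (κ * κ) + 8 * (κ * κ * κ))

  -- With H + 1 the denominator of `h`, θ · bound equals (H+1)/(H+1+9κ), and 1 ≤ 9κ leaves room for
  -- the factor 1 + h. This margin is what makes the subtracted term exponentially smaller than u ^
  -- n.
  θ-bound : (θ ℚ.* bound) ℚ.* (1ℚ ℚ.+ h) ≼ 1ℚ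
  θ-bound = subst (_≼ 1ℚ) (sym (trans (cong₂ ℚ._*_ (frac-* (2 + 2 * κ) (4 + 2 * κ) (20 + 21 * κ + 4 * (κ * κ)) (7 + 15 * κ + 4 * (κ * κ))) (frac-+ 1 0 1 H))
      (frac-* ((2 + 2 * κ) * (20 + 21 * κ + 4 * (κ * κ))) R (1 * suc H + 1 * 1) (H + 0))))
    (frac≼1 {(2 + 2 * κ) * (20 + 21 * κ + 4 * (κ * κ)) * (1 * suc H + 1 * 1)} {(H + 0) + R * suc (H + 0)} (begin
      (2 + 2 * κ) * (20 + 21 * κ + 4 * (κ * κ)) * (1 * suc H + 1 * 1)   ≡⟨ eq κ ⟩
      suc H * (suc H + 1) ≤⟨ *-monoʳ-≤ (suc H) (+-monoʳ-≤ (suc H) (≤-trans 1≤κ (m≤n*m κ 9))) ⟩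
      suc H * (suc H + 9 * κ)                                           ≡⟨ eq₂ κ ⟩
      suc ((H + 0) + R * suc (H + 0))                                   ∎))
    where
    open ≤-Reasoning
    H R : ℕ
    H = 39 + 82 * κ + 50 * (κ * κ) + 8 * (κ * κ * κ)
    R = (7 + 15 * κ + 4 * (κ * κ)) + (4 + 2 * κ) * suc (7 + 15 * κ + 4 * (κ * κ))
    eq : ∀ κ → let H = 39 + 82 * κ + 50 * (κ * κ) + 8 * (κ * κ * κ) in
      (2 + 2 * κ) * (20 + 21 * κ + 4 * (κ * κ)) * (1 * suc H + 1 * 1) ≡ suc H * (suc H + 1)
    eq = solve-∀
    eq₂ : ∀ κ → let H = 39 + 82 * κ + 50 * (κ * κ) + 8 * (κ * κ * κ) in
      suc H * (suc H + 9 * κ) ≡ suc ((H + 0) + ((7 + 15 * κ + 4 * (κ * κ)) + (4 + 2 * κ) * suc (7 + 15 * κ + 4 * (κ * κ))) * suc (H + 0))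
    eq₂ = solve-∀

  -- Three times the denominator of `h`: then s h ≥ 3, and Bernoulli gives 1/(1+3).
  s₀ n₀ : ℕ
  s₀ = 3 * (40 + 82 * κ + 50 * (κ * κ) + 8 * (κ * κ * κ))
  n₀ = s₀ * (2 + κ)

  θ-decay : ∀ s → s₀ ≤ s → pow (θ ℚ.* bound) s ≼ ¼
  θ-decay s s₀≤s = begin
    q                                          ≡⟨ lemma q ⟩
    ¼ ℚ.* (q ℚ.* (1ℚ ℚ.+ ⟪ 3 ⟫)) ≤⟨ *-monoʳ 0≼¼ (*-monoʳ (0≼pow s (0≼* 0≼θ 0≼bound)) (ℚₚ.+-monoʳ-≤ 1ℚ 3≤sh)) ⟩
    ¼ ℚ.* (q ℚ.* (1ℚ ℚ.+ ⟪ s ⟫ ℚ.* h)) ≤⟨ *-monoʳ 0≼¼ (bernoulli (0≼* 0≼θ 0≼bound) 0≼h θ-bound s) ⟩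
    ¼ ℚ.* 1ℚ                                   ≡⟨⟩
    ¼                                          ∎
    where
    open ℚₚ.≤-Reasoning
    q = pow (θ ℚ.* bound) s
    0≼¼ = ℚₚ.nonNegative⁻¹ ¼
    H = 39 + 82 * κ + 50 * (κ * κ) + 8 * (κ * κ * κ)
    0≼h = 0≼frac 1 H
    lemma : ∀ q → q ≡ (½ ℚ.* ½) ℚ.* (q ℚ.* (1ℚ ℚ.+ (1ℚ ℚ.+ 1ℚ ℚ.+ 1ℚ)))
    lemma = RingSolver.solve-∀ ℚ-ring
    3≤sh : ⟪ 3 ⟫ ≼ ⟪ s ⟫ ℚ.* h
    3≤sh = subst (⟪ 3 ⟫ ≼_) (sym (frac-* s 0 1 H)) (frac-≼ {3} {0} {s * 1} {H + 0}
      (subst₂ _≤_ (cong (λ m → 3 * suc m) (sym (+-identityʳ H))) (trans (sym (*-identityʳ s)) (sym (*-identityʳ (s * 1)))) s₀≤s))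

  -- The least weight for which the potential is nonpositive from distance n/(k-1) on.
  weight : ℕ → ℚ
  weight n = pow θ (n / (2 + κ))

  -- Each block of k - 1 variables contributes θ a ^ (k-1) ≤ θ · bound < 1 to the quotient of the
  -- subtracted term by u ^ n. From n₀ on the full blocks give at most 1/4, and the incomplete block
  -- costs at most a factor 2.
  tail-≤ : ∀ n → n₀ ≤ n → weight n ℚ.* pow (mean 1ℚ X) n ≼ ½ ℚ.* pow u n
  tail-≤ n n₀≤n = begin
    pow θ s ℚ.* pow (mean 1ℚ X) n ≡⟨ cong (λ q → pow θ s ℚ.* q) (trans (cong (λ q → pow q n) mean-X) (pow-* a u n)) ⟩
    pow θ s ℚ.* (pow a n ℚ.* pow u n) ≡⟨ ℚₚ.*-assoc (pow θ s) (pow a n) (pow u n) ⟨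
    (pow θ s ℚ.* pow a n) ℚ.* pow u n ≤⟨ ℚₚ.*-monoʳ-≤-nonNeg (pow u n) {{ℚ.nonNegative (0≼pow n 0≼u)}} half ⟩
    ½ ℚ.* pow u n                                          ∎
    where
    open ℚₚ.≤-Reasoning
    s rem : ℕ
    s   = n / (2 + κ)
    rem = n % (2 + κ)
    aⁿ : pow a n ≡ pow a rem ℚ.* pow (pow a (2 + κ)) s
    aⁿ = trans (cong (pow a) (DivMod.m≡m%n+[m/n]*n n (2 + κ))) (trans (pow-+ a rem (s * (2 + κ))) (cong (pow a rem ℚ.*_) (pow-pow a s (2 + κ))))
    a-rem : pow a rem ≼ ⟪ 2 ⟫
    a-rem = ℚₚ.≤-trans (increasing (<⇒≤ (DivMod.m%n<n n (2 + κ)))) (ℚₚ.≤-trans a-power bound≼2)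
      where
      increasing : ∀ {i j} → i ≤ j → pow a i ≼ pow a j
      increasing {i} {j} i≤j = subst₂ _≼_ (ℚₚ.*-identityʳ (pow a i)) (trans (sym (pow-+ a i (j ∸ i))) (cong (pow a) (m+[n∸m]≡n i≤j)))
        (*-monoʳ (0≼pow i 0≼a) (subst (_≼ pow a (j ∸ i)) (pow-1 (j ∸ i)) (pow-mono (j ∸ i) 0≼1 1≼a)))
    s₀≤s : s₀ ≤ s
    s₀≤s = subst (_≤ s) (DivMod.m*n/n≡m s₀ (2 + κ)) (DivMod./-monoˡ-≤ (2 + κ) n₀≤n)
    half : pow θ s ℚ.* pow a n ≼ ½
    half = begin
      pow θ s ℚ.* pow a n                                     ≡⟨ cong (pow θ s ℚ.*_) aⁿ ⟩
      pow θ s ℚ.* (pow a rem ℚ.* pow (pow a (2 + κ)) s) ≤⟨ *-monoʳ (0≼pow s 0≼θ) (*-mono (0≼pow rem 0≼a) a-rem (0≼pow s (0≼pow (2 + κ) 0≼a)) (pow-mono s (0≼pow (2 + κ) 0≼a) a-power)) ⟩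
      pow θ s ℚ.* (⟪ 2 ⟫ ℚ.* pow bound s) ≡⟨ trans (lemma (pow θ s) ⟪ 2 ⟫ (pow bound s)) (cong (⟪ 2 ⟫ ℚ.*_) (sym (pow-* θ bound s))) ⟩
      ⟪ 2 ⟫ ℚ.* pow (θ ℚ.* bound) s ≤⟨ *-monoʳ (0≼frac 2 0) (θ-decay s s₀≤s) ⟩
      ⟪ 2 ⟫ ℚ.* ¼                                             ≡⟨⟩
      ½                                                       ∎
      where
      lemma : ∀ a b c → a ℚ.* (b ℚ.* c) ≡ b ℚ.* (a ℚ.* c)
      lemma = RingSolver.solve-∀ ℚ-ring

  -- Since x ^ d = θ ^ d X ^ d, the sign depends only on whether d reaches the exponent of the
  -- weight.
  potential-≤0 : ∀ n d → n ≤ d * (2 + κ) → Walk.potential drift (weight n) d ≼ 0ℚ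
  potential-≤0 n d n≤ = ℚₚ.≤-trans (ℚₚ.+-monoˡ-≤ (ℚ.- (weight n ℚ.* pow X d)) xᵈ≤)
    (ℚₚ.≤-reflexive (ℚₚ.+-inverseʳ (weight n ℚ.* pow X d)))
    where
    s≤d : n / (2 + κ) ≤ d
    s≤d = subst (n / (2 + κ) ≤_) (DivMod.m*n/n≡m d (2 + κ)) (DivMod./-monoˡ-≤ (2 + κ) n≤)
    xᵈ≤ : pow x d ≼ weight n ℚ.* pow X d
    xᵈ≤ = subst (_≼ weight n ℚ.* pow X d) (trans (sym (pow-* θ X d)) (cong (λ q → pow q d) θX≡x))
      (ℚₚ.*-monoʳ-≤-nonNeg (pow X d) {{ℚ.nonNegative (0≼pow d (0≼frac 1 κ))}} (pow-decreasing 0≼θ θ≼1 s≤d))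

-- For k = 3 + κ with k ≥ 7: searching near z₀ pays off up to distance n/(c+1), a uniform start beyond.
record Split (κ c : ℕ) : Set where
  field
    near-good : (2 * (7 + 2 * κ)) ^ suc c ≤ 3 ^ c * (5 + 2 * κ) ^ suc c
    far-good  : suc c * ((1 + κ) * (1 + κ)) ≤ 4 * ((2 + κ) * (2 + κ))

split : ∀ j → ∃ (Split (4 + j))
-- At k = 7 `near-good` fails for c = 3, while `far-good` still holds for c = 4.
split zero    = 4 , record { near-good = ≤ᵇ⇒≤ _ _ tt ; far-good = ≤ᵇ⇒≤ _ _ tt }
split (suc j) = 3 , record
  { near-good = *-cancelˡ-≤ (15 ^ 4) (begin
      15 ^ 4 * (2 * (7 + 2 * κ)) ^ 4        ≡⟨ ^-distribʳ-* 15 (2 * (7 + 2 * κ)) 4 ⟨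
      -- For k ≥ 8 the quotient (2k+1)/(2k-1) is at most its value 17/15 at k = 8, which leaves
      -- (34/15)^4 ≤ 27.
      (15 * (2 * (7 + 2 * κ))) ^ 4 ≤⟨ ^-monoˡ-≤ 4 (≤-trans (m≤m+n (15 * (2 * (7 + 2 * κ))) (8 * j)) (≤-reflexive (eq j))) ⟩
      (34 * (5 + 2 * κ)) ^ 4                ≡⟨ ^-distribʳ-* 34 (5 + 2 * κ) 4 ⟩
      34 ^ 4 * (5 + 2 * κ) ^ 4 ≤⟨ *-monoˡ-≤ ((5 + 2 * κ) ^ 4) (≤ᵇ⇒≤ (34 ^ 4) (15 ^ 4 * 3 ^ 3) tt) ⟩
      15 ^ 4 * 3 ^ 3 * (5 + 2 * κ) ^ 4      ≡⟨ *-assoc (15 ^ 4) (3 ^ 3) ((5 + 2 * κ) ^ 4) ⟩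
      15 ^ 4 * (3 ^ 3 * (5 + 2 * κ) ^ 4)    ∎)
  ; far-good = *-monoʳ-≤ 4 (*-mono-≤ (n≤1+n (1 + κ)) (n≤1+n (1 + κ))) }
  where
  open ≤-Reasoning
  κ = 5 + j
  eq : ∀ j → 15 * (2 * (7 + 2 * (5 + j))) + 8 * j ≡ 34 * (5 + 2 * (5 + j))
  eq = solve-∀

-- Direct hits near the first solution

module Near (κ c : ℕ) (s : Split κ c) where

  open Constants κ
  open Growth κ using (A; B; u^n)
  open Split s

  -- `near-good` is the extreme case d = n/(c+1), and a smaller d only adds factors 3. Taking
  -- (c+1)-th powers avoids a fractional exponent.
  near-power : ∀ n d → suc c * d ≤ n → (2 * B) ^ n ≤ 3 ^ (n ∸ d) * (5 + 2 * κ) ^ n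
  near-power n d bd≤n = ^-cancel-≤ (suc c) (begin
    ((2 * B) ^ n) ^ suc c                        ≡⟨ ^-comm (2 * B) n (suc c) ⟩
    ((2 * B) ^ suc c) ^ n                        ≤⟨ ^-monoˡ-≤ n near-good ⟩
    (3 ^ c * v ^ suc c) ^ n                      ≡⟨ ^-distribʳ-* (3 ^ c) (v ^ suc c) n ⟩
    (3 ^ c) ^ n * (v ^ suc c) ^ n ≡⟨ cong₂ _*_ (^-*-assoc 3 c n) (^-comm v (suc c) n) ⟩
    3 ^ (c * n) * (v ^ n) ^ suc c ≤⟨ *-monoˡ-≤ ((v ^ n) ^ suc c) (^-monoʳ-≤ 3 exponent-≤) ⟩
    3 ^ ((n ∸ d) * suc c) * (v ^ n) ^ suc c ≡⟨ cong (_* (v ^ n) ^ suc c) (^-*-assoc 3 (n ∸ d) (suc c)) ⟨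
    (3 ^ (n ∸ d)) ^ suc c * (v ^ n) ^ suc c      ≡⟨ ^-distribʳ-* (3 ^ (n ∸ d)) (v ^ n) (suc c) ⟨
    (3 ^ (n ∸ d) * v ^ n) ^ suc c                ∎)
    where
    open ≤-Reasoning
    v = 5 + 2 * κ
    exponent-≤ : c * n ≤ (n ∸ d) * suc c
    exponent-≤ = begin
      c * n                         ≡⟨ m+n∸m≡n n (c * n) ⟨
      suc c * n ∸ n                 ≤⟨ ∸-monoʳ-≤ (suc c * n) bd≤n ⟩
      suc c * n ∸ suc c * d         ≡⟨ *-distribˡ-∸ (suc c) n d ⟨
      suc c * (n ∸ d)               ≡⟨ *-comm (suc c) (n ∸ d) ⟩
      (n ∸ d) * suc c               ∎

  hitChance-≥ : ∀ {n} (y z : Assignment n) → suc c * d-H y z ≤ n → pow u n ≼ hitChance y z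
  hitChance-≥ {n} y z bd≤n = ℚₚ.*-cancelʳ-≤-pos (⟪ A ^ n ⟫ ℚ.* ⟪ 4 ^ n ⟫)
    {{ℚ.positive (subst (0ℚ ℚ.<_) (⟪⟫-* (A ^ n) (4 ^ n)) (frac-< {0} {0} {A ^ n * 4 ^ n} {0}
      (subst (0 <_) (sym (*-identityʳ _)) (*-mono-≤ {1} {A ^ n} {1} {4 ^ n} (m^n>0 A n) (m^n>0 4 n)))))}}
    (subst₂ _≼_ lhs rhs (⟪⟫-mono le))
    where
    lhs : ⟪ B ^ n * 4 ^ n ⟫ ≡ pow u n ℚ.* (⟪ A ^ n ⟫ ℚ.* ⟪ 4 ^ n ⟫)
    lhs = trans (⟪⟫-* (B ^ n) (4 ^ n)) (trans (cong (ℚ._* ⟪ 4 ^ n ⟫) (sym (u^n n))) (ℚₚ.*-assoc (pow u n) ⟪ A ^ n ⟫ ⟪ 4 ^ n ⟫))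
    rhs : ⟪ 3 ^ (n ∸ d-H y z) * A ^ n ⟫ ≡ hitChance y z ℚ.* (⟪ A ^ n ⟫ ℚ.* ⟪ 4 ^ n ⟫)
    rhs = trans (⟪⟫-* (3 ^ (n ∸ d-H y z)) (A ^ n)) (trans (cong (ℚ._* ⟪ A ^ n ⟫) (sym (hitChance-4^n y z)))
      (lemma (hitChance y z) ⟪ 4 ^ n ⟫ ⟪ A ^ n ⟫))
      where
      lemma : ∀ p q r → (p ℚ.* q) ℚ.* r ≡ p ℚ.* (r ℚ.* q)
      lemma = RingSolver.solve-∀ ℚ-ring
    le : B ^ n * 4 ^ n ≤ 3 ^ (n ∸ d-H y z) * A ^ n
    le = begin
      B ^ n * 4 ^ n                                       ≡⟨ ^-distribʳ-* B 4 n ⟨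
      (B * 4) ^ n                                         ≡⟨ cong (_^ n) (eq B) ⟩
      (2 * B * 2) ^ n                                     ≡⟨ ^-distribʳ-* (2 * B) 2 n ⟩
      (2 * B) ^ n * 2 ^ n ≤⟨ *-monoˡ-≤ (2 ^ n) (near-power n (d-H y z) bd≤n) ⟩
      3 ^ (n ∸ d-H y z) * (5 + 2 * κ) ^ n * 2 ^ n ≡⟨ *-assoc (3 ^ (n ∸ d-H y z)) ((5 + 2 * κ) ^ n) (2 ^ n) ⟩
      3 ^ (n ∸ d-H y z) * ((5 + 2 * κ) ^ n * 2 ^ n) ≡⟨ cong (3 ^ (n ∸ d-H y z) *_) (trans (sym (^-distribʳ-* (5 + 2 * κ) 2 n)) (cong (_^ n) (eq₂ κ))) ⟩
      3 ^ (n ∸ d-H y z) * A ^ n                           ∎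
      where
      open ≤-Reasoning
      eq : ∀ b → b * 4 ≡ 2 * b * 2
      eq = solve-∀
      eq₂ : ∀ κ → (5 + 2 * κ) * 2 ≡ 10 + 4 * κ
      eq₂ = solve-∀

-- The approximation ratio

Far : ∀ κ → ℕ → ℕ → Set
Far κ D d = ratio (3 + κ) (s≤s (s≤s (s≤s z≤n))) ℚ.* ⟪ D ⟫ ≼ ⟪ d ⟫

Far-up : ∀ κ D {d e} → d ≤ e → Far κ D d → Far κ D e
Far-up κ D d≤e far = ℚₚ.≤-trans far (⟪⟫-mono d≤e)

-- The form to which the predecessor of (k-2)² reduces, so that `ratio-≡` holds by computation.
square-1 : ℕ → ℕ
square-1 κ = κ * 1 + κ * (suc κ * 1)

ratio-≡ : ∀ κ → ratio (3 + κ) (s≤s (s≤s (s≤s z≤n))) ≡ ½ ℚ.* (1ℚ ℚ.- frac (4 * (2 + κ)) (square-1 κ))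
ratio-≡ κ = refl

Far-0 : ∀ κ D → suc (square-1 κ) ≤ 4 * (2 + κ) → Far κ D 0
Far-0 κ D le = subst (_≼ 0ℚ) (sym (cong (ℚ._* ⟪ D ⟫) (ratio-≡ κ)))
  (0≼⇒≼ (subst (0ℚ ≼_) (lemma (frac (4 * (2 + κ)) (square-1 κ)) ⟪ D ⟫)
    (0≼* (0≼* 0≼½ (≼⇒0≼ (frac-≼ {1} {0} {4 * (2 + κ)} {square-1 κ} (subst₂ _≤_ (sym (*-identityˡ _)) (sym (*-identityʳ _)) le)))) (0≼frac D 0))))
  where
  lemma : ∀ q d → (½ ℚ.* (q ℚ.- 1ℚ)) ℚ.* d ≡ 0ℚ ℚ.- (½ ℚ.* (1ℚ ℚ.- q)) ℚ.* d
  lemma = RingSolver.solve-∀ ℚ-ring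

-- P/(k-2)² is twice the ratio. As P is a natural number the ratio is nonnegative here, so D may be
-- replaced by 2r, which cancels the ½.
Far-if : ∀ κ P → 4 * (2 + κ) + P ≡ suc (square-1 κ) → ∀ {D r d} → D ≤ 2 * r → P * r ≤ d * suc (square-1 κ) → Far κ D d
Far-if κ P eq {D} {r} {d} D≤2r Pr≤ = begin
  ratio (3 + κ) (s≤s (s≤s (s≤s z≤n))) ℚ.* ⟪ D ⟫ ≡⟨ cong (ℚ._* ⟪ D ⟫) (trans (ratio-≡ κ) (cong (½ ℚ.*_) (frac-complement (4 * (2 + κ)) P (square-1 κ) eq))) ⟩
  (½ ℚ.* q) ℚ.* ⟪ D ⟫ ≤⟨ *-monoʳ (0≼* 0≼½ (0≼frac P (square-1 κ))) (subst (⟪ D ⟫ ≼_) (⟪⟫-* 2 r) (⟪⟫-mono D≤2r)) ⟩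
  (½ ℚ.* q) ℚ.* (⟪ 2 ⟫ ℚ.* ⟪ r ⟫)                   ≡⟨ lemma q ⟪ r ⟫ ⟩
  q ℚ.* ⟪ r ⟫                                       ≡⟨ frac-* P (square-1 κ) r 0 ⟩
  frac (P * r) (0 + square-1 κ * 1) ≤⟨ frac-≼ {P * r} {0 + square-1 κ * 1} {d} {0} (subst₂ _≤_ (sym (*-identityʳ (P * r))) (cong (λ m → d * suc m) (sym (*-identityʳ (square-1 κ)))) Pr≤) ⟩
  ⟪ d ⟫                                             ∎
  where
  open ℚₚ.≤-Reasoning
  q = frac P (square-1 κ)
  lemma : ∀ q r → (½ ℚ.* q) ℚ.* ((1ℚ ℚ.+ 1ℚ) ℚ.* r) ≡ q ℚ.* r
  lemma = RingSolver.solve-∀ ℚ-ring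

module _ (κ : ℕ) {n} (F : CNF n) (F≤ : IsKCNF (3 + κ) F) where

  open Constants κ
  open Growth κ using (rate; 0≼rate; rate≼1; success-≥; A; g)
  open Main β leaf speed A g using (rounds)
  open Algorithm β leaf
  open Phases drift F F≤ ((2 + n) * speed)

  finds-mono : ∀ {ν ρ ρ′ Far z₀} → ρ′ ≼ ρ → Finds ν ρ Far z₀ → Finds ν ρ′ Far z₀
  finds-mono ρ′≤ρ finds h 0≼h found = ℚₚ.≤-trans ρ′≤ρ (finds h 0≼h found)

  rate-≤ : ∀ {w} → w ℚ.* pow (mean 1ℚ X) n ≼ ½ ℚ.* pow u n →
    rate n ≼ pow (mean 1ℚ x) n ℚ.- w ℚ.* pow (mean 1ℚ X) n ℚ.- pow μ ((2 + n) * speed)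
  rate-≤ {w} tail≤ = subst (λ q → rate n ≼ pow q n ℚ.- w ℚ.* pow (mean 1ℚ X) n ℚ.- pow μ ((2 + n) * speed)) (sym mean-x)
    (0≼⇒≼ (subst (0ℚ ≼_) (lemma (pow u n) (w ℚ.* pow (mean 1ℚ X) n) (pow μ ((2 + n) * speed)))
      (0≼+ (≼⇒0≼ tail≤) (≼⇒0≼ (μ-walk n)))))
    where
    lemma : ∀ q t m → (½ ℚ.* q ℚ.- t) ℚ.+ ((½ ℚ.* ½) ℚ.* q ℚ.- m) ≡ (q ℚ.- t ℚ.- m) ℚ.- (½ ℚ.* ½) ℚ.* q
    lemma = RingSolver.solve-∀ ℚ-ring

  -- With weight 0 nothing is subtracted and every solution counts.
  finds-solution : Satisfiable F → ∀ z → Finds fair (rate n) (λ _ → ⊤) z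
  finds-solution (z* , z*⊨F) z = finds-mono {fair} {pow (mean 1ℚ x) n ℚ.- 0ℚ ℚ.* pow (mean 1ℚ X) n ℚ.- pow μ ((2 + n) * speed)} {rate n} {λ _ → ⊤} {z}
    (rate-≤ {0ℚ} (subst (_≼ ½ ℚ.* pow u n) (sym (ℚₚ.*-zeroˡ (pow (mean 1ℚ X) n))) (0≼* 0≼½ (0≼pow n 0≼u))))
    (finds-fair {0ℚ} {λ _ → ⊤} {z} {z*} ≼-refl z*⊨F λ y _ → inj₁ tt)

  module _ {c P} (s : Split κ c) (1≤κ : 1 ≤ κ) (P≡ : 4 * (2 + κ) + P ≡ suc (square-1 κ)) where

    open Tail κ 1≤κ using (n₀; weight; tail-≤; potential-≤0; θ; 0≼θ)

    finds-far : n₀ ≤ n → ∀ z₀ → z₀ ⊨ F → Finds fair (rate n) (Far κ (Diam F)) z₀ ⊎ Finds lazy (rate n) (Far κ (Diam F)) z₀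
    finds-far n₀≤n z₀ z₀⊨F = go (farthest F z₀ z₀⊨F)
      where
      go : ∃[ z ] z ⊨ F × Diam F ≤ 2 * d-H z₀ z → Finds fair (rate n) (Far κ (Diam F)) z₀ ⊎ Finds lazy (rate n) (Far κ (Diam F)) z₀
      go (z , z⊨F , D≤) = cases (suc c * r ≤? n)
        where
        r = d-H z₀ z
        Q = suc (square-1 κ)
        far-z : Far κ (Diam F) r
        far-z = Far-if κ P P≡ {Diam F} {r} {r} D≤
          (≤-trans (*-monoˡ-≤ r {P} {Q} (≤-trans (m≤n+m P (4 * (2 + κ))) (≤-reflexive P≡))) (≤-reflexive (*-comm Q r)))
        rate≤u : rate n ≼ pow u n
        rate≤u = subst (rate n ≼_) (ℚₚ.*-identityˡ (pow u n))
          (ℚₚ.*-monoʳ-≤-nonNeg (pow u n) {{ℚ.nonNegative (0≼pow n 0≼u)}} {¼} {1ℚ} (ℚₚ.≤ᵇ⇒≤ {¼} {1ℚ} tt))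
        -- If y misses the ratio, the triangle inequality leaves at least 4(k-1)/(k-2)² · r for its
        -- distance from z. With r > n/(c+1), `far-good` raises this to n/(k-1), the distance from
        -- which the potential is nonpositive.
        missed : ¬ suc c * r ≤ n → ∀ y → ¬ P * r ≤ d-H z₀ y * Q → n ≤ d-H y z * (2 + κ)
        missed ¬near y ¬far = *-cancelˡ-≤ (4 * (2 + κ)) (begin
          4 * (2 + κ) * n ≤⟨ *-monoʳ-≤ (4 * (2 + κ)) {n} {suc c * r} (<⇒≤ (≰⇒> ¬near)) ⟩
          4 * (2 + κ) * (suc c * r)             ≡⟨ eq₁ (4 * (2 + κ)) (suc c) r ⟩
          suc c * (4 * (2 + κ) * r) ≤⟨ *-monoʳ-≤ (suc c) {4 * (2 + κ) * r} {Q * e} surplus ⟩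
          suc c * (Q * e) ≡⟨ trans (sym (*-assoc (suc c) Q e)) (cong (λ q → suc c * q * e) {Q} {(1 + κ) * (1 + κ)} (eq₂ κ)) ⟩
          suc c * ((1 + κ) * (1 + κ)) * e ≤⟨ *-monoˡ-≤ e {suc c * ((1 + κ) * (1 + κ))} {4 * ((2 + κ) * (2 + κ))} (Split.far-good s) ⟩
          4 * ((2 + κ) * (2 + κ)) * e           ≡⟨ eq₃ κ e ⟩
          4 * (2 + κ) * (e * (2 + κ))           ∎)
          where
          open ≤-Reasoning
          d = d-H z₀ y
          e = d-H y z
          eq₁ : ∀ a b r → a * (b * r) ≡ b * (a * r)
          eq₁ = solve-∀
          eq₂ : ∀ κ → suc (κ * 1 + κ * (suc κ * 1)) ≡ (1 + κ) * (1 + κ)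
          eq₂ = solve-∀
          eq₃ : ∀ κ e → 4 * ((2 + κ) * (2 + κ)) * e ≡ 4 * (2 + κ) * (e * (2 + κ))
          eq₃ = solve-∀
          surplus : 4 * (2 + κ) * r ≤ Q * e
          surplus = +-cancelʳ-≤ (P * r) (4 * (2 + κ) * r) (Q * e) (begin
            4 * (2 + κ) * r + P * r     ≡⟨ *-distribʳ-+ r (4 * (2 + κ)) P ⟨
            (4 * (2 + κ) + P) * r       ≡⟨ cong (_* r) {4 * (2 + κ) + P} {Q} P≡ ⟩
            Q * r                       ≤⟨ *-monoʳ-≤ Q {r} {d + e} (d-H-triangle z₀ y z) ⟩
            Q * (d + e)                 ≡⟨ *-distribˡ-+ Q d e ⟩
            Q * d + Q * e ≡⟨ trans (cong (_+ Q * e) {Q * d} {d * Q} (*-comm Q d)) (+-comm (d * Q) (Q * e)) ⟩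
            Q * e + d * Q               ≤⟨ +-monoʳ-≤ (Q * e) {d * Q} {P * r} (<⇒≤ (≰⇒> ¬far)) ⟩
            Q * e + P * r               ∎)
        near? : ¬ suc c * r ≤ n → ∀ y → y ⊨ F → Far κ (Diam F) (d-H z₀ y) ⊎ Walk.potential drift (weight n) (d-H y z) ≼ 0ℚ
        near? ¬near y _ = decide (P * r ≤? d-H z₀ y * Q)
          where
          decide : Dec (P * r ≤ d-H z₀ y * Q) → Far κ (Diam F) (d-H z₀ y) ⊎ Walk.potential drift (weight n) (d-H y z) ≼ 0ℚ
          decide (yes far) = inj₁ (Far-if κ P P≡ {Diam F} {r} {d-H z₀ y} D≤ far)
          decide (no ¬far) = inj₂ (potential-≤0 n (d-H y z) (missed ¬near y ¬far))
        cases : Dec (suc c * r ≤ n) → Finds fair (rate n) (Far κ (Diam F)) z₀ ⊎ Finds lazy (rate n) (Far κ (Diam F)) z₀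
        cases (yes near) = inj₂ (finds-mono {lazy} {hitChance z₀ z} {rate n} {Far κ (Diam F)} {z₀}
          (ℚₚ.≤-trans rate≤u (Near.hitChance-≥ κ c s z₀ z near))
          (finds-lazy {Far κ (Diam F)} {z₀} {z} (s≤s z≤n) z⊨F far-z))
        cases (no ¬near) = inj₁ (finds-mono {fair} {pow (mean 1ℚ x) n ℚ.- weight n ℚ.* pow (mean 1ℚ X) n ℚ.- pow μ ((2 + n) * speed)} {rate n} {Far κ (Diam F)} {z₀}
          (rate-≤ {weight n} (tail-≤ n n₀≤n))
          (finds-fair {weight n} {Far κ (Diam F)} {z₀} {z} (0≼pow (n / (2 + κ)) 0≼θ) z⊨F (near? ¬near)))

  success-chance : Satisfiable F → (∀ z₀ → z₀ ⊨ F → Far κ (Diam F) 0 ⊎ (Finds fair (rate n) (Far κ (Diam F)) z₀ ⊎ Finds lazy (rate n) (Far κ (Diam F)) z₀)) →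
    ∀ z (h : Assignment n × Assignment n → ℚ) → (∀ zs → 0ℚ ≼ h zs) →
    (∀ z₀ z₁ → z₀ ⊨ F → z₁ ⊨ F → Far κ (Diam F) (d-H z₀ z₁) → 1ℚ ≼ h (z₀ , z₁)) →
    1ℚ ℚ.- frac 8 (3 + n) ≼ E (algorithm F ((2 + n) * speed) (rounds n n) z) h
  success-chance sat second z h 0≤h h-good = ℚₚ.≤-trans (success-≥ n)
    (algorithm-succeeds {Far = Far κ (Diam F)} (λ d → _ ℚₚ.≤? _) (λ {d} {e} → Far-up κ (Diam F) {d} {e}) (0≼rate n) (rate≼1 n)
      (finds-solution sat) second (rounds n n) z h 0≤h h-good)

-- The exponent

-- 1 + N/d ≤ (1 + 1/d) ^ N, cleared of denominators.
bernoulli-ℕ : ∀ d N → (d + N) * d ^ N ≤ d * suc d ^ N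
bernoulli-ℕ d zero    = ≤-reflexive (cong (_* 1) (+-identityʳ d))
bernoulli-ℕ d (suc N) = begin
  (d + suc N) * (d * d ^ N)             ≤⟨ m≤m+n _ (N * d ^ N) ⟩
  (d + suc N) * (d * d ^ N) + N * d ^ N ≡⟨ eq d N (d ^ N) ⟩
  suc d * ((d + N) * d ^ N)             ≤⟨ *-monoʳ-≤ (suc d) (bernoulli-ℕ d N) ⟩
  suc d * (d * suc d ^ N)               ≡⟨ eq₂ (suc d) d (suc d ^ N) ⟩
  d * (suc d * suc d ^ N)               ∎
  where
  open ≤-Reasoning
  eq : ∀ d N q → (d + suc N) * (d * q) + N * q ≡ suc d * ((d + N) * q)
  eq = solve-∀
  eq₂ : ∀ a b c → a * (b * c) ≡ b * (a * c)
  eq₂ = solve-∀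

module Exponent (κ : ℕ) where

  open Growth κ using (A; B)

  k w : ℕ
  k = 3 + κ
  w = 5 + 2 * κ

  -- (1 + 1/J)^J ≤ (1 + 1/(kJ))^(kJ) ≤ ((2k+1)/(2k-1))^k.
  compound : ∀ j → let J = suc j in suc J ^ J * w ^ k ≤ J ^ J * B ^ k
  compound j = *-cancelʳ-≤ _ _ ((k * J) ^ (k * J)) {{m^n≢0 (k * J) (k * J)}} (begin
    suc J ^ J * w ^ k * (k * J) ^ (k * J)         ≡⟨ eq (suc J ^ J) (w ^ k) ((k * J) ^ (k * J)) ⟩
    suc J ^ J * (k * J) ^ (k * J) * w ^ k ≡⟨ cong (λ p → suc J ^ J * p * w ^ k) (^-*-assoc (k * J) k J) ⟨
    suc J ^ J * ((k * J) ^ k) ^ J * w ^ k ≡⟨ cong (_* w ^ k) (^-distribʳ-* (suc J) ((k * J) ^ k) J) ⟨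
    (suc J * (k * J) ^ k) ^ J * w ^ k             ≤⟨ *-monoˡ-≤ (w ^ k) (^-monoˡ-≤ J small) ⟩
    (J * suc (k * J) ^ k) ^ J * w ^ k ≡⟨ cong (_* w ^ k) (^-distribʳ-* J (suc (k * J) ^ k) J) ⟩
    J ^ J * (suc (k * J) ^ k) ^ J * w ^ k ≡⟨ trans (*-assoc (J ^ J) _ (w ^ k)) (cong (λ p → J ^ J * (p * w ^ k)) (^-comm (suc (k * J)) k J)) ⟩
    J ^ J * ((suc (k * J) ^ J) ^ k * w ^ k) ≡⟨ cong (J ^ J *_) (^-distribʳ-* (suc (k * J) ^ J) w k) ⟨
    J ^ J * (suc (k * J) ^ J * w) ^ k             ≤⟨ *-monoʳ-≤ (J ^ J) (^-monoˡ-≤ k large) ⟩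
    J ^ J * ((k * J) ^ J * B) ^ k ≡⟨ cong (J ^ J *_) (trans (^-distribʳ-* ((k * J) ^ J) B k) (cong (_* B ^ k) (trans (^-comm (k * J) J k) (^-*-assoc (k * J) k J)))) ⟩
    J ^ J * ((k * J) ^ (k * J) * B ^ k)           ≡⟨ eq₂ (J ^ J) ((k * J) ^ (k * J)) (B ^ k) ⟩
    J ^ J * B ^ k * (k * J) ^ (k * J)             ∎)
    where
    open ≤-Reasoning
    J = suc j
    eq : ∀ a b c → a * b * c ≡ a * c * b
    eq = solve-∀
    eq₂ : ∀ a b c → a * (b * c) ≡ a * c * b
    eq₂ = solve-∀
    small : suc J * (k * J) ^ k ≤ J * suc (k * J) ^ k
    small = *-cancelˡ-≤ k (subst₂ _≤_ (eq₃ k J ((k * J) ^ k)) (*-assoc k J (suc (k * J) ^ k)) (bernoulli-ℕ (k * J) k))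
      where
      eq₃ : ∀ k J p → (k * J + k) * p ≡ k * (suc J * p)
      eq₃ = solve-∀
    large : suc (k * J) ^ J * w ≤ (k * J) ^ J * B
    large = *-cancelʳ-≤ _ _ J (subst₂ _≤_
      (trans (cong (λ q → q ^ J * (J * w)) (+-comm (k * J) 1)) (eq₄ (suc (k * J) ^ J) J w))
      (trans (cong ((k * J) ^ J *_) (eq₅ κ J)) (sym (*-assoc ((k * J) ^ J) B J)))
      (power-≤ (k * J) 1 J (J * w) (eq₆ κ J)))
      where
      eq₄ : ∀ p J w → p * (J * w) ≡ p * w * J
      eq₄ = solve-∀
      eq₅ : ∀ κ J → 2 * ((3 + κ) * J) + J * 1 ≡ (7 + 2 * κ) * J
      eq₅ = solve-∀
      eq₆ : ∀ κ J → J * 1 + J * (5 + 2 * κ) ≡ 2 * ((3 + κ) * J)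
      eq₆ = solve-∀

  -- Σ 1/j over m < j ≤ m+l bounds the telescoping product of all (j+1)/j.
  harmonic-power : ∀ m l u v → harmonicBlock m l ≼ frac u v →
    (suc m + l) ^ suc v * w ^ (k * u) ≤ suc m ^ suc v * B ^ (k * u)
  harmonic-power m zero    u v _  = *-mono-≤ (≤-reflexive (cong (_^ suc v) (+-identityʳ (suc m))))
    (^-monoˡ-≤ (k * u) (+-monoˡ-≤ (2 * κ) (m≤m+n 5 2)))
  harmonic-power m (suc l) u v le = ^-cancel-≤ J (*-cancelʳ-≤ _ _ (J ^ (V * J)) {{m^n≢0 J (V * J)}} (begin
    ((suc m + suc l) ^ V * w ^ (k * u)) ^ J * J ^ (V * J) ≡⟨ cong (λ q → (q ^ V * w ^ (k * u)) ^ J * J ^ (V * J)) (+-suc (suc m) l) ⟩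
    (suc J ^ V * w ^ (k * u)) ^ J * J ^ (V * J) ≡⟨ cong (_* J ^ (V * J)) (trans (^-distribʳ-* (suc J ^ V) (w ^ (k * u)) J) (cong₂ _*_ (^-comm (suc J) V J) (split-power w))) ⟩
    (suc J ^ J) ^ V * ((w ^ k) ^ V * w ^ (k * u₂)) * J ^ (V * J) ≡⟨ eq ((suc J ^ J) ^ V) ((w ^ k) ^ V) (w ^ (k * u₂)) (J ^ (V * J)) ⟩
    ((suc J ^ J) ^ V * (w ^ k) ^ V) * (J ^ (V * J) * w ^ (k * u₂)) ≤⟨ *-mono-≤ factor (harmonic-power m l u₂ (j + v * J) H≤) ⟩
    ((J ^ J) ^ V * (B ^ k) ^ V) * (suc m ^ (V * J) * B ^ (k * u₂)) ≡⟨ eq₂ ((J ^ J) ^ V) ((B ^ k) ^ V) (suc m ^ (V * J)) (B ^ (k * u₂)) ⟩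
    suc m ^ (V * J) * ((B ^ k) ^ V * B ^ (k * u₂)) * (J ^ J) ^ V ≡⟨ cong₂ _*_ (cong₂ _*_ (sym (^-*-assoc (suc m) V J)) (sym (split-power B))) (trans (^-*-assoc J J V) (cong (J ^_) (*-comm J V))) ⟩
    (suc m ^ V) ^ J * (B ^ (k * u)) ^ J * J ^ (V * J) ≡⟨ cong (_* J ^ (V * J)) (^-distribʳ-* (suc m ^ V) (B ^ (k * u)) J) ⟨
    (suc m ^ V * B ^ (k * u)) ^ J * J ^ (V * J)                     ∎))
    where
    open ≤-Reasoning
    j J V u₂ : ℕ
    j  = m + l
    J  = suc j
    V  = suc v
    -- u/V - 1/J = u₂/(V J); the truncated subtraction is exact by `V≤uJ`.
    u₂ = u * J ∸ V
    0≼H : ∀ l → 0ℚ ≼ harmonicBlock m l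
    0≼H zero    = ≼-refl
    0≼H (suc l) = 0≼+ (0≼H l) (0≼frac 1 (m + l))
    V≤uJ : V ≤ u * J
    V≤uJ = subst (_≤ u * J) (*-identityˡ V) (frac-≼⁻¹ {1} {j} {u} {v} (ℚₚ.≤-trans
      (subst (_≼ harmonicBlock m (suc l)) (ℚₚ.+-identityˡ (frac 1 j)) (ℚₚ.+-monoˡ-≤ (frac 1 j) (0≼H l))) le))
    H≤ : harmonicBlock m l ≼ frac u₂ (j + v * J)
    H≤ = 0≼⇒≼ (subst (0ℚ ≼_) (lemma (harmonicBlock m l) (frac 1 j) (frac u₂ (j + v * J))) (≼⇒0≼ (ℚₚ.≤-trans le (ℚₚ.≤-reflexive sum))))
      where
      lemma : ∀ h q r → (r ℚ.+ q) ℚ.- (h ℚ.+ q) ≡ r ℚ.- h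
      lemma = RingSolver.solve-∀ ℚ-ring
      eq₃ : ∀ u V J w → u * (J * w) ≡ u * J * w
      eq₃ = solve-∀
      sum : frac u v ≡ frac u₂ (j + v * J) ℚ.+ frac 1 j
      sum = sym (trans (frac-+ u₂ (j + v * J) 1 j) (frac-≡ {u₂ * J + 1 * (V * J)} {j + (j + v * J) * J} {u} {v} (begin-equality
        (u₂ * J + 1 * (V * J)) * V        ≡⟨ cong (_* V) (eq₄ u₂ J V) ⟩
        (u₂ + V) * J * V                  ≡⟨ cong (λ q → q * J * V) (m∸n+n≡m V≤uJ) ⟩
        u * J * J * V                     ≡⟨ eq₅ u J v ⟩
        u * (V * J * J)                   ∎)))
        where
        eq₄ : ∀ u J V → u * J + 1 * (V * J) ≡ (u + V) * J
        eq₄ = solve-∀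
        eq₅ : ∀ u J v → u * J * J * suc v ≡ u * (suc v * J * J)
        eq₅ = solve-∀
    split-power : ∀ b → (b ^ (k * u)) ^ J ≡ (b ^ k) ^ V * b ^ (k * u₂)
    split-power b = begin-equality
      (b ^ (k * u)) ^ J                 ≡⟨ ^-*-assoc b (k * u) J ⟩
      b ^ (k * u * J) ≡⟨ cong (b ^_) (trans (*-assoc k u J) (cong (k *_) (sym (m+[n∸m]≡n V≤uJ)))) ⟩
      b ^ (k * (V + u₂))                ≡⟨ cong (b ^_) (*-distribˡ-+ k V u₂) ⟩
      b ^ (k * V + k * u₂)              ≡⟨ ^-distribˡ-+-* b (k * V) (k * u₂) ⟩
      b ^ (k * V) * b ^ (k * u₂)        ≡⟨ cong (_* b ^ (k * u₂)) (^-*-assoc b k V) ⟨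
      (b ^ k) ^ V * b ^ (k * u₂)        ∎
    factor : (suc J ^ J) ^ V * (w ^ k) ^ V ≤ (J ^ J) ^ V * (B ^ k) ^ V
    factor = subst₂ _≤_ (^-distribʳ-* (suc J ^ J) (w ^ k) V) (^-distribʳ-* (J ^ J) (B ^ k) V) (^-monoˡ-≤ V (compound j))
    eq : ∀ a b c d → a * (b * c) * d ≡ (a * b) * (d * c)
    eq = solve-∀
    eq₂ : ∀ a b c d → (a * b) * (c * d) ≡ c * (b * d) * a
    eq₂ = solve-∀

  -- For l = m + 1 the product telescopes to (2m+2)/(m+1) = 2. The result, 2 ≤ (B/w) ^ (k q) for
  -- rational q > ln 2, is the form in which e^(1/k) ≤ B/w is used.
  ln2-power : ∀ u v → ln2 (frac u v) → 2 ^ suc v * w ^ (k * u) ≤ B ^ (k * u)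
  ln2-power u v (m , H<) = *-cancelˡ-≤ (suc m ^ suc v) {{m^n≢0 (suc m) (suc v)}} (begin
    suc m ^ suc v * (2 ^ suc v * w ^ (k * u)) ≡⟨ *-assoc (suc m ^ suc v) (2 ^ suc v) (w ^ (k * u)) ⟨
    suc m ^ suc v * 2 ^ suc v * w ^ (k * u) ≡⟨ cong (_* w ^ (k * u)) (^-distribʳ-* (suc m) 2 (suc v)) ⟨
    (suc m * 2) ^ suc v * w ^ (k * u) ≡⟨ cong (λ q → q ^ suc v * w ^ (k * u)) (eq (suc m)) ⟩
    (suc m + suc m) ^ suc v * w ^ (k * u)         ≤⟨ harmonic-power m (suc m) u v (ℚₚ.<⇒≤ H<) ⟩
    suc m ^ suc v * B ^ (k * u)                   ∎)
    where
    open ≤-Reasoning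
    eq : ∀ m → m * 2 ≡ m + m
    eq = solve-∀

  -- As A = 2 w, the claim is 2 ^ (1-r) ≤ B/w for r = a/(b+1). Some rational q > ln 2 has 1 - r <
  -- 1/(k q), and `ln2-power` gives 2 ^ (1/(k q)) ≤ B/w. The K-th powers, with K the denominator of
  -- 1/(k q), clear the roots.
  exponent-power : ∀ a b → exponent k (s≤s (s≤s (s≤s z≤n))) (frac a b) → A ^ suc b ≤ 2 ^ a * B ^ suc b
  exponent-power a b (u′ , v′ , ln2<q , bound<) = ^-cancel-≤ K (begin
    (A ^ suc b) ^ K                               ≡⟨ cong (λ q → (q ^ suc b) ^ K) (eq κ) ⟩
    ((2 * w) ^ suc b) ^ K ≡⟨ trans (^-*-assoc (2 * w) (suc b) K) (^-distribʳ-* 2 w (suc b * K)) ⟩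
    2 ^ (suc b * K) * w ^ (suc b * K) ≤⟨ *-monoˡ-≤ (w ^ (suc b * K)) (^-monoʳ-≤ 2 exponents) ⟩
    2 ^ (a * K + v * suc b) * w ^ (suc b * K) ≡⟨ cong₂ _*_ (^-distribˡ-+-* 2 (a * K) (v * suc b)) (trans (cong (w ^_) (*-comm (suc b) K)) (sym (^-*-assoc w K (suc b)))) ⟩
    2 ^ (a * K) * 2 ^ (v * suc b) * (w ^ K) ^ suc b ≡⟨ trans (*-assoc (2 ^ (a * K)) _ _) (cong (λ q → 2 ^ (a * K) * (q * (w ^ K) ^ suc b)) (sym (^-*-assoc 2 v (suc b)))) ⟩
    2 ^ (a * K) * ((2 ^ v) ^ suc b * (w ^ K) ^ suc b) ≡⟨ cong₂ _*_ (sym (^-*-assoc 2 a K)) (sym (^-distribʳ-* (2 ^ v) (w ^ K) (suc b))) ⟩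
    (2 ^ a) ^ K * (2 ^ v * w ^ K) ^ suc b ≤⟨ *-monoʳ-≤ ((2 ^ a) ^ K) (^-monoˡ-≤ (suc b) (ln2-power (suc u′) v′ ln2<q)) ⟩
    (2 ^ a) ^ K * (B ^ K) ^ suc b                 ≡⟨ cong ((2 ^ a) ^ K *_) (^-comm B K (suc b)) ⟩
    (2 ^ a) ^ K * (B ^ suc b) ^ K                 ≡⟨ ^-distribʳ-* (2 ^ a) (B ^ suc b) K ⟨
    (2 ^ a * B ^ suc b) ^ K                       ∎)
    where
    open ≤-Reasoning
    K v c : ℕ
    K = k * suc u′
    v = suc v′
    c = u′ + (2 + κ) * suc u′
    eq : ∀ κ → 10 + 4 * κ ≡ 2 * (5 + 2 * κ)
    eq = solve-∀
    one< : 1ℚ ℚ.< frac a b ℚ.+ frac v c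
    one< = subst (ℚ._< frac a b ℚ.+ frac v c) (lemma (frac v c)) (ℚₚ.+-monoˡ-< (frac v c) bound<)
      where
      lemma : ∀ q → (1ℚ ℚ.- q) ℚ.+ q ≡ 1ℚ
      lemma = RingSolver.solve-∀ ℚ-ring
    exponents : suc b * K ≤ a * K + v * suc b
    exponents = <⇒≤ (subst₂ _<_ (eq₂ b c) (*-identityʳ (a * suc c + v * suc b))
      (frac-<⁻¹ {1} {0} {a * suc c + v * suc b} {c + b * suc c} (subst (1ℚ ℚ.<_) (frac-+ a b v c) one<)))
      where
      eq₂ : ∀ b c → 1 * suc (c + b * suc c) ≡ suc b * suc c
      eq₂ = solve-∀

-- The running time and the theorem

IsPolynomial : (ℕ → ℕ) → Set
IsPolynomial f = ∃[ C ] ∃[ d ] ∀ n → f n ≤ C * suc n ^ d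

const-polynomial : ∀ c → IsPolynomial (λ _ → c)
const-polynomial c = c , 0 , λ n → ≤-reflexive (sym (*-identityʳ c))

id-polynomial : IsPolynomial (λ n → n)
id-polynomial = 1 , 1 , λ n → ≤-trans (n≤1+n n) (≤-reflexive (sym (trans (+-identityʳ _) (*-identityʳ (suc n)))))

^-polynomial : ∀ c → IsPolynomial (_^ c)
^-polynomial c = 1 , c , λ n → ≤-trans (^-monoˡ-≤ c (n≤1+n n)) (≤-reflexive (sym (+-identityʳ (suc n ^ c))))

infixl 6 _+-polynomial_
infixl 7 _*-polynomial_

_+-polynomial_ : ∀ {f g} → IsPolynomial f → IsPolynomial g → IsPolynomial (λ n → f n + g n)
(C , d , f≤) +-polynomial (C′ , d′ , g≤) = C + C′ , d + d′ , λ n → ≤-trans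
  (+-mono-≤ (≤-trans (f≤ n) (*-monoʳ-≤ C (^-monoʳ-≤ (suc n) (m≤m+n d d′))))
            (≤-trans (g≤ n) (*-monoʳ-≤ C′ (^-monoʳ-≤ (suc n) (m≤n+m d′ d)))))
  (≤-reflexive (sym (*-distribʳ-+ (suc n ^ (d + d′)) C C′)))

_*-polynomial_ : ∀ {f g} → IsPolynomial f → IsPolynomial g → IsPolynomial (λ n → f n * g n)
(C , d , f≤) *-polynomial (C′ , d′ , g≤) = C * C′ , d + d′ , λ n → ≤-trans (*-mono-≤ (f≤ n) (g≤ n))
  (≤-reflexive (trans (eq C C′ (suc n ^ d) (suc n ^ d′)) (cong (C * C′ *_) (sym (^-distribˡ-+-* (suc n) d d′)))))
  where
  eq : ∀ C C′ p q → C * p * (C′ * q) ≡ C * C′ * (p * q)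
  eq = solve-∀

get-nils : ∀ m x → get (List.replicate m nil) x ≡ nil
get-nils zero    x       = refl
get-nils (suc m) zero    = refl
get-nils (suc m) (suc x) = get-nils m x

decode-encode : ∀ {n} (y : Assignment n) → decodeAssignment n (encodeA y) ≡ just y
decode-encode []          = refl
decode-encode (false ∷ y) rewrite decode-encode y = refl
decode-encode (true ∷ y)  rewrite decode-encode y = refl

decodePair-encode : ∀ {n} (y z : Assignment n) → decodePair n (encodeA y ∙ encodeA z) ≡ just (y , z)
decodePair-encode y z rewrite decode-encode y | decode-encode z = refl

module Time (κ c : ℕ) where

  open Constants κ
  open Growth κ using (A; g; B; rounds-≤; growTime-≤; refuel-≡)
  open Main β leaf speed A g
  open MainWin β leaf speed A g

  clauseBound literalBound checkBound stepBound : ℕ → ℕ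
  clauseBound n = n ^ c + c
  literalBound n     = 12 + n * 4
  checkBound n       = clauseBound n * (9 + k * literalBound n)
  stepBound n        = 12 + (checkBound n + (β * 3 + (12 + n * 10)))

  walkSteps : ℕ → ℕ
  walkSteps n = (2 + n) * speed

  searchBound : ℕ → ℕ → ℕ
  searchBound τ n = 17 + (n * (11 + τ) + walkSteps n * stepBound n)

  loops overhead : ℕ → ℕ
  loops n    = (4 + searchBound 1 n) + (4 + (searchBound 1 n + (18 + n * 12) + (searchBound 8 n + (18 + n * 12))))
  overhead n = (25 + n * 16) + loops n

  -- `rounds-≤` controls the number of rounds only together with A B, hence the sum; the other
  -- factor is polynomial.
  T-bound : ℕ → ℕ
  T-bound n = (rounds n n + A * B) * overhead n

  walkLength-≡ : ∀ n → refuel n (2 * speed + 0) ≡ walkSteps n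
  walkLength-≡ n = trans (refuel-≡ n (2 * speed + 0)) (eq n speed)
    where
    eq : ∀ n s → n * s + (2 * s + 0) ≡ (2 + n) * s
    eq = solve-∀

  abstract
    overhead-polynomial : IsPolynomial (λ n → (n + A * B) * overhead n)
    overhead-polynomial = (id-polynomial +-polynomial num (A * B)) *-polynomial
      ((num 25 +-polynomial id-polynomial *-polynomial num 16) +-polynomial
       ((num 4 +-polynomial search 1) +-polynomial (num 4 +-polynomial (search 1 +-polynomial improve′ +-polynomial (search 8 +-polynomial improve′)))))
      where
      num : ∀ a → IsPolynomial (λ _ → a)
      num = const-polynomial
      improve′ : IsPolynomial (λ n → 18 + n * 12)
      improve′ = num 18 +-polynomial id-polynomial *-polynomial num 12
      step′ : IsPolynomial stepBound
      step′ = num 12 +-polynomial ((^-polynomial c +-polynomial num c) *-polynomial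
          (num 9 +-polynomial num k *-polynomial (num 12 +-polynomial id-polynomial *-polynomial num 4)) +-polynomial
        (num (β * 3) +-polynomial (num 12 +-polynomial id-polynomial *-polynomial num 10)))
      search : ∀ τ → IsPolynomial (searchBound τ)
      search τ = num 17 +-polynomial (id-polynomial *-polynomial num (11 + τ) +-polynomial
        ((num 2 +-polynomial id-polynomial) *-polynomial num speed) *-polynomial step′)

  T-bound∈O* : T-bound ∈O*2^[ exponent (3 + κ) (s≤s (s≤s (s≤s z≤n))) ·n]
  T-bound∈O* = C , d , bound
    where
    open ≤-Reasoning
    C d : ℕ
    C = proj₁ overhead-polynomial
    d = proj₁ (proj₂ overhead-polynomial)
    poly≤ : ∀ n → (n + A * B) * overhead n ≤ C * suc n ^ d
    poly≤ = proj₂ (proj₂ overhead-polynomial)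
    T≤ : ∀ n → T-bound n * B ^ n ≤ C * suc n ^ d * A ^ n
    T≤ n = begin
      (rounds n n + A * B) * overhead n * B ^ n ≡⟨ eq (rounds n n + A * B) (overhead n) (B ^ n) ⟩
      (rounds n n + A * B) * B ^ n * overhead n ≤⟨ *-monoˡ-≤ (overhead n) {(rounds n n + A * B) * B ^ n} {(n + A * B) * A ^ n} (rounds-≤ n n) ⟩
      (n + A * B) * A ^ n * overhead n                ≡⟨ eq (n + A * B) (A ^ n) (overhead n) ⟩
      (n + A * B) * overhead n * A ^ n ≤⟨ *-monoˡ-≤ (A ^ n) {(n + A * B) * overhead n} {C * suc n ^ d} (poly≤ n) ⟩
      C * suc n ^ d * A ^ n                           ∎
      where
      eq : ∀ a b c → a * b * c ≡ a * c * b
      eq = solve-∀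
    bound : ∀ n a b .{{_ : NonZero b}} → exponent (3 + κ) (s≤s (s≤s (s≤s z≤n))) (+ a ℚ./ b) →
      T-bound n ^ b ≤ (C * suc n ^ d) ^ b * 2 ^ (a * n)
    bound n a (suc b) ex = *-cancelʳ-≤ (T-bound n ^ suc b) (poly ^ suc b * 2 ^ (a * n)) ((B ^ n) ^ suc b) {{m^n≢0 (B ^ n) (suc b) {{m^n≢0 B n}}}} (begin
      T-bound n ^ suc b * (B ^ n) ^ suc b ≡⟨ ^-distribʳ-* (T-bound n) (B ^ n) (suc b) ⟨
      (T-bound n * B ^ n) ^ suc b                       ≤⟨ ^-monoˡ-≤ (suc b) (T≤ n) ⟩
      (poly * A ^ n) ^ suc b ≡⟨ trans (^-distribʳ-* poly (A ^ n) (suc b)) (cong (poly ^ suc b *_) (^-comm A n (suc b))) ⟩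
      poly ^ suc b * (A ^ suc b) ^ n ≤⟨ *-monoʳ-≤ (poly ^ suc b) (^-monoˡ-≤ n (Exponent.exponent-power κ a b ex)) ⟩
      poly ^ suc b * (2 ^ a * B ^ suc b) ^ n ≡⟨ cong (poly ^ suc b *_) (trans (^-distribʳ-* (2 ^ a) (B ^ suc b) n) (cong₂ _*_ (^-*-assoc 2 a n) (^-comm B (suc b) n))) ⟩
      poly ^ suc b * (2 ^ (a * n) * (B ^ n) ^ suc b) ≡⟨ *-assoc (poly ^ suc b) (2 ^ (a * n)) ((B ^ n) ^ suc b) ⟨
      poly ^ suc b * 2 ^ (a * n) * (B ^ n) ^ suc b         ∎)
      where
      poly = C * suc n ^ d

  module _ {Good : Tree → Set} {n} (F : CNF n) (F≤ : IsKCNF k F) (F-short : length F ≤ clauseBound n) where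

    searchTime-≤ : ∀ τ → searchTime {Good} F F≤ τ (walkLength {Good} F F≤) ≤ searchBound τ n
    searchTime-≤ τ = +-monoʳ-≤ 17 (+-monoʳ-≤ (n * (11 + τ)) (*-mono-≤ (≤-reflexive (walkLength-≡ n))
      (+-monoʳ-≤ 12 (+-monoˡ-≤ _ (*-monoˡ-≤ (9 + k * literalBound n) F-short)))))

    mainTime-≤ : mainTime {Good} F F≤ ≤ T-bound n
    mainTime-≤ = begin
      24 + (n * 4 + growTime n n + N * f + N * r) ≤⟨ +-monoʳ-≤ 24 (+-mono-≤ (+-mono-≤ (+-monoʳ-≤ (n * 4) (growTime-≤ n n)) (*-monoʳ-≤ N f≤)) (*-monoʳ-≤ N r≤)) ⟩
      24 + (n * 4 + (1 + n * (8 + N * 4)) + N * f′ + N * r′) ≤⟨ m≤m+n _ (25 * N + 12 * (n * N) + 4 * n + f′ + r′) ⟩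
      24 + (n * 4 + (1 + n * (8 + N * 4)) + N * f′ + N * r′) + (25 * N + 12 * (n * N) + 4 * n + f′ + r′) ≡⟨ eq N n f′ r′ ⟩
      (N + 1) * ((25 + n * 16) + (f′ + r′)) ≤⟨ *-monoˡ-≤ (overhead n) (+-monoʳ-≤ N (s≤s z≤n)) ⟩
      T-bound n                                                           ∎
      where
      open ≤-Reasoning
      N f r f′ r′ : ℕ
      N = rounds n n
      f = firstTime {Good} F F≤ (walkLength {Good} F F≤)
      r = roundTime {Good} F F≤ (walkLength {Good} F F≤)
      f′ = 4 + searchBound 1 n
      r′ = 4 + (searchBound 1 n + (18 + n * 12) + (searchBound 8 n + (18 + n * 12)))
      f≤ : f ≤ f′
      f≤ = +-monoʳ-≤ 4 (searchTime-≤ 1)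
      r≤ : r ≤ r′
      r≤ = +-monoʳ-≤ 4 (+-mono-≤ (+-monoˡ-≤ (18 + n * 12) (searchTime-≤ 1)) (+-monoˡ-≤ (18 + n * 12) (searchTime-≤ 8)))
      eq : ∀ N n f r → 24 + (n * 4 + (1 + n * (8 + N * 4)) + N * f + N * r) + (25 * N + 12 * (n * N) + 4 * n + f + r) ≡
                       (N + 1) * ((25 + n * 16) + (f + r))
      eq = solve-∀

threshold : ℕ → ℕ
threshold 0 = 0
threshold 1 = 0
threshold 2 = 0
threshold 3 = 0
threshold (suc (suc (suc (suc j)))) = Tail.n₀ (4 + j) (s≤s z≤n)

second-phase : ∀ κ {n} (F : CNF n) (F≤ : IsKCNF (3 + κ) F) → threshold κ ≤ n → ∀ z₀ → z₀ ⊨ F →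
  let open Constants κ ; open Growth κ ; open Phases drift F F≤ ((2 + n) * speed) in
  Far κ (Diam F) 0 ⊎ (Finds fair (rate n) (Far κ (Diam F)) z₀ ⊎ Finds lazy (rate n) (Far κ (Diam F)) z₀)
second-phase 0 F F≤ _ z₀ _ = inj₁ (Far-0 0 (Diam F) (≤ᵇ⇒≤ _ _ tt))
second-phase 1 F F≤ _ z₀ _ = inj₁ (Far-0 1 (Diam F) (≤ᵇ⇒≤ _ _ tt))
second-phase 2 F F≤ _ z₀ _ = inj₁ (Far-0 2 (Diam F) (≤ᵇ⇒≤ _ _ tt))
second-phase 3 F F≤ _ z₀ _ = inj₁ (Far-0 3 (Diam F) (≤ᵇ⇒≤ _ _ tt))
second-phase (suc (suc (suc (suc j)))) F F≤ n₀≤n z₀ z₀⊨F = inj₂ (finds-far (4 + j) F F≤ (proj₂ (split j)) (s≤s z≤n) (eq j) n₀≤n z₀ z₀⊨F)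
  where
  -- Here P = (k-2)² - 4(k-1) at k = 7 + j, positive from k = 7 on.
  eq : ∀ j → 4 * (6 + j) + (1 + 6 * j + j * j) ≡ suc ((4 + j) * 1 + (4 + j) * (suc (4 + j) * 1))
  eq = solve-∀

frac-little-o : ∀ a → IsLittleO1 (λ n → frac a (3 + n))
frac-little-o a (ℚ.mkℚ ℤ.-[1+ _ ] d _) (ℚ.*<* ())
frac-little-o a δ@(ℚ.mkℚ (+ p) d _) 0<δ = a * suc d , λ n n₀≤n →
  subst₂ ℚ._<_ (sym (ℚₚ.0≤p⇒∣p∣≡p (0≼frac a (3 + n)))) (ℚₚ.↥p/↧p≡p δ)
    (frac-< {a} {3 + n} {p} {d} (≤-trans (s≤s n₀≤n) (≤-trans (m≤n+m (suc n) 3) (≤-trans (≤-reflexive (sym (*-identityˡ (4 + n)))) (*-monoˡ-≤ (4 + n) 1≤p)))))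
  where
  1≤p : 1 ≤ p
  1≤p = subst₂ _≤_ refl (*-identityʳ p) (frac-<⁻¹ {0} {0} {p} {d} (subst (0ℚ ℚ.<_) (sym (ℚₚ.↥p/↧p≡p δ)) 0<δ))

theorem5 : ∀ (k : ℕ) (3≤k : 3 ≤ k) →
    ∃[ A ] ∀ (c : ℕ) →
    ∃[ T ] T ∈O*2^[ exponent k 3≤k ·n]
    × (∀ n (F : CNF n) → IsKCNF k F → length F ≤ n ^ c + c →
    HaltsWithin (T n) A (encodeCNF F))
    × ∃[ ε ] IsLittleO1 ε
    × (∀ n (F : CNF n) → IsKCNF k F → length F ≤ n ^ c + c → Satisfiable F →
    1ℚ ℚ.- ε n ℚ.≤ Pr (success? k 3≤k A F (T n)))
theorem5 (suc (suc (suc κ))) 3≤k@(s≤s (s≤s (s≤s z≤n))) = A , λ c →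
  -- Each phase fails with probability at most 4/(n+4). Adding the threshold to the numerator 8
  -- makes ε n ≥ 1 below the threshold, where nothing then remains to be shown.
  T-bound c , T-bound∈O* c , halts c , (λ n → frac (8 + threshold κ) (3 + n)) , frac-little-o (8 + threshold κ) , succeeds c
  where
  open Constants κ using (β; leaf; speed; drift)
  open Growth κ using (g) renaming (A to growth)
  open Programs β leaf speed growth (suc g) using (main)
  open MainWin β leaf speed growth g using (main-win)
  open Time κ using (T-bound; T-bound∈O*; mainTime-≤; walkLength-≡)

  A : Program
  A = main

  initially : ∀ {n} (F : CNF n) → initial A (encodeCNF F) ∼ (A ∷ [] , encodeCNF F ∷ List.replicate 13 nil)
  initially F = same refl λ { zero → refl ; (suc x) → sym (get-nils 13 x) }

  halts : ∀ c n (F : CNF n) → IsKCNF (3 + κ) F → length F ≤ n ^ c + c → HaltsWithin (T-bound c n) A (encodeCNF F)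
  halts c n F F≤ F-short = Win⇒halts
    -- With payoff 0 only the time bound of the derivation is used, so satisfiability is not
    -- assumed.
    (longer (mainTime-≤ c {λ _ → ⊤} F F≤ F-short) (main-win {Good = λ _ → ⊤} F F≤ (λ _ → 0ℚ) (λ _ → 0≼1) (λ _ _ → inj₁ ≼-refl)))
    (initially F)

  succeeds : ∀ c n (F : CNF n) → IsKCNF (3 + κ) F → length F ≤ n ^ c + c → Satisfiable F →
    1ℚ ℚ.- frac (8 + threshold κ) (3 + n) ℚ.≤ Pr (success? (3 + κ) 3≤k A F (T-bound c n))
  succeeds c n F F≤ F-short sat = ℚₚ.≤-trans (chance (threshold κ ≤? n)) (Win⇒Pr
    (longer (mainTime-≤ c {Good} F F≤ F-short) (main-win {Good} F F≤ h (λ zs → indicator≼1 (diverse? zs)) h-good))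
    (initially F) (success? (3 + κ) 3≤k A F (T-bound c n)) (λ _ → id))
    where
    open Algorithm β leaf
    open Main β leaf speed growth g using (rounds; refuel)
    Good : Tree → Set
    Good t = MaybeAny.Any (Diverse (3 + κ) 3≤k F) (decodePair n t)
    diverse? : ∀ zs → Dec (Diverse (3 + κ) 3≤k F zs)
    diverse? (z₀ , z₁) = (z₀ ⊨? F) ×-dec (z₁ ⊨? F) ×-dec (_ ℚₚ.≤? _)
    h : Assignment n × Assignment n → ℚ
    h zs = indicator (diverse? zs)
    h-good : ∀ z₀ z₁ → h (z₀ , z₁) ≼ 0ℚ ⊎ Good (encodeA z₀ ∙ encodeA z₁)
    h-good z₀ z₁ = decide (diverse? (z₀ , z₁))
      where
      decide : (d? : Dec (Diverse (3 + κ) 3≤k F (z₀ , z₁))) → indicator d? ≼ 0ℚ ⊎ Good (encodeA z₀ ∙ encodeA z₁)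
      decide (no _)  = inj₁ ≼-refl
      decide (yes d) = inj₂ (subst (MaybeAny.Any (Diverse (3 + κ) 3≤k F)) (sym (decodePair-encode z₀ z₁)) (MaybeAny.just d))
    z : Assignment n
    z = Vec.replicate n false
    t : ℕ
    t = refuel n (2 * speed + 0)
    lemma : ∀ q → q ℚ.- 1ℚ ≡ 0ℚ ℚ.- (1ℚ ℚ.- q)
    lemma = RingSolver.solve-∀ ℚ-ring
    chance : Dec (threshold κ ≤ n) → 1ℚ ℚ.- frac (8 + threshold κ) (3 + n) ≼ E (algorithm F t (rounds n n) z) h
    chance (yes n₀≤n) = ℚₚ.≤-trans
      (ℚₚ.+-monoʳ-≤ 1ℚ (ℚₚ.neg-antimono-≤ (frac-≼ {8} {3 + n} {8 + threshold κ} {3 + n} (*-monoˡ-≤ (4 + n) {8} {8 + threshold κ} (m≤m+n 8 (threshold κ))))))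
      (subst (λ t → 1ℚ ℚ.- frac 8 (3 + n) ≼ E (algorithm F t (rounds n n) z) h) (sym (walkLength-≡ c n))
        (success-chance κ F F≤ sat (second-phase κ F F≤ n₀≤n) z h (λ zs → 0≼indicator (diverse? zs))
          λ z₀ z₁ z₀⊨F z₁⊨F far → ℚₚ.≤-reflexive (sym (indicator-yes (diverse? (z₀ , z₁)) (z₀⊨F , z₁⊨F , far)))))
    chance (no n≱) = ℚₚ.≤-trans
      (0≼⇒≼ (subst (0ℚ ≼_) (lemma (frac (8 + threshold κ) (3 + n))) (≼⇒0≼ (frac-≼ {1} {0} {8 + threshold κ} {3 + n}
        (subst₂ _≤_ (sym (*-identityˡ (4 + n))) (sym (*-identityʳ (8 + threshold κ))) (+-mono-≤ (m≤m+n 4 4) (<⇒≤ (≰⇒> n≱))))))))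
      (0≼E (algorithm F t (rounds n n) z) λ zs → 0≼indicator (diverse? zs))
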